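{- The parameterized problem Stable Cutset[mod lin forest] is $\mathsf{MK[2]}$-hard under polynomial parameter transformations; i.e., every parameterized problem in $\mathsf{MK[2]}$ has a polynomial parameter transformation to Stable Cutset[mod lin forest].
   Context: All graphs are finite and simple. A stable cutset of a graph $G$ is a set $S\subseteq V(G)$ whose vertices are pairwise non-adjacent and such that $G-S$ is disconnected; the empty set is a stable cutset of any disconnected graph. A linear forest is a disjoint union of paths. Stable Cutset[mod lin forest]: input is a graph $G$ and $X\subseteq V(G)$ such that $G-X$ is a linear forest; parameter $|X|$; question: does $G$ have a stable cutset? A parameterized problem is a set $L\subseteq\Sigma^*\times\mathbb{N}$. A polynomial parameter transformation (PPT) from $Q$ to $Q'$ is a polynomial-time computable map $(x,k)\mapsto(x',k')$ with $(x,k)\in Q\iff(x',k')\in Q'$ and $k'$ bounded by a polynomial in $k$. Hitting Set[$n$]: input is a finite ground set $U$, a family $\mathcal{F}$ of subsets of $U$ and $k\in\mathbb{N}$; parameter $n=|U|$; question: is there $S\subseteq U$ with $|S|\le k$ and $S\cap F\neq\emptyset$ for all $F\in\mathcal{F}$? $\mathsf{MK[2]}$ is the class of all parameterized problems that have a PPT to Hitting Set[$n$]. -}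

module Defs where

open import Data.Bool using (Bool; true; false)
open import Data.Nat using (ℕ; zero; suc; _+_; _*_; _^_; _≤_)
open import Data.Fin using (Fin; toℕ)
open import Data.Fin.Subset using (Subset; _∈_; _∉_; ∣_∣)
open import Data.List using (List; []; _∷_; _++_; length; concatMap; replicate; map; lookup)
open import Data.List.Relation.Unary.All using (All)
open import Data.List.Relation.Unary.Any using (Any)
open import Data.List.Relation.Unary.Unique.Propositional using (Unique)
import Data.List.Membership.Propositional as LM
open import Data.Vec using (toList)
open import Data.Maybe using (Maybe; just; nothing)
open import Data.Product using (Σ; ∃; _×_; _,_; proj₁; proj₂)
open import Data.Sum using (_⊎_)
open import Relation.Binary.PropositionalEquality using (_≡_; _≢_)
open import Relation.Nullary using (¬_)

Str : Set
Str = List Bool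

ParamProblem : Set₁
ParamProblem = Str → ℕ → Set

-- Machine model: deterministic single-tape Turing machines with a
-- two-way infinite tape over {0,1,blank}.

data Sym : Set where
  s0 s1 blank : Sym

data Move : Set where
  L R N : Move

record TM : Set where
  field
    nQ : ℕ                                     -- states: Fin (suc nQ), start = zero
    δ  : Fin (suc nQ) → Sym → Maybe (Fin (suc nQ) × Sym × Move)
                                               -- nothing = halt

record Config (M : TM) : Set where
  constructor cfg
  field
    state : Fin (suc (TM.nQ M))
    left  : List Sym     -- cells left of the head, nearest first
    head  : Sym
    right : List Sym     -- cells right of the head, nearest first

bitSym : Bool → Sym
bitSym false = s0
bitSym true  = s1

moveTape : {M : TM} → Fin (suc (TM.nQ M)) → List Sym → Sym → List Sym → Move → Config M
moveTape q l  h r N = cfg q l h r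
moveTape q [] h r L = cfg q [] blank (h ∷ r)
moveTape q (a ∷ l) h r L = cfg q l a (h ∷ r)
moveTape q l h [] R = cfg q (h ∷ l) blank []
moveTape q l h (a ∷ r) R = cfg q (h ∷ l) a r

step : {M : TM} → Config M → Maybe (Config M)
step {M} (cfg q l h r) with TM.δ M q h
... | nothing = nothing
... | just (q' , w , m) = just (moveTape q' l w r m)

haltsWithin : {M : TM} → ℕ → Config M → Maybe (Config M)
haltsWithin zero c with step c
... | nothing = just c
... | just _  = nothing
haltsWithin (suc t) c with step c
... | nothing = just c
... | just c' = haltsWithin t c'

initial : (M : TM) → Str → Config M
initial M []      = cfg Data.Fin.zero [] blank []
initial M (b ∷ w) = cfg Data.Fin.zero [] (bitSym b) (map bitSym w)

readBits : List Sym → Str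
readBits [] = []
readBits (s0 ∷ xs) = false ∷ readBits xs
readBits (s1 ∷ xs) = true ∷ readBits xs
readBits (blank ∷ xs) = []

output : {M : TM} → Config M → Str
output (cfg _ _ h r) = readBits (h ∷ r)

encPair : Str → ℕ → Str
encPair x k = concatMap (λ b → b ∷ b ∷ []) x ++ (false ∷ true ∷ []) ++ replicate k true

poly : ℕ → ℕ → ℕ
poly c n = c * n ^ c + c

PolyTimeComputable : (Str → ℕ → Str × ℕ) → Set
PolyTimeComputable F =
  Σ TM λ M → Σ ℕ λ c → ∀ x k →
    Σ (Config M) λ fin →
      (haltsWithin (poly c (length (encPair x k))) (initial M (encPair x k)) ≡ just fin)
      × (output fin ≡ encPair (proj₁ (F x k)) (proj₂ (F x k)))

PPT : ParamProblem → ParamProblem → Set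
PPT Q Q' =
  Σ (Str → ℕ → Str × ℕ) λ F →
    PolyTimeComputable F
    × (∀ x k → (Q x k → Q' (proj₁ (F x k)) (proj₂ (F x k)))
             × (Q' (proj₁ (F x k)) (proj₂ (F x k)) → Q x k))
    × (Σ ℕ λ c → ∀ x k → proj₂ (F x k) ≤ poly c k)

encℕ : ℕ → Str
encℕ m = replicate m true ++ (false ∷ [])

encList : {A : Set} → (A → Str) → List A → Str
encList e xs = encℕ (length xs) ++ concatMap e xs

encFin : {n : ℕ} → Fin n → Str
encFin i = encℕ (toℕ i)

encSubset : {n : ℕ} → Subset n → Str
encSubset X = toList X

encHS : (n : ℕ) → List (List (Fin n)) → ℕ → Str
encHS n 𝓕 m = encℕ n ++ encList (encList encFin) 𝓕 ++ encℕ m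

HasHittingSet : (n : ℕ) → List (List (Fin n)) → ℕ → Set
HasHittingSet n 𝓕 m =
  Σ (Subset n) λ S → (∣ S ∣ ≤ m) × All (λ F → Any (λ u → u ∈ S) F) 𝓕

HittingSet-n : ParamProblem
HittingSet-n w p =
  Σ ℕ λ n → Σ (List (List (Fin n))) λ 𝓕 → Σ ℕ λ m →
    (w ≡ encHS n 𝓕 m) × (p ≡ n) × HasHittingSet n 𝓕 m

-- Finite simple graphs on vertex set Fin n, given by an edge list.

record Graph : Set where
  constructor graph
  field
    n     : ℕ
    edges : List (Fin n × Fin n)

open Graph public

Adj : (G : Graph) → Fin (n G) → Fin (n G) → Set
Adj G u v = (u ≢ v) × (LM._∈_ (u , v) (edges G) ⊎ LM._∈_ (v , u) (edges G))

data Walk (G : Graph) (S : Subset (n G)) : Fin (n G) → Fin (n G) → Set where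
  here : ∀ {u} → u ∉ S → Walk G S u u
  next : ∀ {u v w} → u ∉ S → Adj G u v → Walk G S v w → Walk G S u w

DisconnectedMinus : (G : Graph) → Subset (n G) → Set
DisconnectedMinus G S =
  Σ (Fin (n G)) λ u → Σ (Fin (n G)) λ v →
    (u ∉ S) × (v ∉ S) × ¬ Walk G S u v

Stable : (G : Graph) → Subset (n G) → Set
Stable G S = ∀ u v → u ∈ S → v ∈ S → ¬ Adj G u v

StableCutset : (G : Graph) → Subset (n G) → Set
StableCutset G S = Stable G S × DisconnectedMinus G S

HasStableCutset : Graph → Set
HasStableCutset G = Σ (Subset (n G)) λ S → StableCutset G S

-- G - X is a linear forest (disjoint union of paths): every vertex v of
-- G - X lies in a sequence P = p₀,…,p_{m-1} of distinct vertices of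
-- G - X such that P is a union of components of G - X (no edge of G - X
-- leaves P) and, in G - X, p_i p_j is an edge iff |i - j| = 1;
-- i.e. the component of v is a path.
LinearForestMinus : (G : Graph) → Subset (n G) → Set
LinearForestMinus G X =
  ∀ v → v ∉ X →
    Σ (List (Fin (n G))) λ P →
      Unique P
      × All (λ p → p ∉ X) P
      × LM._∈_ v P
      × (∀ p q → LM._∈_ p P → q ∉ X → Adj G p q → LM._∈_ q P)
      × (∀ i j → Adj G (lookup P i) (lookup P j)
                 → (suc (toℕ i) ≡ toℕ j) ⊎ (suc (toℕ j) ≡ toℕ i))
      × (∀ i j → suc (toℕ i) ≡ toℕ j → Adj G (lookup P i) (lookup P j))

encSC : (G : Graph) → Subset (n G) → Str
encSC G X = encℕ (n G) ++ encList (λ e → encFin (proj₁ e) ++ encFin (proj₂ e)) (edges G)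
            ++ encSubset X

-- Strings not encoding a valid instance (including those violating the
-- promise that G - X is a linear forest, or with parameter ≠ |X|) are
-- no-instances.
StableCutset-modLinForest : ParamProblem
StableCutset-modLinForest w p =
  Σ Graph λ G → Σ (Subset (n G)) λ X →
    (w ≡ encSC G X) × (p ≡ ∣ X ∣) × LinearForestMinus G X × HasStableCutset G

InMK2 : ParamProblem → Set
InMK2 Q = PPT Q HittingSet-n

{-# OPTIONS --safe #-}

-- A stable cutset amounts to labelling the vertices A, S, B such that no edge
-- joins S to S or A to B. Triangles with two adjacent vertices a₁ a₂ (or b₁ b₂)
-- make a vertex choose between S and the side of a (or b), and a hub adjacent
-- to all four is forced into S as soon as a and b lie on different sides.
--
-- Given n, 𝓕 and the bound m, there are n slots. The vertex sel i u is tied to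
-- b, neg i u to a, and they are adjacent, so exactly one of them is in S; slot
-- i holds u when this is neg i u. For fixed i the vertices neg i u form a
-- clique, so a slot holds at most one element; for i ≥ m the extra edge from
-- sel i u to a₁ keeps the slot empty. All this is X, with 5 + 2n² vertices.
-- The rest is one path. Its stretch for F ∈ 𝓕 starts next to a, ends next to
-- b, and has two consecutive vertices for each u ∈ F and each slot i, both
-- adjacent to sel i u; the second is adjacent to the hub too, hence not in S.
-- If sel i u is in S, both vertices inherit the side of their predecessor; if
-- not, the first may be in S and the second falls to b. So the stretch can be
-- labelled iff F is hit. If a and b are on the same side or the hub is not in
-- S, everything outside S is connected, so there is no other stable cutset.
--
-- The transformation is computed by a stack program with loops, simulated on
-- the tape by shifting cells. If every loop runs at most W times, the running
-- time is bounded by a polynomial in W that is read off from the syntax; the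
-- numbers that occur bound W polynomially, since they are written in unary.

module Submission where

open import Data.Bool using (Bool; true; false)
open import Data.Nat using (ℕ; zero; suc; _+_; _*_; _^_; _≤_; _<_; z≤n; s≤s; _≤?_; _<?_; _≟_; _∸_)
open import Data.Nat.Properties
open import Data.Nat.Solver using (module +-*-Solver)
open import Data.Fin using (Fin; zero; suc; toℕ; fromℕ; fromℕ<; inject₁; _↑ˡ_; _↑ʳ_; splitAt; join; combine; remQuot)
open import Data.Fin.Patterns using (0F; 1F; 2F; 3F; 4F; 5F; 6F; 7F; 8F; 9F)
open import Data.Fin.Properties as Finₚ using (toℕ-inject₁; toℕ-fromℕ; toℕ<n; toℕ-fromℕ<; toℕ-injective; toℕ-↑ˡ; toℕ-↑ʳ; toℕ-combine; splitAt-↑ˡ; splitAt-↑ʳ; join-splitAt; remQuot-combine; combine-remQuot)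
open import Data.Fin.Subset using (Subset; _∈_; _∉_; ∣_∣; ⁅_⁆; _∪_; ⊥)
open import Data.Fin.Subset.Properties using (_∈?_; ∣⁅x⁆∣≡1; ∣⊥∣≡0; x∈⁅x⁆; x∈p∪q⁺; ∣p∣≤n)
open import Data.List using (List; []; _∷_; _++_; _ʳ++_; length; map; replicate; reverse; concatMap; concat; allFin; tabulate; lookup)
open import Data.List.Properties using (++-assoc; ++-identityʳ; ++-ʳ++; ʳ++-defn; length-++; length-map; length-replicate; length-reverse; map-++; reverse-map; reverse-involutive; concatMap-cong; map-concatMap; map-tabulate; ∷-injective)
open import Data.List.Relation.Unary.All as All using (All; []; _∷_)
import Data.List.Relation.Unary.All.Properties as Allₚ
open import Data.List.Relation.Unary.Any as Any using (Any; here; there)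
import Data.List.Relation.Unary.Any.Properties as Anyₚ
import Data.List.Relation.Unary.Unique.Propositional.Properties as Uniqueₚ
open import Data.List.Membership.Propositional using () renaming (_∈_ to _∈ₗ_)
open import Data.List.Membership.Propositional.Properties using (∈-map⁺; ∈-allFin; ∈-tabulate⁺)
open import Data.Maybe using (Maybe; just; nothing)
open import Data.Product using (Σ; ∃; ∃₂; _×_; _,_; proj₁; proj₂)
open import Data.Product.Properties using (,-injective)
open import Data.Sum using (_⊎_; inj₁; inj₂; [_,_]′)
open import Data.Sum.Properties using (inj₂-injective)
open import Data.Empty using (⊥-elim) renaming (⊥ to Empty)
open import Data.Unit using (⊤; tt)
open import Data.Vec as Vec using (Vec; []; _∷_; _[_]≔_)
import Data.Vec.Properties as Vecₚ
open import Function using (_∘_; id)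
open import Relation.Binary.PropositionalEquality using (_≡_; _≢_; refl; sym; trans; cong; cong₂; subst; subst₂; module ≡-Reasoning)
open import Relation.Nullary using (¬_; Dec; yes; no)
open import Relation.Nullary.Decidable using (¬?; _×-dec_)
open import Defs

-- There are `n` slots, and not `m`, because the new parameter must be polynomial in `n` alone; `m`
-- may be larger, but a set has at most `n` elements. Moreover `m` stands at the end of the code, so
-- the slots are written first and some of them switched off last. Between two stretches of the path
-- stands a vertex adjacent to `a₁`, `a₂` and `b₁`. It is forced into the cutset and lets the next
-- stretch start afresh on the side of a, so all sets share one path. The obstacle is to exclude
-- unintended cutsets: a path vertex whose only neighbour in X is `sel i u` could be cut off once
-- `sel i u` is in the cutset. The edge from the second vertex of each slot to the hub prevents
-- this. If the hub is outside, the vertex hangs on the hub; if it is inside, the vertex is outside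
-- and hands the connection on to its successor. A string that is no instance must become a
-- no-instance, so the program also decides well-formedness while it reads. The reduction is defined
-- from the outcome of this run, whence function and machine agree.

Tape : Set
Tape = List Sym × Sym × List Sym

shift : List Sym → Sym → List Sym → Move → Tape
shift l       h r       N = l , h , r
shift []      h r       L = [] , blank , h ∷ r
shift (a ∷ l) h r       L = l , a , h ∷ r
shift l       h []      R = h ∷ l , blank , []
shift l       h (a ∷ r) R = h ∷ l , a , r

atTape : {M : TM} → Fin (suc (TM.nQ M)) → Tape → Config M
atTape q (l , h , r) = cfg q l h r

moveTape-shift : {M : TM} (q : Fin (suc (TM.nQ M))) (l : List Sym) (h : Sym) (r : List Sym) (m : Move) →
                 moveTape {M} q l h r m ≡ atTape q (shift l h r m)
moveTape-shift q l       h r       N = refl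
moveTape-shift q []      h r       L = refl
moveTape-shift q (a ∷ l) h r       L = refl
moveTape-shift q []      h []      R = refl
moveTape-shift q (_ ∷ _) h []      R = refl
moveTape-shift q []      h (a ∷ r) R = refl
moveTape-shift q (_ ∷ _) h (a ∷ r) R = refl

-- Finite state sets and the wiring of machine fragments

record Finite (A : Set) : Set where
  field
    size    : ℕ
    enc     : A → Fin size
    dec     : Fin size → A
    dec-enc : ∀ a → dec (enc a) ≡ a

open Finite

finFin : ∀ k → Finite (Fin k)
finFin k = record { size = k ; enc = id ; dec = id ; dec-enc = λ _ → refl }

finSym : Finite Sym
finSym = record { size = 3 ; enc = e ; dec = d ; dec-enc = λ { s0 → refl ; s1 → refl ; blank → refl } }
  where
  e : Sym → Fin 3
  e s0    = 0F
  e s1    = 1F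
  e blank = 2F
  d : Fin 3 → Sym
  d 0F = s0
  d 1F = s1
  d 2F = blank

fin⊎ : {A B : Set} → Finite A → Finite B → Finite (A ⊎ B)
fin⊎ {A} {B} FA FB = record { size = size FA + size FB ; enc = e ; dec = d ; dec-enc = de }
  where
  e : A ⊎ B → Fin (size FA + size FB)
  e (inj₁ a) = enc FA a ↑ˡ size FB
  e (inj₂ b) = size FA ↑ʳ enc FB b
  d : Fin (size FA + size FB) → A ⊎ B
  d i = [ inj₁ ∘ dec FA , inj₂ ∘ dec FB ]′ (splitAt (size FA) i)
  de : ∀ x → d (e x) ≡ x
  de (inj₁ a) rewrite splitAt-↑ˡ (size FA) (enc FA a) (size FB) = cong inj₁ (dec-enc FA a)
  de (inj₂ b) rewrite splitAt-↑ʳ (size FA) (size FB) (enc FB b) = cong inj₂ (dec-enc FB b)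

fin× : {A B : Set} → Finite A → Finite B → Finite (A × B)
fin× {A} {B} FA FB = record { size = size FA * size FB ; enc = e ; dec = d ; dec-enc = de }
  where
  e : A × B → Fin (size FA * size FB)
  e (a , b) = combine (enc FA a) (enc FB b)
  d : Fin (size FA * size FB) → A × B
  d i = let (x , y) = remQuot {size FA} (size FB) i in dec FA x , dec FB y
  de : ∀ x → d (e x) ≡ x
  de (a , b) = trans (cong (λ p → dec FA (proj₁ p) , dec FB (proj₂ p)) (remQuot-combine (enc FA a) (enc FB b)))
                     (cong₂ _,_ (dec-enc FA a) (dec-enc FB b))

finΣ : ∀ k {B : Fin k → Set} → (∀ i → Finite (B i)) → Finite (Σ (Fin k) B)
finΣ zero    FB = record { size = 0 ; enc = λ { (() , _) } ; dec = λ () ; dec-enc = λ { (() , _) } }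
finΣ (suc k) {B} FB = record { size = size F ; enc = enc F ∘ to ; dec = from ∘ dec F ; dec-enc = de }
  where
  F : Finite (B zero ⊎ Σ (Fin k) (B ∘ suc))
  F = fin⊎ (FB zero) (finΣ k (FB ∘ suc))
  to : Σ (Fin (suc k)) B → B zero ⊎ Σ (Fin k) (B ∘ suc)
  to (zero  , b) = inj₁ b
  to (suc i , b) = inj₂ (i , b)
  from : B zero ⊎ Σ (Fin k) (B ∘ suc) → Σ (Fin (suc k)) B
  from (inj₁ b)       = zero , b
  from (inj₂ (i , b)) = suc i , b
  from-to : ∀ x → from (to x) ≡ x
  from-to (zero  , b) = refl
  from-to (suc i , b) = refl
  de : ∀ x → from (dec F (enc F (to x))) ≡ x
  de x rewrite dec-enc F (to x) = from-to x

-- The exits of a machine fragment. For a stack operation: stack empty, or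
-- the popped bit. For a program: nothing = finished, just false = rejected.
Exit : Set
Exit = Maybe Bool

pattern done     = nothing
pattern rejected = just false

record Frag : Set₁ where
  field
    St    : Set
    fin   : Finite St
    start : St
    tr    : St → Sym → (St ⊎ Exit) × Sym × Move

open Frag

-- The number is an upper bound for the steps: `exit` accepts any positive one, so bounds can be
-- relaxed later by `reach-mono`.
data Reach (F : Frag) : St F → Tape → ℕ → Exit → Tape → Set where
  exit : ∀ {s l h r e w m k} → tr F s h ≡ (inj₂ e , w , m) →
         Reach F s (l , h , r) (suc k) e (shift l w r m)
  go   : ∀ {s s′ l h r e w m k t} → tr F s h ≡ (inj₁ s′ , w , m) →
         Reach F s′ (shift l w r m) k e t → Reach F s (l , h , r) (suc k) e t

Runs : Frag → Tape → ℕ → Exit → Tape → Set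
Runs F = Reach F (start F)

reach-mono : ∀ {F s t k k′ e t′} → k ≤ k′ → Reach F s t k e t′ → Reach F s t k′ e t′
reach-mono (s≤s _)    (exit p) = exit p
reach-mono (s≤s k≤k′) (go p q) = go p (reach-mono k≤k′ q)

reach-from : ∀ {F s t u k e t′} → t ≡ u → Reach F s u k e t′ → Reach F s t k e t′
reach-from refl p = p

reach-to : ∀ {F s t k e t′ u} → t′ ≡ u → Reach F s t k e t′ → Reach F s t k e u
reach-to refl p = p

module _ (k : ℕ) (node : Fin (suc k) → Frag) (next : Fin (suc k) → Exit → Fin (suc k) ⊎ Exit) where

  route : (i : Fin (suc k)) → (St (node i) ⊎ Exit) × Sym × Move →
          (Σ (Fin (suc k)) (St ∘ node) ⊎ Exit) × Sym × Move
  route i (inj₁ s , w , m) = inj₁ (i , s) , w , m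
  route i (inj₂ e , w , m) = [ (λ i′ → inj₁ (i′ , start (node i′))) , inj₂ ]′ (next i e) , w , m

  -- The exit transition of a node is redirected to the start state of its successor, with the same
  -- write and move. Wiring thus costs no step, and running times add up.
  wire : Frag
  wire = record
    { St    = Σ (Fin (suc k)) (St ∘ node)
    ; fin   = finΣ (suc k) (fin ∘ node)
    ; start = zero , start (node zero)
    ; tr    = λ { (i , s) h → route i (tr (node i) s h) }
    }

  enter : Fin (suc k) → Tape → ℕ → Exit → Tape → Set
  enter i = Reach wire (i , start (node i))

  wire-exit : ∀ {i s t c e e′ t′} → next i e ≡ inj₂ e′ →
              Reach (node i) s t c e t′ → Reach wire (i , s) t c e′ t′
  wire-exit {i} {e = e} ne (exit {w = w} {m = m} p) =
    exit (trans (cong (route i) p) (cong (λ z → [ (λ i′ → inj₁ (i′ , start (node i′))) , inj₂ ]′ z , w , m) ne))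
  wire-exit {i} ne (go p q) = go (cong (route i) p) (wire-exit ne q)

  wire-step : ∀ {i i′ s t c c′ e e′ t′ t″} → next i e ≡ inj₁ i′ →
              Reach (node i) s t c e t′ → enter i′ t′ c′ e′ t″ → Reach wire (i , s) t (c + c′) e′ t″
  wire-step {i} {c = suc c} {c′} ne (exit {w = w} {m = m} p) q =
    go (trans (cong (route i) p) (cong (λ z → [ (λ i′ → inj₁ (i′ , start (node i′))) , inj₂ ]′ z , w , m) ne))
       (reach-mono (m≤n+m c′ c) q)
  wire-step {i} ne (go p q) r = go (cong (route i) p) (wire-step ne q r)

then : Frag → Frag → Frag
then F G = wire 1 (λ { 0F → F ; 1F → G })
                  (λ { 0F done → inj₁ 1F ; 0F (just b) → inj₂ (just b) ; 1F e → inj₂ e })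

then-runs : ∀ {F G t t′ t″ c c′ e} → Runs F t c done t′ → Runs G t′ c′ e t″ → Runs (then F G) t (c + c′) e t″
then-runs p q = wire-step 1 _ _ {i = 0F} refl p (wire-exit 1 _ _ {i = 1F} refl q)

then-reject : ∀ {F G t t′ c b} → Runs F t c (just b) t′ → Runs (then F G) t c (just b) t′
then-reject p = wire-exit 1 _ _ {i = 0F} refl p

leave : Exit → Frag
leave e = record { St = ⊤ ; fin = fin⊤ ; start = tt ; tr = λ _ h → inj₂ e , h , N }
  where
  fin⊤ : Finite ⊤
  fin⊤ = record { size = 1 ; enc = λ _ → zero ; dec = λ _ → tt ; dec-enc = λ _ → refl }

leave-runs : ∀ e {t} → Runs (leave e) t 1 e t
leave-runs e {l , h , r} = exit refl

-- Head movements over strings of bits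

bits : Str → List Sym
bits = map bitSym

bits-ʳ++ : ∀ q x → bits q ʳ++ x ≡ bits (reverse q) ++ x
bits-ʳ++ q x = trans (ʳ++-defn (bits q)) (cong (_++ x) (sym (reverse-map bitSym q)))

bits-reverse-ʳ++ : ∀ q x → bits (reverse q) ʳ++ x ≡ bits q ++ x
bits-reverse-ʳ++ q x = trans (bits-ʳ++ (reverse q) x) (cong (λ z → bits z ++ x) (reverse-involutive q))

-- State `0F` moves once without looking, so that the search may start on a blank.
seekBlank : Move → Frag
seekBlank d = record { St = Fin 2 ; fin = finFin 2 ; start = 0F ; tr = t }
  where
  t : Fin 2 → Sym → (Fin 2 ⊎ Exit) × Sym × Move
  t 0F h     = inj₁ 1F , h , d
  t 1F s0    = inj₁ 1F , s0 , d
  t 1F s1    = inj₁ 1F , s1 , d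
  t 1F blank = inj₂ done , blank , N

seekR-loop : ∀ l h r x → Reach (seekBlank R) 1F (shift l h (bits r ++ blank ∷ x) R) (suc (length r)) done
               (bits r ʳ++ (h ∷ l) , blank , x)
seekR-loop []      h []          x = exit refl
seekR-loop (_ ∷ _) h []          x = exit refl
seekR-loop []      h (false ∷ r) x = go refl (seekR-loop _ s0 r x)
seekR-loop (_ ∷ _) h (false ∷ r) x = go refl (seekR-loop _ s0 r x)
seekR-loop []      h (true ∷ r)  x = go refl (seekR-loop _ s1 r x)
seekR-loop (_ ∷ _) h (true ∷ r)  x = go refl (seekR-loop _ s1 r x)

seekR : ∀ l h r x → Runs (seekBlank R) (l , h , bits r ++ blank ∷ x) (2 + length r) done
          (bits r ʳ++ (h ∷ l) , blank , x)
seekR l h r x = go refl (seekR-loop l h r x)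

-- For a tape left by an unknown machine: the closing blank may be a recorded cell or lie beyond the
-- recorded ones, so the remainder `y` is unspecified.
seekR-readBits-loop : ∀ l h x → ∃ λ y → Reach (seekBlank R) 1F (shift l h x R) (suc (length (readBits x))) done
                        (bits (readBits x) ʳ++ (h ∷ l) , blank , y)
seekR-readBits-loop []      h []          = _ , exit refl
seekR-readBits-loop (_ ∷ _) h []          = _ , exit refl
seekR-readBits-loop []      h (blank ∷ x) = _ , exit refl
seekR-readBits-loop (_ ∷ _) h (blank ∷ x) = _ , exit refl
seekR-readBits-loop []      h (s0 ∷ x) = let (y , p) = seekR-readBits-loop _ s0 x in y , go refl p
seekR-readBits-loop (_ ∷ _) h (s0 ∷ x) = let (y , p) = seekR-readBits-loop _ s0 x in y , go refl p
seekR-readBits-loop []      h (s1 ∷ x) = let (y , p) = seekR-readBits-loop _ s1 x in y , go refl p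
seekR-readBits-loop (_ ∷ _) h (s1 ∷ x) = let (y , p) = seekR-readBits-loop _ s1 x in y , go refl p

seekL-loop : ∀ q l h x → Reach (seekBlank L) 1F (shift (bits q ++ blank ∷ l) h x L) (suc (length q)) done
               (l , blank , bits q ʳ++ (h ∷ x))
seekL-loop []          l h x = exit refl
seekL-loop (false ∷ q) l h x = go refl (seekL-loop q l s0 (h ∷ x))
seekL-loop (true ∷ q)  l h x = go refl (seekL-loop q l s1 (h ∷ x))

seekL : ∀ q l h x → Runs (seekBlank L) (bits q ++ blank ∷ l , h , x) (2 + length q) done
          (l , blank , bits q ʳ++ (h ∷ x))
seekL q l h x = go refl (seekL-loop q l h x)

-- The tape holds the stacks from left to right, tops leftmost, each closed
-- by a blank; the head rests on the blank just before the first stack.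
-- Cells outside this window are arbitrary.

cells : ∀ {k} → Vec Str k → List Sym → List Sym
cells []      g = g
cells (r ∷ ρ) g = bits r ++ blank ∷ cells ρ g

-- Stacks lying left of the head, nearest first and each reversed.
leftOf : List Str → List Sym → List Sym
leftOf []       g = g
leftOf (q ∷ qs) g = bits q ++ blank ∷ leftOf qs g

unwind : List Str → List Sym → List Sym
unwind []       x = x
unwind (q ∷ qs) x = unwind qs (bits q ʳ++ (blank ∷ x))

before : ∀ {k} → Fin k → Vec Str k → List Str → List Str
before zero    ρ       acc = acc
before (suc j) (r ∷ ρ) acc = before j ρ (reverse r ∷ acc)

behind : ∀ {k} → Fin k → Vec Str k → List Sym → List Sym
behind zero    (r ∷ ρ) g = cells ρ g
behind (suc j) (r ∷ ρ) g = behind j ρ g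

total : ∀ {k} → Vec Str k → ℕ
total []      = 0
total (r ∷ ρ) = suc (length r) + total ρ

weight : List Str → ℕ
weight []       = 0
weight (q ∷ qs) = suc (length q) + weight qs

-- Two reversals cancel: a stack is reversed when the head passes it to the right and once more when
-- it is unwound.
unwind-before : ∀ {k} (j : Fin k) ρ acc g →
                unwind acc (cells ρ g) ≡ unwind (before j ρ acc) (bits (Vec.lookup ρ j) ++ blank ∷ behind j ρ g)
unwind-before zero    (r ∷ ρ) acc g = refl
unwind-before (suc j) (r ∷ ρ) acc g =
  trans (cong (unwind acc) (sym (bits-reverse-ʳ++ r (blank ∷ cells ρ g)))) (unwind-before j ρ (reverse r ∷ acc) g)

before-update : ∀ {k} (j : Fin k) ρ acc x → before j (ρ [ j ]≔ x) acc ≡ before j ρ acc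
before-update zero    (r ∷ ρ) acc x = refl
before-update (suc j) (r ∷ ρ) acc x = before-update j ρ (reverse r ∷ acc) x

behind-update : ∀ {k} (j : Fin k) ρ x g → behind j (ρ [ j ]≔ x) g ≡ behind j ρ g
behind-update zero    (r ∷ ρ) x g = refl
behind-update (suc j) (r ∷ ρ) x g = behind-update j ρ x g

length-before : ∀ {k} (j : Fin k) ρ acc → length (before j ρ acc) ≡ toℕ j + length acc
length-before zero    ρ       acc = refl
length-before (suc j) (r ∷ ρ) acc = trans (length-before j ρ (reverse r ∷ acc)) (+-suc (toℕ j) (length acc))

weight-before : ∀ {k} (j : Fin k) ρ acc → weight (before j ρ acc) ≤ total ρ + weight acc
weight-before zero    (r ∷ ρ) acc = m≤n+m (weight acc) _
weight-before (suc j) (r ∷ ρ) acc = begin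
  weight (before j ρ (reverse r ∷ acc))          ≤⟨ weight-before j ρ (reverse r ∷ acc) ⟩
  total ρ + (suc (length (reverse r)) + weight acc) ≡⟨ cong (λ z → total ρ + (suc z + weight acc)) (length-reverse r) ⟩
  total ρ + (suc (length r) + weight acc)        ≡⟨ solve 3 (λ a b c → a :+ (b :+ c) := b :+ a :+ c) refl (total ρ) (suc (length r)) (weight acc) ⟩
  suc (length r) + total ρ + weight acc          ∎
  where
  open ≤-Reasoning
  open +-*-Solver

cells-update : ∀ {k} (j : Fin k) ρ x g →
               cells (ρ [ j ]≔ x) g ≡ unwind (before j ρ []) (bits x ++ blank ∷ behind j ρ g)
cells-update j ρ x g
  rewrite unwind-before j (ρ [ j ]≔ x) [] g | before-update j ρ [] x | behind-update j ρ x g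
        | Vecₚ.lookup∘update j ρ x = refl

-- Pushing and popping on the tape

seekRs : ℕ → Frag
seekRs zero    = leave done
seekRs (suc j) = then (seekBlank R) (seekRs j)

seekRs-runs : ∀ {k} (j : Fin k) ρ acc gl g →
  Runs (seekRs (toℕ j)) (leftOf acc gl , blank , cells ρ g) (1 + 2 * total ρ) done
       (leftOf (before j ρ acc) gl , blank , bits (Vec.lookup ρ j) ++ blank ∷ behind j ρ g)
seekRs-runs zero    (r ∷ ρ) acc gl g = reach-mono (s≤s z≤n) (leave-runs done)
seekRs-runs (suc j) (r ∷ ρ) acc gl g = reach-mono bound (then-runs first (seekRs-runs j ρ (reverse r ∷ acc) gl g))
  where
  first : Runs (seekBlank R) (leftOf acc gl , blank , bits r ++ blank ∷ cells ρ g) (2 + length r) done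
            (leftOf (reverse r ∷ acc) gl , blank , cells ρ g)
  first = reach-to (cong (_, (blank , cells ρ g)) (bits-ʳ++ r _))
            (seekR (leftOf acc gl) blank r (cells ρ g))
  bound : 2 + length r + (1 + 2 * total ρ) ≤ 1 + 2 * (suc (length r) + total ρ)
  bound = ≤-trans (m≤m+n _ (length r)) (≤-reflexive
    (solve 2 (λ a b → con 2 :+ a :+ (con 1 :+ con 2 :* b) :+ a := con 1 :+ con 2 :* (con 1 :+ a :+ b)) refl (length r) (total ρ)))
    where open +-*-Solver

seekLs : ℕ → Frag
seekLs zero    = leave done
seekLs (suc j) = then (seekBlank L) (seekLs j)

seekLs-runs : ∀ j qs gl x → j ≡ length qs →
  Runs (seekLs j) (leftOf qs gl , blank , x) (1 + 2 * weight qs) done (gl , blank , unwind qs x)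
seekLs-runs .0 []       gl x refl = leave-runs done
seekLs-runs ._ (q ∷ qs) gl x refl =
  reach-mono bound (then-runs (seekL q (leftOf qs gl) blank x) (seekLs-runs _ qs gl (bits q ʳ++ (blank ∷ x)) refl))
  where
  bound : 2 + length q + (1 + 2 * weight qs) ≤ 1 + 2 * (suc (length q) + weight qs)
  bound = ≤-trans (m≤m+n _ (length q)) (≤-reflexive
    (solve 2 (λ a b → con 2 :+ a :+ (con 1 :+ con 2 :* b) :+ a := con 1 :+ con 2 :* (con 1 :+ a :+ b)) refl (length q) (weight qs)))
    where open +-*-Solver

-- Inserts a symbol at the head by moving the j stacks left of it one cell
-- further left; the state holds the displaced symbol and the number of
-- blanks still to be met.
insertL : ℕ → Bool → Frag
insertL j b = record
  { St = ⊤ ⊎ (Sym × Fin (suc j)) ; fin = fin⊎ (fin (leave done)) (fin× finSym (finFin (suc j)))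
  ; start = inj₂ (bitSym b , fromℕ j) ; tr = t }
  where
  t : ⊤ ⊎ (Sym × Fin (suc j)) → Sym → ((⊤ ⊎ (Sym × Fin (suc j))) ⊎ Exit) × Sym × Move
  t (inj₁ tt)          h     = inj₂ done , blank , N
  t (inj₂ (c , i))     s0    = inj₁ (inj₂ (s0 , i)) , c , L
  t (inj₂ (c , i))     s1    = inj₁ (inj₂ (s1 , i)) , c , L
  t (inj₂ (c , zero))  blank = inj₁ (inj₁ tt) , c , L
  t (inj₂ (c , suc i)) blank = inj₁ (inj₂ (blank , inject₁ i)) , c , L

tapeL : Str → List Sym → List Sym → Tape
tapeL []      l x = l , blank , x
tapeL (b ∷ q) l x = bits q ++ blank ∷ l , bitSym b , x

shift-tapeL : ∀ q l h x → shift (bits q ++ blank ∷ l) h x L ≡ tapeL q l (h ∷ x)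
shift-tapeL []      l h x = refl
shift-tapeL (b ∷ q) l h x = refl

-- Since the cells on the left are the ones that move, the same sweep brings the head home. The
-- window grows by one cell, taken from the arbitrary cells on the left; hence the unspecified
-- `gl′`.
insertL-loop : ∀ {j b} q qs c (i : Fin (suc j)) gl x → toℕ i ≡ length qs →
  ∃ λ gl′ → Reach (insertL j b) (inj₂ (c , i)) (tapeL q (leftOf qs gl) x) (2 + length q + weight qs) done
                  (gl′ , blank , unwind qs (bits q ʳ++ (c ∷ x)))
insertL-loop []          []        c zero    []       x eq = _ , go refl (exit refl)
insertL-loop []          []        c zero    (_ ∷ gl) x eq = _ , go refl (exit refl)
insertL-loop {j} {b} []  (q ∷ qs)  c (suc i) gl x eq =
  let (gl′ , p) = insertL-loop {j} {b} q qs blank (inject₁ i) gl (c ∷ x) (trans (toℕ-inject₁ i) (suc-injective eq))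
  in gl′ , go refl (reach-from (shift-tapeL q (leftOf qs gl) c x) p)
insertL-loop {j} {b} (false ∷ q) qs c i gl x eq =
  let (gl′ , p) = insertL-loop {j} {b} q qs s0 i gl (c ∷ x) eq
  in gl′ , go refl (reach-from (shift-tapeL q (leftOf qs gl) c x) p)
insertL-loop {j} {b} (true ∷ q) qs c i gl x eq =
  let (gl′ , p) = insertL-loop {j} {b} q qs s1 i gl (c ∷ x) eq
  in gl′ , go refl (reach-from (shift-tapeL q (leftOf qs gl) c x) p)

pushF : ℕ → Bool → Frag
pushF j b = then (seekRs j) (insertL j b)

-- A generous common bound for a push and for both outcomes of a pop, with `s` the total size of the
-- stacks.
opCost : ℕ → ℕ
opCost s = 9 + 7 * s

pushF-runs : ∀ {k} (j : Fin k) b ρ gl g →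
  ∃ λ gl′ → Runs (pushF (toℕ j) b) (gl , blank , cells ρ g) (opCost (total ρ)) done
                 (gl′ , blank , cells (ρ [ j ]≔ (b ∷ Vec.lookup ρ j)) g)
pushF-runs j b ρ gl g =
  let (gl′ , p) = insertL-loop {toℕ j} {b} [] (before j ρ []) (bitSym b) (fromℕ (toℕ j)) gl _
                    (trans (toℕ-fromℕ (toℕ j)) (sym (trans (length-before j ρ []) (+-identityʳ _))))
  in gl′ , reach-to (cong (λ z → gl′ , blank , z) (sym (cells-update j ρ _ g)))
             (reach-mono bound (then-runs (seekRs-runs j ρ [] gl g) p))
  where
  bound : 1 + 2 * total ρ + (2 + 0 + weight (before j ρ [])) ≤ opCost (total ρ)
  bound = begin
    1 + 2 * total ρ + (2 + 0 + weight (before j ρ [])) ≤⟨ +-monoʳ-≤ (1 + 2 * total ρ) (+-monoʳ-≤ 2 (weight-before j ρ [])) ⟩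
    1 + 2 * total ρ + (2 + (total ρ + 0))              ≤⟨ m≤m+n _ (6 + 4 * total ρ) ⟩
    1 + 2 * total ρ + (2 + (total ρ + 0)) + (6 + 4 * total ρ)
      ≡⟨ solve 1 (λ a → con 1 :+ con 2 :* a :+ (con 2 :+ (a :+ con 0)) :+ (con 6 :+ con 4 :* a) := con 9 :+ con 7 :* a) refl (total ρ) ⟩
    opCost (total ρ) ∎
    where
    open ≤-Reasoning
    open +-*-Solver

peek : Frag
peek = record { St = Fin 2 ; fin = finFin 2 ; start = 0F ; tr = t }
  where
  t : Fin 2 → Sym → (Fin 2 ⊎ Exit) × Sym × Move
  t 0F h     = inj₁ 1F , h , R
  t 1F s0    = inj₂ (just false) , s0 , N
  t 1F s1    = inj₂ (just true) , s1 , N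
  t 1F blank = inj₂ nothing , blank , N

-- Deletes the symbol at the head by moving the j stacks left of it one cell
-- to the right.
deleteL : ℕ → Exit → Frag
deleteL j e = record
  { St = Fin (suc j) ⊎ (Fin (suc j) ⊎ (Sym × Fin (suc j)))
  ; fin = fin⊎ (finFin (suc j)) (fin⊎ (finFin (suc j)) (fin× finSym (finFin (suc j))))
  ; start = inj₁ (fromℕ j) ; tr = t }
  where
  S : Set
  S = Fin (suc j) ⊎ (Fin (suc j) ⊎ (Sym × Fin (suc j)))
  t : S → Sym → (S ⊎ Exit) × Sym × Move
  t (inj₁ i)                        h = inj₁ (inj₂ (inj₁ i)) , h , L
  t (inj₂ (inj₁ i))                 c = inj₁ (inj₂ (inj₂ (c , i))) , c , R
  t (inj₂ (inj₂ (s0 , i)))          h = inj₁ (inj₁ i) , s0 , L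
  t (inj₂ (inj₂ (s1 , i)))          h = inj₁ (inj₁ i) , s1 , L
  t (inj₂ (inj₂ (blank , zero)))    h = inj₂ e , blank , N
  t (inj₂ (inj₂ (blank , suc i)))   h = inj₁ (inj₁ (inject₁ i)) , blank , L

deleteL-loop : ∀ {j e} q qs (i : Fin (suc j)) gl h x → toℕ i ≡ length qs →
  ∃ λ gl′ → Reach (deleteL j e) (inj₁ i) (bits q ++ blank ∷ leftOf qs gl , h , x)
                  (3 * (suc (length q) + weight qs)) e
                  (gl′ , blank , unwind qs (bits q ʳ++ x))
deleteL-loop []         []       zero    gl h x eq = _ , go refl (go refl (exit refl))
deleteL-loop {j} {e} [] (q ∷ qs) (suc i) gl h x eq =
  let (gl′ , p) = deleteL-loop {j} {e} q qs (inject₁ i) gl blank (blank ∷ x) (trans (toℕ-inject₁ i) (suc-injective eq))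
  in gl′ , reach-mono (≤-reflexive (sym (*-suc 3 (suc (length q) + weight qs)))) (go refl (go refl (go refl p)))
deleteL-loop {j} {e} (false ∷ q) qs i gl h x eq =
  let (gl′ , p) = deleteL-loop {j} {e} q qs i gl s0 (s0 ∷ x) eq
  in gl′ , reach-mono (≤-reflexive (sym (*-suc 3 (suc (length q) + weight qs)))) (go refl (go refl (go refl p)))
deleteL-loop {j} {e} (true ∷ q) qs i gl h x eq =
  let (gl′ , p) = deleteL-loop {j} {e} q qs i gl s1 (s1 ∷ x) eq
  in gl′ , reach-mono (≤-reflexive (sym (*-suc 3 (suc (length q) + weight qs)))) (go refl (go refl (go refl p)))

-- The popped bit must be remembered while the other stacks move; it is kept in the choice between
-- nodes `3F` and `4F`.
popNode : ℕ → Fin 5 → Frag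
popNode j 0F = seekRs j
popNode j 1F = peek
popNode j 2F = then (seekBlank L) (seekLs j)
popNode j 3F = deleteL j (just false)
popNode j 4F = deleteL j (just true)

popNext : Fin 5 → Exit → Fin 5 ⊎ Exit
popNext 0F e            = inj₁ 1F
popNext 1F nothing      = inj₁ 2F
popNext 1F (just false) = inj₁ 3F
popNext 1F (just true)  = inj₁ 4F
popNext 2F e            = inj₂ e
popNext 3F e            = inj₂ e
popNext 4F e            = inj₂ e

popF : ℕ → Frag
popF j = wire 4 (popNode j) popNext

popF-empty : ∀ {k} (j : Fin k) ρ gl g → Vec.lookup ρ j ≡ [] →
  Runs (popF (toℕ j)) (gl , blank , cells ρ g) (opCost (total ρ)) nothing (gl , blank , cells ρ g)
popF-empty j ρ gl g eq = reach-mono bound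
  (wire-step 4 (popNode (toℕ j)) popNext {i = 0F} refl to
    (wire-step 4 (popNode (toℕ j)) popNext {i = 1F} {e = nothing} refl (go {k = 1} refl (exit refl))
      (wire-exit 4 (popNode (toℕ j)) popNext {i = 2F} refl back)))
  where
  qs = before j ρ []
  to : Runs (seekRs (toℕ j)) (gl , blank , cells ρ g) (1 + 2 * total ρ) done (leftOf qs gl , blank , blank ∷ behind j ρ g)
  to = reach-to (cong (λ z → leftOf qs gl , blank , bits z ++ blank ∷ behind j ρ g) eq) (seekRs-runs j ρ [] gl g)
  back : Runs (then (seekBlank L) (seekLs (toℕ j))) (blank ∷ leftOf qs gl , blank , behind j ρ g) (2 + (1 + 2 * weight qs))
           nothing (gl , blank , cells ρ g)
  back = reach-to (cong (λ z → gl , blank , z)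
    (sym (trans (unwind-before j ρ [] g) (cong (λ z → unwind qs (bits z ++ blank ∷ behind j ρ g)) eq))))
    (then-runs (seekL [] (leftOf qs gl) blank (behind j ρ g))
               (seekLs-runs (toℕ j) qs gl _ (sym (trans (length-before j ρ []) (+-identityʳ _)))))
  bound : 1 + 2 * total ρ + (2 + (2 + (1 + 2 * weight qs))) ≤ opCost (total ρ)
  bound = begin
    1 + 2 * total ρ + (2 + (2 + (1 + 2 * weight qs))) ≤⟨ +-monoʳ-≤ (1 + 2 * total ρ) (+-monoʳ-≤ 5 (*-monoʳ-≤ 2 (weight-before j ρ []))) ⟩
    1 + 2 * total ρ + (5 + 2 * (total ρ + 0))         ≤⟨ m≤m+n _ (3 + 3 * total ρ) ⟩
    1 + 2 * total ρ + (5 + 2 * (total ρ + 0)) + (3 + 3 * total ρ)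
      ≡⟨ solve 1 (λ a → con 1 :+ con 2 :* a :+ (con 5 :+ con 2 :* (a :+ con 0)) :+ (con 3 :+ con 3 :* a) := con 9 :+ con 7 :* a) refl (total ρ) ⟩
    opCost (total ρ) ∎
    where
    open ≤-Reasoning
    open +-*-Solver

popF-bit : ∀ {k} (j : Fin k) b xs ρ gl g → Vec.lookup ρ j ≡ b ∷ xs →
  ∃ λ gl′ → Runs (popF (toℕ j)) (gl , blank , cells ρ g) (opCost (total ρ)) (just b)
                 (gl′ , blank , cells (ρ [ j ]≔ xs) g)
popF-bit j b xs ρ gl g eq = proj₁ del , reach-to (cong (λ z → proj₁ del , blank , z) (sym (cells-update j ρ xs g)))
  (reach-mono bound (wire-step 4 (popNode (toℕ j)) popNext {i = 0F} refl to (branch b (proj₂ del))))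
  where
  qs = before j ρ []
  y = bits xs ++ blank ∷ behind j ρ g
  del = deleteL-loop {toℕ j} {just b} [] qs (fromℕ (toℕ j)) gl (bitSym b) y
          (trans (toℕ-fromℕ (toℕ j)) (sym (trans (length-before j ρ []) (+-identityʳ _))))
  to : Runs (seekRs (toℕ j)) (gl , blank , cells ρ g) (1 + 2 * total ρ) done (leftOf qs gl , blank , bitSym b ∷ y)
  to = reach-to (cong (λ z → leftOf qs gl , blank , bits z ++ blank ∷ behind j ρ g) eq) (seekRs-runs j ρ [] gl g)
  branch : ∀ b {c t} → Runs (deleteL (toℕ j) (just b)) (blank ∷ leftOf qs gl , bitSym b , y) c (just b) t →
           enter 4 (popNode (toℕ j)) popNext 1F (leftOf qs gl , blank , bitSym b ∷ y) (2 + c) (just b) t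
  branch false p = wire-step 4 (popNode (toℕ j)) popNext {i = 1F} {e = just false} refl (go {k = 1} refl (exit refl)) (wire-exit 4 (popNode (toℕ j)) popNext {i = 3F} refl p)
  branch true  p = wire-step 4 (popNode (toℕ j)) popNext {i = 1F} {e = just true} refl (go {k = 1} refl (exit refl)) (wire-exit 4 (popNode (toℕ j)) popNext {i = 4F} refl p)
  bound : 1 + 2 * total ρ + (2 + 3 * (1 + weight qs)) ≤ opCost (total ρ)
  bound = begin
    1 + 2 * total ρ + (2 + 3 * (1 + weight qs)) ≤⟨ +-monoʳ-≤ (1 + 2 * total ρ) (+-monoʳ-≤ 2 (*-monoʳ-≤ 3 (+-monoʳ-≤ 1 (weight-before j ρ [])))) ⟩
    1 + 2 * total ρ + (2 + 3 * (1 + (total ρ + 0))) ≤⟨ m≤m+n _ (3 + 2 * total ρ) ⟩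
    1 + 2 * total ρ + (2 + 3 * (1 + (total ρ + 0))) + (3 + 2 * total ρ)
      ≡⟨ solve 1 (λ a → con 1 :+ con 2 :* a :+ (con 2 :+ con 3 :* (con 1 :+ (a :+ con 0))) :+ (con 3 :+ con 2 :* a) := con 9 :+ con 7 :* a) refl (total ρ) ⟩
    opCost (total ρ) ∎
    where
    open ≤-Reasoning
    open +-*-Solver

-- Stack programs, their semantics and their cost

data Prog (K : ℕ) : Set where
  skip fail : Prog K
  push      : Fin K → Bool → Prog K
  pop       : Fin K → (onEmpty on0 on1 : Prog K) → Prog K
  _⨾_       : Prog K → Prog K → Prog K
  loop      : Fin K → (on0 on1 : Prog K) → Prog K

infixr 5 _⨾_

pick : ∀ {a} {A : Set a} → A → A → Bool → A
pick p q false = p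
pick p q true  = q

-- Outcome nothing means that the program has rejected. The parameter W
-- bounds the number of iterations of every loop.
module _ {K : ℕ} (W : ℕ) where

  data Exec : Prog K → Vec Str K → Maybe (Vec Str K) → Set
  data Iter (j : Fin K) (p q : Prog K) : ℕ → Vec Str K → Maybe (Vec Str K) → Set

  data Exec where
    skip  : ∀ {ρ} → Exec skip ρ (just ρ)
    fail  : ∀ {ρ} → Exec fail ρ nothing
    push  : ∀ {j b ρ} → Exec (push j b) ρ (just (ρ [ j ]≔ (b ∷ Vec.lookup ρ j)))
    pop-[] : ∀ {j p q r ρ o} → Vec.lookup ρ j ≡ [] → Exec p ρ o → Exec (pop j p q r) ρ o
    pop-∷ : ∀ {j p q r ρ o b xs} → Vec.lookup ρ j ≡ b ∷ xs → Exec (pick q r b) (ρ [ j ]≔ xs) o →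
            Exec (pop j p q r) ρ o
    _⨾_   : ∀ {p q ρ ρ′ o} → Exec p ρ (just ρ′) → Exec q ρ′ o → Exec (p ⨾ q) ρ o
    abort : ∀ {p q ρ} → Exec p ρ nothing → Exec (p ⨾ q) ρ nothing
    loop  : ∀ {j p q ρ o} → Iter j p q W ρ o → Exec (loop j p q) ρ o

  data Iter j p q where
    stop  : ∀ {k ρ} → Vec.lookup ρ j ≡ [] → Iter j p q k ρ (just ρ)
    more  : ∀ {k ρ ρ′ o b xs} → Vec.lookup ρ j ≡ b ∷ xs → Exec (pick p q b) (ρ [ j ]≔ xs) (just ρ′) →
            Iter j p q k ρ′ o → Iter j p q (suc k) ρ o
    abort : ∀ {k ρ b xs} → Vec.lookup ρ j ≡ b ∷ xs → Exec (pick p q b) (ρ [ j ]≔ xs) nothing →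
            Iter j p q (suc k) ρ nothing

  iter-mono : ∀ {j p q k k′ ρ o} → k ≤ k′ → Iter j p q k ρ o → Iter j p q k′ ρ o
  iter-mono k≤k′       (stop e)     = stop e
  iter-mono (s≤s k≤k′) (more e x i) = more e x (iter-mono k≤k′ i)
  iter-mono (s≤s k≤k′) (abort e x)  = abort e x

  loop≤ : ∀ {j p q k ρ o} → k ≤ W → Iter j p q k ρ o → Exec (loop j p q) ρ o
  loop≤ k≤W i = loop (iter-mono k≤W i)

-- The outer `suc` pays for the final pop of the empty stack, the inner one for the pop that opens
-- each round.
iterCost : ℕ → ℕ → ℕ
iterCost k c = suc (k * suc c)

-- An operation adds at most one cell, so this one number bounds both the operations executed and
-- the growth of the stacks.
cost : ∀ {K} → ℕ → Prog K → ℕ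
cost W skip          = 1
cost W fail          = 1
cost W (push j b)    = 1
cost W (pop j p q r) = suc (cost W p + (cost W q + cost W r))
cost W (p ⨾ q)       = cost W p + cost W q
cost W (loop j p q)  = iterCost W (cost W p + cost W q)

-- Compilation of stack programs and its correctness

branchF : Frag → Frag → Frag → Frag → Frag
branchF F P Q Q′ = wire 3 (λ { 0F → F ; 1F → P ; 2F → Q ; 3F → Q′ })
  (λ { 0F nothing → inj₁ 1F ; 0F (just false) → inj₁ 2F ; 0F (just true) → inj₁ 3F
     ; 1F e → inj₂ e ; 2F e → inj₂ e ; 3F e → inj₂ e })

loopF : Frag → Frag → Frag → Frag
loopF F P Q = wire 2 (λ { 0F → F ; 1F → P ; 2F → Q })
  (λ { 0F nothing → inj₂ done ; 0F (just false) → inj₁ 1F ; 0F (just true) → inj₁ 2F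
     ; 1F nothing → inj₁ 0F ; 1F (just b) → inj₂ (just b)
     ; 2F nothing → inj₁ 0F ; 2F (just b) → inj₂ (just b) })

compile : ∀ {K} → Prog K → Frag
compile skip          = leave done
compile fail          = leave rejected
compile (push j b)    = pushF (toℕ j) b
compile (pop j p q r) = branchF (popF (toℕ j)) (compile p) (compile q) (compile r)
compile (p ⨾ q)       = then (compile p) (compile q)
compile (loop j p q)  = loopF (popF (toℕ j)) (compile p) (compile q)

data Ends {K} (F : Frag) (t : Tape) (c b : ℕ) (g : List Sym) : Maybe (Vec Str K) → Set where
  finishes : ∀ {ρ gl} → total ρ ≤ b → Runs F t c done (gl , blank , cells ρ g) → Ends F t c b g (just ρ)
  rejects  : ∀ {t′} → Runs F t c rejected t′ → Ends F t c b g nothing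

total-push : ∀ {k} (j : Fin k) ρ b → total (ρ [ j ]≔ (b ∷ Vec.lookup ρ j)) ≡ suc (total ρ)
total-push zero    (r ∷ ρ) b = refl
total-push (suc j) (r ∷ ρ) b =
  trans (cong (suc (length r) +_) (total-push j ρ b)) (+-suc (suc (length r)) (total ρ))

total-pop : ∀ {k} (j : Fin k) ρ {b xs} → Vec.lookup ρ j ≡ b ∷ xs → total (ρ [ j ]≔ xs) ≤ total ρ
total-pop zero    (r ∷ ρ) refl = n≤1+n _
total-pop (suc j) (r ∷ ρ) eq   = +-monoʳ-≤ (suc (length r)) (total-pop j ρ eq)

opCost-mono : ∀ {a b} → a ≤ b → opCost a ≤ opCost b
opCost-mono a≤b = +-monoʳ-≤ 9 (*-monoʳ-≤ 7 a≤b)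

module Simulation {K : ℕ} (W S : ℕ) (g : List Sym) where

  U : ℕ
  U = opCost S

  once : ∀ {a} c → a ≤ S → opCost a ≤ suc c * U
  once c a≤S = ≤-trans (opCost-mono a≤S) (m≤m+n U (c * U))

  one : 1 ≤ 1 * U
  one = s≤s z≤n

  weaken-ends : ∀ {F t c c′ b b′ o} → c ≤ c′ → b ≤ b′ → Ends {K} F t c b g o → Ends F t c′ b′ g o
  weaken-ends c≤ b≤ (finishes x y) = finishes (≤-trans x b≤) (reach-mono c≤ y)
  weaken-ends c≤ b≤ (rejects y)    = rejects (reach-mono c≤ y)

  map-ends : ∀ {F P t t′ c c′ b o} → (∀ {e u} → Runs P t′ c′ e u → Runs F t c e u) →
             Ends {K} P t′ c′ b g o → Ends F t c b g o
  map-ends f (finishes x y) = finishes x (f y)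
  map-ends f (rejects y)    = rejects (f y)

  branch-empty : ∀ {F P Q Q′ t t′ c c′ b o} → Runs F t c nothing t′ → Ends {K} P t′ c′ b g o →
                 Ends (branchF F P Q Q′) t (c + c′) b g o
  branch-empty p = map-ends (λ y → wire-step 3 _ _ {i = 0F} {e = nothing} refl p (wire-exit 3 _ _ {i = 1F} refl y))

  branch-bit : ∀ {F P Q Q′ t t′ c c′ b o} x → Runs F t c (just x) t′ → Ends {K} (pick Q Q′ x) t′ c′ b g o →
               Ends (branchF F P Q Q′) t (c + c′) b g o
  branch-bit false p = map-ends (λ y → wire-step 3 _ _ {i = 0F} {e = just false} refl p (wire-exit 3 _ _ {i = 2F} refl y))
  branch-bit true  p = map-ends (λ y → wire-step 3 _ _ {i = 0F} {e = just true} refl p (wire-exit 3 _ _ {i = 3F} refl y))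

  loop-bit : ∀ {F P Q t t′ t″ c c′ c″ b o} x → Runs F t c (just x) t′ → Runs (pick P Q x) t′ c′ done t″ →
             Ends {K} (loopF F P Q) t″ c″ b g o → Ends (loopF F P Q) t (c + (c′ + c″)) b g o
  loop-bit false p q = map-ends (λ y → wire-step 2 _ _ {i = 0F} {e = just false} refl p (wire-step 2 _ _ {i = 1F} refl q y))
  loop-bit true  p q = map-ends (λ y → wire-step 2 _ _ {i = 0F} {e = just true} refl p (wire-step 2 _ _ {i = 2F} refl q y))

  loop-reject : ∀ {F P Q t t′ t″ c c′} x → Runs F t c (just x) t′ → Runs (pick P Q x) t′ c′ rejected t″ →
                Runs (loopF F P Q) t (c + c′) rejected t″
  loop-reject false p q = wire-step 2 _ _ {i = 0F} {e = just false} refl p (wire-exit 2 _ _ {i = 1F} refl q)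
  loop-reject true  p q = wire-step 2 _ _ {i = 0F} {e = just true} refl p (wire-exit 2 _ _ {i = 2F} refl q)

  pick-runs : ∀ (p q : Prog K) x {t c e u} → Runs (compile (pick p q x)) t c e u → Runs (pick (compile p) (compile q) x) t c e u
  pick-runs p q false r = r
  pick-runs p q true  r = r

  pick-ends : ∀ (p q : Prog K) x {t c b o} → Ends (compile (pick p q x)) t c b g o → Ends {K} (pick (compile p) (compile q) x) t c b g o
  pick-ends p q false r = r
  pick-ends p q true  r = r

  pick-cost : ∀ (p q : Prog K) x → cost W (pick p q x) ≤ cost W p + cost W q
  pick-cost p q false = m≤m+n _ _
  pick-cost p q true  = m≤n+m _ _

  Fits : ℕ → Vec Str K → Set
  Fits c ρ = total ρ + c ≤ S

  fits-mono : ∀ ρ {c c′} → c ≤ c′ → Fits c′ ρ → Fits c ρ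
  fits-mono ρ c≤ = ≤-trans (+-monoʳ-≤ (total ρ) c≤)

  fits-pop : ∀ ρ {b xs} c (j : Fin K) → Vec.lookup ρ j ≡ b ∷ xs → Fits c ρ → Fits c (ρ [ j ]≔ xs)
  fits-pop ρ c j e = ≤-trans (+-monoˡ-≤ c (total-pop j ρ e))

  total≤S : ∀ ρ c → Fits c ρ → total ρ ≤ S
  total≤S ρ c = ≤-trans (m≤m+n _ c)

  -- `Fits` reserves below `S` all the growth that the remaining cost allows, so every operation
  -- takes at most `U` steps. The bound on the final size re-establishes `Fits` for whatever runs
  -- next.
  simulate : ∀ {p ρ o} gl → Exec W p ρ o → Fits (cost W p) ρ →
             Ends (compile p) (gl , blank , cells ρ g) (cost W p * U) (total ρ + cost W p) g o
  iterate  : ∀ {j p q k ρ o} gl → Iter W j p q k ρ o → Fits (iterCost k (cost W p + cost W q)) ρ →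
             Ends (loopF (popF (toℕ j)) (compile p) (compile q)) (gl , blank , cells ρ g)
                  (iterCost k (cost W p + cost W q) * U) (total ρ + iterCost k (cost W p + cost W q)) g o

  simulate gl skip f = finishes (m≤m+n _ _) (reach-mono one (leave-runs done))
  simulate gl fail f = rejects (reach-mono one (leave-runs rejected))
  simulate {ρ = ρ} gl (push {j} {b}) f =
    let (gl′ , r) = pushF-runs j b ρ gl g
    in finishes (≤-reflexive (trans (total-push j ρ b) (+-comm 1 _))) (reach-mono (once 0 (total≤S ρ _ f)) r)
  simulate {ρ = ρ} gl (pop-[] {j} {p} {q} {r} e x) f =
    weaken-ends (+-mono-≤ (opCost-mono (total≤S ρ _ f)) (*-monoˡ-≤ U c≤)) (+-monoʳ-≤ (total ρ) (m≤n⇒m≤1+n c≤))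
      (branch-empty (popF-empty j ρ gl g e) (simulate gl x (fits-mono ρ (m≤n⇒m≤1+n c≤) f)))
    where
    c≤ : cost W p ≤ cost W p + (cost W q + cost W r)
    c≤ = m≤m+n _ _
  simulate {ρ = ρ} gl (pop-∷ {j} {p} {q} {r} {b = b} {xs} e x) f =
    let (gl′ , run) = popF-bit j b xs ρ gl g e
    in weaken-ends (+-mono-≤ (opCost-mono (total≤S ρ _ f)) (*-monoˡ-≤ U c≤))
         (+-mono-≤ (total-pop j ρ e) (m≤n⇒m≤1+n c≤))
         (branch-bit b run (pick-ends q r b
           (simulate gl′ x (fits-pop ρ _ j e (fits-mono ρ (m≤n⇒m≤1+n c≤) f)))))
    where
    c≤ : cost W (pick q r b) ≤ cost W p + (cost W q + cost W r)
    c≤ = ≤-trans (pick-cost q r b) (m≤n+m _ (cost W p))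
  simulate {ρ = ρ} gl (_⨾_ {p} {q} x y) f with simulate gl x (fits-mono ρ (m≤m+n _ _) f)
  ... | finishes {ρ′} {gl′} t≤ run =
    weaken-ends (≤-reflexive (sym (*-distribʳ-+ U (cost W p) (cost W q)))) bound
      (map-ends (then-runs run) (simulate gl′ y (≤-trans bound f)))
    where
    bound : total ρ′ + cost W q ≤ total ρ + (cost W p + cost W q)
    bound = ≤-trans (+-monoˡ-≤ (cost W q) t≤) (≤-reflexive (+-assoc (total ρ) _ _))
  simulate {ρ = ρ} gl (abort {p} {q} x) f with simulate gl x (fits-mono ρ (m≤m+n _ _) f)
  ... | rejects run = rejects (reach-mono (*-monoˡ-≤ U (m≤m+n (cost W p) (cost W q))) (then-reject run))
  simulate gl (loop i) f = iterate gl i f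

  iterate {j} {p} {q} {ρ = ρ} gl (stop {k} e) f =
    finishes (m≤m+n _ _) (reach-mono (once (k * suc (cost W p + cost W q)) (total≤S ρ _ f)) (wire-exit 2 _ _ {i = 0F} refl (popF-empty j ρ gl g e)))
  iterate {j} {p} {q} {ρ = ρ} gl (more {k} {b = b} {xs} e x i) f
    with popF-bit j b xs ρ gl g e
  ... | gl′ , run with simulate gl′ x (fits-pop ρ _ j e (fits-mono ρ c≤ f))
    where
    c≤ : cost W (pick p q b) ≤ iterCost (suc k) (cost W p + cost W q)
    c≤ = ≤-trans (pick-cost p q b) (≤-trans (m≤m+n _ _) (m≤n+m _ 2))
  ... | finishes {ρ″} {gl″} t≤ run′ =
    weaken-ends time bound
      (loop-bit b run (pick-runs p q b run′) (iterate gl″ i (≤-trans bound f)))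
    where
    c = cost W p + cost W q
    bound : total ρ″ + iterCost k c ≤ total ρ + iterCost (suc k) c
    bound = begin
      total ρ″ + suc (k * suc c)                                ≤⟨ +-monoˡ-≤ _ (≤-trans t≤ (+-mono-≤ (total-pop j ρ e) (pick-cost p q b))) ⟩
      total ρ + c + suc (k * suc c)                             ≤⟨ n≤1+n _ ⟩
      suc (total ρ + c + suc (k * suc c))                       ≡⟨ solve 3 (λ a b d → con 1 :+ (a :+ b :+ (con 1 :+ d)) := a :+ (con 1 :+ (con 1 :+ b :+ d))) refl (total ρ) c (k * suc c) ⟩
      total ρ + suc (suc c + k * suc c)                         ∎
      where
      open ≤-Reasoning
      open +-*-Solver
    time : opCost (total ρ) + (cost W (pick p q b) * U + iterCost k c * U) ≤ iterCost (suc k) c * U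
    time = begin
      opCost (total ρ) + (cost W (pick p q b) * U + iterCost k c * U)
        ≤⟨ +-mono-≤ (opCost-mono (total≤S ρ _ f)) (+-monoˡ-≤ _ (*-monoˡ-≤ U (pick-cost p q b))) ⟩
      U + (c * U + suc (k * suc c) * U)
        ≡⟨ solve 3 (λ u c d → u :+ (c :* u :+ (con 1 :+ d) :* u) := (con 1 :+ (con 1 :+ c :+ d)) :* u) refl U c (k * suc c) ⟩
      iterCost (suc k) c * U ∎
      where
      open ≤-Reasoning
      open +-*-Solver
  iterate {j} {p} {q} {ρ = ρ} gl (abort {k} {b = b} {xs} e x) f
    with popF-bit j b xs ρ gl g e
  ... | gl′ , run with simulate gl′ x (fits-pop ρ _ j e (fits-mono ρ c≤ f))
    where
    c≤ : cost W (pick p q b) ≤ iterCost (suc k) (cost W p + cost W q)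
    c≤ = ≤-trans (pick-cost p q b) (≤-trans (m≤m+n _ _) (m≤n+m _ 2))
  ... | rejects run′ = rejects (reach-mono time (loop-reject b run (pick-runs p q b run′)))
    where
    c = cost W p + cost W q
    time : opCost (total ρ) + cost W (pick p q b) * U ≤ iterCost (suc k) c * U
    time = begin
      opCost (total ρ) + cost W (pick p q b) * U ≤⟨ +-mono-≤ (opCost-mono (total≤S ρ _ f)) (*-monoˡ-≤ U (pick-cost p q b)) ⟩
      U + c * U                                  ≤⟨ *-monoˡ-≤ U {x = suc c} (s≤s (≤-trans (m≤m+n c (k * suc c)) (n≤1+n _))) ⟩
      iterCost (suc k) c * U                     ∎
      where open ≤-Reasoning

-- Turing machines and fragments

tapeOf : {M : TM} → Config M → Tape
tapeOf (cfg q l h r) = l , h , r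

module _ (M : TM) where

  private
    Q : Set
    Q = Fin (suc (TM.nQ M))

  embedMove : Sym → Maybe (Q × Sym × Move) → (Q ⊎ Exit) × Sym × Move
  embedMove h nothing             = inj₂ done , h , N
  embedMove h (just (q , w , m))  = inj₁ q , w , m

  embed : Frag
  embed = record { St = Q ; fin = finFin _ ; start = zero ; tr = λ q h → embedMove h (TM.δ M q h) }

  -- Halting is no step of `M`, but as a fragment it needs an exit transition; hence `suc k`.
  embed-runs : ∀ k (c c′ : Config M) → haltsWithin k c ≡ just c′ →
               Reach embed (Config.state c) (tapeOf c) (suc k) done (tapeOf c′)
  embed-runs zero (cfg q l h r) c′ eq with TM.δ M q h in δ≡
  embed-runs zero (cfg q l h r) .(cfg q l h r) refl | nothing = exit (cong (embedMove h) δ≡)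
  embed-runs (suc k) (cfg q l h r) c′ eq with TM.δ M q h in δ≡
  embed-runs (suc k) (cfg q l h r) .(cfg q l h r) refl | nothing = exit (cong (embedMove h) δ≡)
  embed-runs (suc k) (cfg q l h r) c′ eq | just (q′ , w , m) rewrite moveTape-shift {M} q′ l w r m =
    go (cong (embedMove h) δ≡) (embed-runs k (atTape q′ (shift l w r m)) c′ eq)

module _ (F : Frag) where

  private
    Q : Set
    Q = Fin (suc (suc (size (fin F))))

  -- A machine starts in state 0, whereas `enc` may place `start F` anywhere; so state 0 is an extra
  -- copy of the start state, and state 1 is the halting state.
  stateOf : Q → Maybe (St F)
  stateOf zero          = just (start F)
  stateOf (suc zero)    = nothing
  stateOf (suc (suc i)) = just (dec (fin F) i)

  codeMove : (St F ⊎ Exit) × Sym × Move → Q × Sym × Move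
  codeMove (inj₁ s , w , m) = suc (suc (enc (fin F) s)) , w , m
  codeMove (inj₂ e , w , m) = suc zero , w , m

  codeδ : Maybe (St F) → Sym → Maybe (Q × Sym × Move)
  codeδ nothing  h = nothing
  codeδ (just s) h = just (codeMove (tr F s h))

  toTM : TM
  toTM = record { nQ = suc (size (fin F)) ; δ = λ q → codeδ (stateOf q) }

  toTM-step : ∀ {q s l h r} → stateOf q ≡ just s → step {toTM} (cfg q l h r) ≡
              just (let (q′ , w , m) = codeMove (tr F s h) in atTape q′ (shift l w r m))
  toTM-step {s = s} {l} {h} {r} eq rewrite eq with codeMove (tr F s h)
  ... | q′ , w , m = cong just (moveTape-shift {toTM} q′ l w r m)

  haltsWithin-step : ∀ {k c c′} → step {toTM} c ≡ just c′ → haltsWithin (suc k) c ≡ haltsWithin k c′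
  haltsWithin-step eq rewrite eq = refl

  halted : ∀ k t → haltsWithin k (atTape {toTM} (suc zero) t) ≡ just (atTape (suc zero) t)
  halted zero    (l , h , r) = refl
  halted (suc k) (l , h , r) = refl

  toTM-halts : ∀ {s t k e t′} q → stateOf q ≡ just s → Reach F s t k e t′ →
               haltsWithin k (atTape {toTM} q t) ≡ just (atTape (suc zero) t′)
  toTM-halts q eq (exit {l = l} {h} {r} {e} {w} {m} {k} p) =
    trans (haltsWithin-step {k} (trans (toTM-step {q} eq) (cong (λ z → just (let (q′ , w′ , m′) = codeMove z in atTape q′ (shift l w′ r m′))) p)))
          (halted k (shift l w r m))
  toTM-halts q eq (go {s} {s′} {l} {h} {r} {e} {w} {m} {k} p x) =
    trans (haltsWithin-step {k} (trans (toTM-step {q} eq) (cong (λ z → just (let (q′ , w′ , m′) = codeMove z in atTape q′ (shift l w′ r m′))) p)))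
          (toTM-halts (suc (suc (enc (fin F) s′))) (cong just (dec-enc (fin F) s′)) x)

rightLength : Tape → ℕ
rightLength (l , h , r) = suc (length r)

rightLength-shift : ∀ l h r m → rightLength (shift l h r m) ≤ 2 + length r
rightLength-shift l       h r       N = n≤1+n _
rightLength-shift []      h r       L = ≤-refl
rightLength-shift (_ ∷ _) h r       L = ≤-refl
rightLength-shift []      h []      R = n≤1+n _
rightLength-shift (_ ∷ _) h []      R = n≤1+n _
rightLength-shift []      h (_ ∷ r) R = m≤n+m _ 2
rightLength-shift (_ ∷ _) h (_ ∷ r) R = m≤n+m _ 2

-- A step lengthens the right half by at most one cell. This bounds the output of a machine by its
-- running time.
reach-rightLength : ∀ {F s t k e t′} → Reach F s t k e t′ → rightLength t′ ≤ k + rightLength t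
reach-rightLength (exit {l = l} {r = r} {w = w} {m} {k} p) = begin
  rightLength (shift l w r m) ≤⟨ rightLength-shift l w r m ⟩
  2 + length r                ≤⟨ s≤s (m≤n+m (suc (length r)) k) ⟩
  suc k + suc (length r)      ∎
  where open ≤-Reasoning
reach-rightLength {t′ = t′} (go {l = l} {r = r} {w = w} {m} {k} p x) = begin
  rightLength t′                  ≤⟨ reach-rightLength x ⟩
  k + rightLength (shift l w r m) ≤⟨ +-monoʳ-≤ k (rightLength-shift l w r m) ⟩
  k + (2 + length r)              ≡⟨ +-suc k (suc (length r)) ⟩
  suc k + suc (length r)          ∎
  where open ≤-Reasoning

length-readBits : ∀ x → length (readBits x) ≤ length x
length-readBits []          = z≤n
length-readBits (s0 ∷ x)    = s≤s (length-readBits x)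
length-readBits (s1 ∷ x)    = s≤s (length-readBits x)
length-readBits (blank ∷ x) = z≤n

readBits-bits : ∀ z x → readBits (bits z ++ blank ∷ x) ≡ z
readBits-bits []          x = refl
readBits-bits (false ∷ z) x = cong (false ∷_) (readBits-bits z x)
readBits-bits (true ∷ z)  x = cong (true ∷_) (readBits-bits z x)

-- Preparing the stacks, delivering the output, composing with a machine

addBlank : Frag
addBlank = record { St = Fin 2 ; fin = finFin 2 ; start = 0F ; tr = t }
  where
  t : Fin 2 → Sym → (Fin 2 ⊎ Exit) × Sym × Move
  t 0F h = inj₁ 1F , h , L
  t 1F h = inj₂ done , blank , N

addBlank-runs : ∀ l h r → ∃ λ l′ → Runs addBlank (l , h , r) 2 done (l′ , blank , h ∷ r)
addBlank-runs []      h r = _ , go refl (exit refl)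
addBlank-runs (_ ∷ l) h r = _ , go refl (exit refl)

addBlanks : ℕ → Frag
addBlanks zero    = leave done
addBlanks (suc k) = then addBlank (addBlanks k)

initVec : ∀ k → Str → Vec Str (suc k)
initVec zero    z = z ∷ []
initVec (suc k) z = [] ∷ initVec k z

addBlanks-runs : ∀ k j z l g → ∃ λ l′ →
  Runs (addBlanks k) (l , blank , cells (initVec j z) g) (k * 2 + 1) done (l′ , blank , cells (initVec (k + j) z) g)
addBlanks-runs zero    j z l g = l , leave-runs done
addBlanks-runs (suc k) j z l g with addBlank-runs l blank (cells (initVec j z) g)
... | l′ , p with addBlanks-runs k (suc j) z l′ g
... | l″ , q = l″ , then-runs p (reach-to (cong (λ i → l″ , blank , cells (initVec i z) g) (+-suc k j)) q)

-- The output of the preceding machine becomes the last stack: it ends at the first blank to its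
-- right, which serves as closing blank. The `k` empty stacks before it are `k` further blanks on
-- the left.
setup : ℕ → Frag
setup k = then addBlank (then (seekBlank R) (then (seekBlank L) (addBlanks k)))

setupCost : ℕ → ℕ → ℕ
setupCost k s = 2 + ((2 + s) + ((2 + s) + (k * 2 + 1)))

setup-runs : ∀ k l h r → ∃₂ λ l′ g →
  Runs (setup k) (l , h , r) (setupCost k (length (readBits (h ∷ r)))) done
       (l′ , blank , cells (initVec k (readBits (h ∷ r))) g)
setup-runs k l h r with addBlank-runs l h r
... | l₁ , p with seekR-readBits-loop l₁ blank (h ∷ r)
... | g , q with addBlanks-runs k 0 (readBits (h ∷ r)) l₁ g
... | l₂ , b = l₂ , g , then-runs p (then-runs (go refl q)
      (then-runs back (reach-to (cong (λ i → l₂ , blank , cells (initVec i z) g) (+-identityʳ k)) b)))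
  where
  z = readBits (h ∷ r)
  back : Runs (seekBlank L) (bits z ʳ++ (blank ∷ l₁) , blank , g) (2 + length z) done (l₁ , blank , bits z ++ blank ∷ g)
  back = reach-from (cong (_, (blank , g)) (bits-ʳ++ z _))
    (reach-to (cong (λ x → l₁ , blank , x) (bits-reverse-ʳ++ z _))
      (subst (λ i → Runs (seekBlank L) (bits (reverse z) ++ blank ∷ l₁ , blank , g) (2 + i) done
                      (l₁ , blank , bits (reverse z) ʳ++ (blank ∷ g)))
        (length-reverse z) (seekL (reverse z) l₁ blank g)))

-- `output` reads from the head onwards, so the head leaves the home blank and steps onto the first
-- stack.
stepR : Frag
stepR = record { St = Fin 1 ; fin = finFin 1 ; start = 0F ; tr = λ _ h → inj₂ done , h , R }

stepR-runs : ∀ l z x → ∃₂ λ c y → ∃ λ l′ → Runs stepR (l , blank , bits z ++ blank ∷ x) 1 done (l′ , c , y) × readBits (c ∷ y) ≡ z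
stepR-runs []      []      x = _ , _ , _ , exit refl , refl
stepR-runs (_ ∷ _) []      x = _ , _ , _ , exit refl , refl
stepR-runs []      (b ∷ z) x = _ , _ , _ , exit refl , readBits-bits (b ∷ z) x
stepR-runs (_ ∷ _) (b ∷ z) x = _ , _ , _ , exit refl , readBits-bits (b ∷ z) x

-- Leaves the code 01 of the pair ([] , 0) at the head.
refuse : Frag
refuse = record { St = Fin 4 ; fin = finFin 4 ; start = 0F ; tr = t }
  where
  t : Fin 4 → Sym → (Fin 4 ⊎ Exit) × Sym × Move
  t 0F h = inj₁ 1F , s0 , R
  t 1F h = inj₁ 2F , s1 , R
  t 2F h = inj₁ 3F , blank , L
  t 3F h = inj₂ done , h , L

refuse-runs : ∀ t → ∃₂ λ c y → ∃ λ l′ → Runs refuse t 4 done (l′ , c , y) × readBits (c ∷ y) ≡ false ∷ true ∷ []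
refuse-runs ([]    , h , [])        = _ , _ , _ , go refl (go refl (go refl (exit refl))) , refl
refuse-runs (_ ∷ _ , h , [])        = _ , _ , _ , go refl (go refl (go refl (exit refl))) , refl
refuse-runs ([]    , h , _ ∷ [])    = _ , _ , _ , go refl (go refl (go refl (exit refl))) , refl
refuse-runs (_ ∷ _ , h , _ ∷ [])    = _ , _ , _ , go refl (go refl (go refl (exit refl))) , refl
refuse-runs ([]    , h , _ ∷ _ ∷ r) = _ , _ , _ , go refl (go refl (go refl (exit refl))) , refl
refuse-runs (_ ∷ _ , h , _ ∷ _ ∷ r) = _ , _ , _ , go refl (go refl (go refl (exit refl))) , refl

-- The second program starts with stacks of total size at most W′, which
-- is therefore also a bound for loops that only empty stacks.
data Result {k} (P P′ : Prog (suc k)) (W : ℕ) (z : Str) : Str → Set where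
  accepts : ∀ {out ρ} → Exec W P (initVec k z) (just ρ) →
            (total ρ ≤ (suc k + length z) + cost W P →
             ∃ λ ρ′ → Exec ((suc k + length z) + cost W P) P′ ρ (just (out ∷ ρ′))) →
            Result P P′ W z out
  refuses : Exec W P (initVec k z) nothing → Result P P′ W z (false ∷ true ∷ [])

totalCost : ∀ {k} (P P′ : Prog (suc k)) → ℕ → ℕ → ℕ
totalCost {k} P P′ W s = setupCost k s + (cost W P * opCost S + (cost W′ P′ * opCost S + 4))
  where
  W′ = (suc k + s) + cost W P
  S = W′ + cost W′ P′

total-initVec : ∀ k z → total (initVec k z) ≡ suc k + length z
total-initVec zero    z = +-identityʳ _
total-initVec (suc k) z = cong suc (total-initVec k z)

module _ (M : TM) {k : ℕ} (P P′ : Prog (suc k)) where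

  private
    node : Fin 6 → Frag
    node 0F = embed M
    node 1F = setup k
    node 2F = compile P
    node 3F = compile P′
    node 4F = stepR
    node 5F = refuse

    follow : Fin 6 → Exit → Fin 6 ⊎ Exit
    follow 0F e        = inj₁ 1F
    follow 1F e        = inj₁ 2F
    follow 2F nothing  = inj₁ 3F
    follow 2F (just _) = inj₁ 5F
    follow 3F e        = inj₁ 4F
    follow 4F e        = inj₂ done
    follow 5F e        = inj₂ done

    whole : Frag
    whole = wire 5 node follow

  compose : TM
  compose = toTM whole

  compose-halts : ∀ {t W out} x (c : Config M) → haltsWithin t (initial M x) ≡ just c → Result P P′ W (output c) out →
    ∃ λ c′ → haltsWithin (suc t + totalCost P P′ W (length (output c))) (initial compose x) ≡ just c′ × output c′ ≡ out
  compose-halts {t} {W} {out} x c@(cfg q l h r) halts result = final whole-run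
    where
    z = output c
    s = length z
    W′ = (suc k + s) + cost W P
    S = W′ + cost W′ P′

    eqW′ : total (initVec k z) + cost W P ≡ W′
    eqW′ = cong (_+ cost W P) (total-initVec k z)

    tape₀ : Tape
    tape₀ = tapeOf (initial M x)

    initial-at : ∀ x → initial compose x ≡ atTape zero (tapeOf (initial M x))
    initial-at []      = refl
    initial-at (b ∷ x) = refl

    start₀ : ∀ x → Config.state (initial M x) ≡ zero
    start₀ []      = refl
    start₀ (b ∷ x) = refl

    Goal : ℕ → Fin 6 → Tape → Set
    Goal n i t = ∃₂ λ c y → ∃ λ l′ → enter 5 node follow i t n done (l′ , c , y) × readBits (c ∷ y) ≡ out

    prepend : ∀ {n n′ i j e t t′} → follow i e ≡ inj₁ j → Runs (node i) t n e t′ → Goal n′ j t′ → Goal (n + n′) i t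
    prepend eq p (c , y , l , q , o) = c , y , l , wire-step 5 node follow eq p q , o

    weaken : ∀ {n n′ i t} → n ≤ n′ → Goal n i t → Goal n′ i t
    weaken le (c , y , l , q , o) = c , y , l , reach-mono le q , o

    program-run : ∀ gl g → Goal (cost W P * opCost S + (cost W′ P′ * opCost S + 4)) 2F (gl , blank , cells (initVec k z) g)
    program-run gl g = go′ result refl
      where
      fits : total (initVec k z) + cost W P ≤ S
      fits = ≤-trans (≤-reflexive eqW′) (m≤m+n W′ _)
      go′ : ∀ {o} → Result P P′ W z o → o ≡ out → Goal (cost W P * opCost S + (cost W′ P′ * opCost S + 4)) 2F (gl , blank , cells (initVec k z) g)
      go′ (refuses e) o≡ with Simulation.simulate W S g gl e fits
      ... | rejects {t′} run = prepend refl run (weaken (m≤n+m 4 _)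
        (let (c , y , l , p , o) = refuse-runs t′ in c , y , l , wire-exit 5 node follow {i = 5F} refl p , trans o o≡))
      go′ (accepts {out′} e f) o≡ with Simulation.simulate W S g gl e fits
      ... | finishes {ρ} {gl′} ρ≤ run
        with Simulation.simulate W′ S g gl′ (proj₂ (f (≤-trans ρ≤ (≤-reflexive eqW′)))) (+-monoˡ-≤ (cost W′ P′) (≤-trans ρ≤ (≤-reflexive eqW′)))
      ... | finishes {out′ ∷ ρ′} {gl″} _ run′ = prepend refl run (prepend refl run′ (weaken (s≤s z≤n)
        (let (c , y , l , p , o) = stepR-runs gl″ out′ (cells ρ′ g) in c , y , l , wire-exit 5 node follow {i = 4F} refl p , trans o o≡)))

    first : Runs (embed M) tape₀ (suc t) done (l , h , r)
    first = subst (λ q₀ → Reach (embed M) q₀ tape₀ (suc t) done (l , h , r)) (start₀ x)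
              (embed-runs M t (initial M x) c halts)

    whole-run : Goal (suc t + totalCost P P′ W s) 0F tape₀
    whole-run = let (gl , g , p) = setup-runs k l h r in
      prepend refl first (prepend refl p (program-run gl g))

    final : Goal (suc t + totalCost P P′ W s) 0F tape₀ → _
    final (c , y , l′ , p , o) = _ , trans (cong (haltsWithin (suc t + totalCost P P′ W s)) (initial-at x)) (toTM-halts whole zero refl p) , o

length-output : ∀ (M : TM) t x c → haltsWithin t (initial M x) ≡ just c → length (output c) ≤ suc t + suc (length x)
length-output M t x c@(cfg q l h r) halts = begin
  length (readBits (h ∷ r))                        ≤⟨ length-readBits (h ∷ r) ⟩
  suc (length r)                                   ≤⟨ reach-rightLength (embed-runs M t (initial M x) c halts) ⟩
  suc t + rightLength (tapeOf (initial M x))       ≤⟨ +-monoʳ-≤ (suc t) (initial-length x) ⟩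
  suc t + suc (length x)                           ∎
  where
  open ≤-Reasoning
  initial-length : ∀ x → rightLength (tapeOf (initial M x)) ≤ suc (length x)
  initial-length []      = ≤-refl
  initial-length (b ∷ x) = s≤s (≤-trans (≤-reflexive (length-map bitSym x)) (n≤1+n _))

-- Polynomial bounds

-- The base `suc x` is never zero, so exponents can be raised when two bounds are added.
PolyBounded : (ℕ → ℕ) → Set
PolyBounded f = ∃₂ λ a d → ∀ x → f x ≤ a * suc x ^ d

^-distribʳ-* : ∀ d a b → (a * b) ^ d ≡ a ^ d * b ^ d
^-distribʳ-* zero    a b = refl
^-distribʳ-* (suc d) a b = trans (cong (a * b *_) (^-distribʳ-* d a b))
  (solve 4 (λ a b s t → a :* b :* (s :* t) := a :* s :* (b :* t)) refl a b (a ^ d) (b ^ d))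
  where open +-*-Solver

pb-≤ : ∀ {f g} → (∀ x → f x ≤ g x) → PolyBounded g → PolyBounded f
pb-≤ f≤g (a , d , p) = a , d , λ x → ≤-trans (f≤g x) (p x)

pb-const : ∀ c → PolyBounded (λ _ → c)
pb-const c = c , 0 , λ x → ≤-reflexive (sym (*-identityʳ c))

pb-id : PolyBounded id
pb-id = 1 , 1 , λ x → ≤-trans (n≤1+n x) (≤-reflexive (sym (trans (*-identityˡ _) (*-identityʳ _))))

pb-+ : ∀ {f g} → PolyBounded f → PolyBounded g → PolyBounded (λ x → f x + g x)
pb-+ {f} {g} (a , d , p) (b , e , q) = a + b , d + e , λ x → begin
  f x + g x                                     ≤⟨ +-mono-≤ (p x) (q x) ⟩
  a * suc x ^ d + b * suc x ^ e                 ≤⟨ +-mono-≤ (*-monoʳ-≤ a (^-monoʳ-≤ (suc x) (m≤m+n d e))) (*-monoʳ-≤ b (^-monoʳ-≤ (suc x) (m≤n+m e d))) ⟩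
  a * suc x ^ (d + e) + b * suc x ^ (d + e)     ≡⟨ sym (*-distribʳ-+ (suc x ^ (d + e)) a b) ⟩
  (a + b) * suc x ^ (d + e)                     ∎
  where open ≤-Reasoning

pb-* : ∀ {f g} → PolyBounded f → PolyBounded g → PolyBounded (λ x → f x * g x)
pb-* {f} {g} (a , d , p) (b , e , q) = a * b , d + e , λ x → begin
  f x * g x                                     ≤⟨ *-mono-≤ (p x) (q x) ⟩
  a * suc x ^ d * (b * suc x ^ e)               ≡⟨ solve 4 (λ a s b t → a :* s :* (b :* t) := a :* b :* (s :* t)) refl a (suc x ^ d) b (suc x ^ e) ⟩
  a * b * (suc x ^ d * suc x ^ e)               ≡⟨ cong (a * b *_) (sym (^-distribˡ-+-* (suc x) d e)) ⟩
  a * b * suc x ^ (d + e)                       ∎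
  where
  open ≤-Reasoning
  open +-*-Solver

pb-∘ : ∀ {f g} → PolyBounded f → PolyBounded g → PolyBounded (f ∘ g)
pb-∘ {f} {g} (a , d , p) (b , e , q) = a * suc b ^ d , e * d , λ x → begin
  f (g x)                                  ≤⟨ p (g x) ⟩
  a * suc (g x) ^ d                        ≤⟨ *-monoʳ-≤ a (^-monoˡ-≤ d (inner x)) ⟩
  a * (suc b * suc x ^ e) ^ d              ≡⟨ cong (a *_) (^-distribʳ-* d (suc b) (suc x ^ e)) ⟩
  a * (suc b ^ d * (suc x ^ e) ^ d)        ≡⟨ sym (*-assoc a (suc b ^ d) _) ⟩
  a * suc b ^ d * (suc x ^ e) ^ d          ≡⟨ cong (a * suc b ^ d *_) (^-*-assoc (suc x) e d) ⟩
  a * suc b ^ d * suc x ^ (e * d)          ∎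
  where
  open ≤-Reasoning
  inner : ∀ x → suc (g x) ≤ suc b * suc x ^ e
  inner x = +-mono-≤ (m^n>0 (suc x) e) (q x)

pb-^ : ∀ c → PolyBounded (_^ c)
pb-^ c = 1 , c , λ x → ≤-trans (^-monoˡ-≤ c (n≤1+n x)) (≤-reflexive (sym (*-identityˡ _)))

pb-poly : ∀ c → PolyBounded (poly c)
pb-poly c = pb-+ (pb-* (pb-const c) (pb-^ c)) (pb-const c)

≤-poly : ∀ {f} → PolyBounded f → ∃ λ c → ∀ x → f x ≤ poly c x
≤-poly {f} (a , d , p) = c , bound
  where
  -- One constant has to serve as factor, exponent and summand: `a * 2 ^ d` absorbs the passage from
  -- `suc x` to `x` for positive `x`, `d` covers the exponent, and `a` the value at 0.
  c = a * 2 ^ d + (d + a)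
  open ≤-Reasoning
  bound : ∀ x → f x ≤ poly c x
  bound zero = begin
    f 0         ≤⟨ p 0 ⟩
    a * 1 ^ d   ≡⟨ trans (cong (a *_) (^-zeroˡ d)) (*-identityʳ a) ⟩
    a           ≤⟨ ≤-trans (m≤n+m a d) (m≤n+m (d + a) (a * 2 ^ d)) ⟩
    c           ≤⟨ m≤n+m c (c * 0 ^ c) ⟩
    poly c 0    ∎
  bound (suc x) = begin
    f (suc x)                      ≤⟨ p (suc x) ⟩
    a * suc (suc x) ^ d            ≤⟨ *-monoʳ-≤ a (^-monoˡ-≤ d double) ⟩
    a * (2 * suc x) ^ d            ≡⟨ cong (a *_) (^-distribʳ-* d 2 (suc x)) ⟩
    a * (2 ^ d * suc x ^ d)        ≡⟨ sym (*-assoc a (2 ^ d) _) ⟩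
    a * 2 ^ d * suc x ^ d          ≤⟨ *-mono-≤ (m≤m+n (a * 2 ^ d) _) (^-monoʳ-≤ (suc x) (≤-trans (m≤m+n d a) (m≤n+m (d + a) (a * 2 ^ d)))) ⟩
    c * suc x ^ c                  ≤⟨ m≤m+n _ c ⟩
    poly c (suc x)                 ∎
    where
    double : suc (suc x) ≤ 2 * suc x
    double = s≤s (≤-trans (≤-reflexive (+-comm 1 x)) (+-monoʳ-≤ x (s≤s z≤n)))

pb-cost : ∀ {K} (p : Prog K) → PolyBounded (λ W → cost W p)
pb-cost skip          = pb-const 1
pb-cost fail          = pb-const 1
pb-cost (push j b)    = pb-const 1
pb-cost (pop j p q r) = pb-+ (pb-const 1) (pb-+ (pb-cost p) (pb-+ (pb-cost q) (pb-cost r)))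
pb-cost (p ⨾ q)       = pb-+ (pb-cost p) (pb-cost q)
pb-cost (loop j p q)  = pb-+ (pb-const 1) (pb-* pb-id (pb-+ (pb-const 1) (pb-+ (pb-cost p) (pb-cost q))))

cost-mono : ∀ {K} (p : Prog K) {a b} → a ≤ b → cost a p ≤ cost b p
cost-mono skip          a≤b = ≤-refl
cost-mono fail          a≤b = ≤-refl
cost-mono (push j b)    a≤b = ≤-refl
cost-mono (pop j p q r) a≤b = s≤s (+-mono-≤ (cost-mono p a≤b) (+-mono-≤ (cost-mono q a≤b) (cost-mono r a≤b)))
cost-mono (p ⨾ q)       a≤b = +-mono-≤ (cost-mono p a≤b) (cost-mono q a≤b)
cost-mono (loop j p q)  a≤b = s≤s (*-mono-≤ a≤b (s≤s (+-mono-≤ (cost-mono p a≤b) (cost-mono q a≤b))))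

pb-opCost : ∀ {f} → PolyBounded f → PolyBounded (opCost ∘ f)
pb-opCost = pb-∘ (pb-+ (pb-const 9) (pb-* (pb-const 7) pb-id))

module _ {k : ℕ} (P P′ : Prog (suc k)) where

  totalCost-mono : ∀ W {s s′} → s ≤ s′ → totalCost P P′ W s ≤ totalCost P P′ W s′
  totalCost-mono W {s} {s′} s≤s′ =
    +-mono-≤ (+-monoʳ-≤ 2 (+-mono-≤ (+-monoʳ-≤ 2 s≤s′) (+-monoˡ-≤ _ (+-monoʳ-≤ 2 s≤s′))))
      (+-mono-≤ (*-monoʳ-≤ (cost W P) U≤) (+-monoˡ-≤ 4 (*-mono-≤ (cost-mono P′ W′≤) U≤)))
    where
    W′≤ : suc k + s + cost W P ≤ suc k + s′ + cost W P
    W′≤ = +-monoˡ-≤ (cost W P) (+-monoʳ-≤ (suc k) s≤s′)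
    U≤ : opCost (suc k + s + cost W P + cost (suc k + s + cost W P) P′) ≤
         opCost (suc k + s′ + cost W P + cost (suc k + s′ + cost W P) P′)
    U≤ = opCost-mono (+-mono-≤ W′≤ (cost-mono P′ W′≤))

  pb-totalCost : ∀ {w s} → PolyBounded w → PolyBounded s → PolyBounded (λ x → totalCost P P′ (w x) (s x))
  pb-totalCost {w} {s} pw ps =
    pb-+ (pb-+ (pb-const 2) (pb-+ (pb-+ (pb-const 2) ps) (pb-+ (pb-+ (pb-const 2) ps) (pb-const (k * 2 + 1)))))
      (pb-+ (pb-* cP U) (pb-+ (pb-* cP′ U) (pb-const 4)))
    where
    cP : PolyBounded (λ x → cost (w x) P)
    cP = pb-∘ (pb-cost P) pw
    W′ : PolyBounded (λ x → suc k + s x + cost (w x) P)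
    W′ = pb-+ (pb-+ (pb-const (suc k)) ps) cP
    cP′ : PolyBounded (λ x → cost (suc k + s x + cost (w x) P) P′)
    cP′ = pb-∘ (pb-cost P′) W′
    U : PolyBounded (λ x → opCost (suc k + s x + cost (w x) P + cost (suc k + s x + cost (w x) P) P′))
    U = pb-opCost (pb-+ W′ cP′)

haltsWithin-mono : ∀ {M : TM} {k k′ c c′} → k ≤ k′ → haltsWithin {M} k c ≡ just c′ → haltsWithin k′ c ≡ just c′
haltsWithin-mono {k = zero} {zero}   {c} le       eq = eq
haltsWithin-mono {k = zero} {suc k′} {c} le       eq with step c
... | nothing = eq
haltsWithin-mono {k = suc k} {suc k′} {c} (s≤s le) eq with step c
... | nothing = eq
... | just c₁ = haltsWithin-mono {k = k} {k′} {c₁} le eq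

outBound : ℕ → ℕ → ℕ
outBound c ℓ = suc (poly c ℓ) + suc ℓ

-- The output of the given machine is at most `outBound` of its input length, so `w` of that bounds
-- the loops of `P`. All bounds are then polynomials composed with polynomials.
postcompose : ∀ {F : Str → ℕ → Str × ℕ} {k} (P P′ : Prog (suc k)) (w : ℕ → ℕ) (f : Str → ℕ → Str × ℕ) → PolyBounded w →
  (∀ b x p → length (encPair x p) ≤ b → Result P P′ (w b) (encPair x p) (encPair (proj₁ (f x p)) (proj₂ (f x p)))) →
  PolyTimeComputable F → PolyTimeComputable (λ x p → f (proj₁ (F x p)) (proj₂ (F x p)))
postcompose {F} {k} P P′ w f pw result (M , c , halts) = compose M P P′ , proj₁ bound , run
  where
  T : ℕ → ℕ
  T ℓ = suc (poly c ℓ) + totalCost P P′ (w (outBound c ℓ)) (outBound c ℓ)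
  pb-out : PolyBounded (outBound c)
  pb-out = pb-+ (pb-+ (pb-const 1) (pb-poly c)) (pb-+ (pb-const 1) pb-id)
  bound = ≤-poly {T} (pb-+ (pb-+ (pb-const 1) (pb-poly c)) (pb-totalCost P P′ (pb-∘ pw pb-out) pb-out))
  run : ∀ x p → Σ (Config (compose M P P′)) λ fin →
    (haltsWithin (poly (proj₁ bound) (length (encPair x p))) (initial (compose M P P′) (encPair x p)) ≡ just fin) × _
  run x p with halts x p
  ... | c₁ , h , o =
    let ℓ = length (encPair x p)
        out≤ = length-output M (poly c ℓ) (encPair x p) c₁ h
        (c₂ , h₂ , o₂) = compose-halts M P P′ {W = w (outBound c ℓ)} (encPair x p) c₁ h
          (subst (λ z → Result P P′ _ z _) (sym o) (result (outBound c ℓ) _ _ (subst (λ z → length z ≤ outBound c ℓ) o out≤)))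
    in c₂ , haltsWithin-mono (≤-trans (+-monoʳ-≤ (suc (poly c ℓ)) (totalCost-mono P P′ _ out≤)) (proj₂ bound ℓ)) h₂ , o₂

-- Stack programs for unary arithmetic

ones : ℕ → Str
ones m = replicate m true

dbl : Str → Str
dbl = concatMap (λ b → b ∷ b ∷ [])

replicate-++-∷ : ∀ b m x → replicate m b ++ b ∷ x ≡ b ∷ replicate {A = Bool} m b ++ x
replicate-++-∷ b zero    x = refl
replicate-++-∷ b (suc m) x = cong (b ∷_) (replicate-++-∷ b m x)

replicate-ʳ++ : ∀ b m x → replicate m b ʳ++ x ≡ replicate {A = Bool} m b ++ x
replicate-ʳ++ b zero    x = refl
replicate-ʳ++ b (suc m) x = trans (replicate-ʳ++ b m (b ∷ x)) (replicate-++-∷ b m x)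

ones-++-∷ : ∀ m x → ones m ++ true ∷ x ≡ true ∷ ones m ++ x
ones-++-∷ = replicate-++-∷ true

ones-+ : ∀ a b x → ones a ++ (ones b ++ x) ≡ ones (a + b) ++ x
ones-+ zero    b x = refl
ones-+ (suc a) b x = cong (true ∷_) (ones-+ a b x)

ones-++-ones : ∀ a b → ones a ++ ones b ≡ ones (a + b)
ones-++-ones zero    b = refl
ones-++-ones (suc a) b = cong (true ∷_) (ones-++-ones a b)

drained : Str → Str → Str
drained []      y = y
drained (b ∷ x) y = drained x (b ∷ b ∷ y)

-- Moving a stack bit by bit doubles and reverses it at once. Therefore everything destined for the
-- output is collected last first.
drained-ʳ++ : ∀ x z y → drained x (dbl z ++ y) ≡ dbl (x ʳ++ z) ++ y
drained-ʳ++ []      z y = refl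
drained-ʳ++ (b ∷ x) z y = drained-ʳ++ x (b ∷ z) y

module Three {K} (ρ : Vec Str K) {j k l : Fin K} (j≢k : j ≢ k) (j≢l : j ≢ l) (k≢l : k ≢ l) where

  put : Str → Str → Str → Vec Str K
  put a b c = ((ρ [ j ]≔ a) [ k ]≔ b) [ l ]≔ c

  get-l : ∀ a b c → Vec.lookup (put a b c) l ≡ c
  get-l a b c = Vecₚ.lookup∘update l ((ρ [ j ]≔ a) [ k ]≔ b) c

  get-k : ∀ a b c → Vec.lookup (put a b c) k ≡ b
  get-k a b c = trans (Vecₚ.lookup∘update′ k≢l ((ρ [ j ]≔ a) [ k ]≔ b) c) (Vecₚ.lookup∘update k (ρ [ j ]≔ a) b)

  get-j : ∀ a b c → Vec.lookup (put a b c) j ≡ a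
  get-j a b c = trans (Vecₚ.lookup∘update′ j≢l ((ρ [ j ]≔ a) [ k ]≔ b) c)
    (trans (Vecₚ.lookup∘update′ j≢k (ρ [ j ]≔ a) b) (Vecₚ.lookup∘update j ρ a))

  set-l : ∀ {a b c} c′ → put a b c [ l ]≔ c′ ≡ put a b c′
  set-l c′ = Vecₚ.[]≔-idempotent _ l

  set-k : ∀ {a b c} b′ → put a b c [ k ]≔ b′ ≡ put a b′ c
  set-k {a} {b} {c} b′ = trans (Vecₚ.[]≔-commutes _ l k (k≢l ∘ sym)) (cong (_[ l ]≔ c) (Vecₚ.[]≔-idempotent _ k))

  set-j : ∀ {a b c} a′ → put a b c [ j ]≔ a′ ≡ put a′ b c
  set-j {a} {b} {c} a′ = trans (Vecₚ.[]≔-commutes _ l j (j≢l ∘ sym)) (cong (_[ l ]≔ c)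
    (trans (Vecₚ.[]≔-commutes _ k j (j≢k ∘ sym)) (cong (_[ k ]≔ b) (Vecₚ.[]≔-idempotent _ j))))

  put-jk : ∀ {a b} c → Vec.lookup ρ j ≡ a → Vec.lookup ρ k ≡ b → put a b c ≡ ρ [ l ]≔ c
  put-jk c refl refl = cong (_[ l ]≔ c) (trans (cong (_[ k ]≔ _) (Vecₚ.[]≔-lookup ρ j)) (Vecₚ.[]≔-lookup ρ k))

  put-jkl : ∀ {a b c} → Vec.lookup ρ j ≡ a → Vec.lookup ρ k ≡ b → Vec.lookup ρ l ≡ c → put a b c ≡ ρ
  put-jkl {c = c} ej ek refl = trans (put-jk c ej ek) (Vecₚ.[]≔-lookup ρ l)

pushes : ∀ {K} → ℕ → Fin K → Prog K
pushes zero    j = skip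
pushes (suc m) j = pushes m j ⨾ push j true

clear : ∀ {K} → Fin K → Prog K
clear j = loop j skip skip

-- t is a scratch stack.
copy : ∀ {K} → (j t d : Fin K) → Prog K
copy j t d = loop j skip (push t true ⨾ push d true) ⨾ loop t skip (push j true)

-- The input stack i holds the doubled bits of a string, the end mark 01
-- and a unary number.
readBit : ∀ {K} → Fin K → (on0 on1 onEnd : Prog K) → Prog K
readBit i p q e = pop i fail (pop i fail p e) (pop i fail fail q)

-- Reads 1^m 0 and adds m to d; c is a flag that keeps the loop alive.
readNum : ∀ {K} → (c d i : Fin K) → Prog K
readNum c d i = push c true ⨾ loop c skip (readBit i skip (push d true ⨾ push c true) fail)

drain : ∀ {K} → (j o : Fin K) → Prog K
drain j o = loop j (push o false ⨾ push o false) (push o true ⨾ push o true)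

module Programs {K : ℕ} (W : ℕ) where

  exec-to : ∀ {p : Prog K} {ρ ρ′ ρ″} → ρ′ ≡ ρ″ → Exec W p ρ (just ρ′) → Exec W p ρ (just ρ″)
  exec-to refl x = x

  exec-from : ∀ {p : Prog K} {ρ ρ′ o} → ρ′ ≡ ρ → Exec W p ρ o → Exec W p ρ′ o
  exec-from refl x = x

  iter-from : ∀ {j} {p q : Prog K} {k ρ ρ′ o} → ρ′ ≡ ρ → Iter W j p q k ρ o → Iter W j p q k ρ′ o
  iter-from refl x = x

  pushes-exec : ∀ m (j : Fin K) ρ → Exec W (pushes m j) ρ (just (ρ [ j ]≔ (ones m ++ Vec.lookup ρ j)))
  pushes-exec zero    j ρ = exec-to (sym (Vecₚ.[]≔-lookup ρ j)) skip
  pushes-exec (suc m) j ρ = pushes-exec m j ρ ⨾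
    exec-to (trans (Vecₚ.[]≔-idempotent ρ j) (cong (λ z → ρ [ j ]≔ (true ∷ z)) (Vecₚ.lookup∘update j ρ _))) push

  clear-iter : ∀ (j : Fin K) ρ x → Vec.lookup ρ j ≡ x → Iter W j skip skip (length x) ρ (just (ρ [ j ]≔ []))
  clear-iter j ρ []      e = subst (λ z → Iter W j skip skip 0 ρ (just z)) (trans (sym (Vecₚ.[]≔-lookup ρ j)) (cong (ρ [ j ]≔_) e)) (stop e)
  clear-iter j ρ (b ∷ x) e = more e (both b) (subst (λ z → Iter W j skip skip (length x) (ρ [ j ]≔ x) (just z)) (Vecₚ.[]≔-idempotent ρ j)
      (clear-iter j (ρ [ j ]≔ x) x (Vecₚ.lookup∘update j ρ x)))
    where
    both : ∀ b {ρ : Vec Str K} → Exec W (pick skip skip b) ρ (just ρ)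
    both false = skip
    both true  = skip

  clear-exec : ∀ (j : Fin K) ρ m → Vec.lookup ρ j ≡ ones m → m ≤ W → Exec W (clear j) ρ (just (ρ [ j ]≔ []))
  clear-exec j ρ m e m≤W = loop≤ W (≤-trans (≤-reflexive (length-replicate m)) m≤W) (clear-iter j ρ (ones m) e)

  module _ (ρ : Vec Str K) {j t d : Fin K} (j≢t : j ≢ t) (j≢d : j ≢ d) (t≢d : t ≢ d) where

    open Three ρ j≢t j≢d t≢d

    copy-out : ∀ m b c → Iter W j skip (push t true ⨾ push d true) m (put (ones m) b c)
                 (just (put [] (ones m ++ b) (ones m ++ c)))
    copy-out zero    b c = stop (get-j _ _ _)
    copy-out (suc m) b c = more (get-j _ _ _)
      (exec-from (set-j (ones m))
        (exec-to (trans (set-k _) (cong (λ z → put (ones m) (true ∷ z) c) (get-k (ones m) b c))) push ⨾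
         exec-to (trans (set-l _) (cong (λ z → put (ones m) (true ∷ b) (true ∷ z)) (get-l (ones m) (true ∷ b) c))) push))
      (subst₂ (λ x y → Iter W j skip (push t true ⨾ push d true) m (put (ones m) (true ∷ b) (true ∷ c)) (just (put [] x y)))
        (ones-++-∷ m b) (ones-++-∷ m c) (copy-out m (true ∷ b) (true ∷ c)))

    copy-back : ∀ m a c → Iter W t skip (push j true) m (put a (ones m) c) (just (put (ones m ++ a) [] c))
    copy-back zero    a c = stop (get-k _ _ _)
    copy-back (suc m) a c = more (get-k _ _ _)
      (exec-from (set-k (ones m))
        (exec-to (trans (set-j _) (cong (λ z → put (true ∷ z) (ones m) c) (get-j a (ones m) c))) push))
      (subst (λ x → Iter W t skip (push j true) m (put (true ∷ a) (ones m) c) (just (put x [] c)))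
        (ones-++-∷ m a) (copy-back m (true ∷ a) c))

    copy-exec : ∀ m → Vec.lookup ρ j ≡ ones m → Vec.lookup ρ t ≡ [] → m ≤ W →
                Exec W (copy j t d) ρ (just (ρ [ d ]≔ (ones m ++ Vec.lookup ρ d)))
    copy-exec m ej et m≤W = exec-from (sym (put-jkl ej et refl))
      (loop≤ W m≤W (copy-out m [] (Vec.lookup ρ d)) ⨾
       exec-from (cong (λ z → put [] z (ones m ++ Vec.lookup ρ d)) (++-identityʳ (ones m)))
         (exec-to (trans (cong (λ z → put z [] (ones m ++ Vec.lookup ρ d)) (++-identityʳ (ones m))) (put-jk _ ej et))
           (loop≤ W m≤W (copy-back m [] (ones m ++ Vec.lookup ρ d)))))

  -- The rule for counting loops: `τ r i` is the store with `r` rounds left on the counter and `i`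
  -- rounds done.
  loop-family : ∀ {c} {body : Prog K} (τ : ℕ → ℕ → Vec Str K) →
    (∀ r i → Vec.lookup (τ r i) c ≡ ones r) → (∀ r i → τ (suc r) i [ c ]≔ ones r ≡ τ r i) →
    ∀ m → (∀ r i → i < m → Exec W body (τ r i) (just (τ r (suc i)))) →
    ∀ r i → r + i ≡ m → Iter W c skip body r (τ r i) (just (τ 0 m))
  loop-family τ get set m body zero    i refl = stop (get 0 i)
  loop-family τ get set m body (suc r) i eq = more (get (suc r) i)
    (exec-from (set r i) (body r i (≤-trans (s≤s (m≤n+m i r)) (≤-reflexive eq))))
    (loop-family τ get set m body r (suc i) (trans (+-suc r i) eq))

  module _ (ρ : Vec Str K) {c d i : Fin K} (c≢d : c ≢ d) (c≢i : c ≢ i) (d≢i : d ≢ i) where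

    open Three ρ c≢d c≢i d≢i

    private
      body : Prog K
      body = readBit i skip (push d true ⨾ push c true) fail

      read-1 : ∀ x z → Exec W body (put [] x (true ∷ true ∷ z)) (just (put (true ∷ []) (true ∷ x) z))
      read-1 x z = pop-∷ (get-l _ _ _) (exec-from (set-l _) (pop-∷ (get-l _ _ _) (exec-from (set-l _)
        (exec-to (trans (set-k _) (cong (λ y → put [] (true ∷ y) z) (get-k _ _ _))) push ⨾
         exec-to (trans (set-j _) (cong (λ y → put (true ∷ y) (true ∷ x) z) (get-j _ _ _))) push))))

      read-0 : ∀ x z → Exec W body (put [] x (false ∷ false ∷ z)) (just (put [] x z))
      read-0 x z = pop-∷ (get-l _ _ _) (exec-from (set-l _) (pop-∷ (get-l _ _ _) (exec-from (set-l _) skip)))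

      read-end : ∀ x z → Exec W body (put [] x (false ∷ true ∷ z)) nothing
      read-end x z = pop-∷ (get-l _ _ _) (exec-from (set-l _) (pop-∷ (get-l _ _ _) fail))

    readNum-iter : ∀ m x w z → Iter W c skip body (suc m) (put (true ∷ []) x (dbl (encℕ m ++ w) ++ z))
                     (just (put [] (ones m ++ x) (dbl w ++ z)))
    readNum-iter zero    x w z = more (get-j _ _ _) (exec-from (set-j _) (read-0 x _)) (stop (get-j _ _ _))
    readNum-iter (suc m) x w z = more (get-j _ _ _) (exec-from (set-j _) (read-1 x _))
      (subst (λ y → Iter W c skip body (suc m) (put (true ∷ []) (true ∷ x) (dbl (encℕ m ++ w) ++ z)) (just (put [] y (dbl w ++ z))))
        (ones-++-∷ m x) (readNum-iter m (true ∷ x) w z))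

    readNum-iter-cut : ∀ m x z → Iter W c skip body (suc m) (put (true ∷ []) x (dbl (ones m) ++ false ∷ true ∷ z)) nothing
    readNum-iter-cut zero    x z = abort (get-j _ _ _) (exec-from (set-j _) (read-end x z))
    readNum-iter-cut (suc m) x z = more (get-j _ _ _) (exec-from (set-j _) (read-1 x _)) (readNum-iter-cut m (true ∷ x) z)

    private
      raise : ∀ {y} → Vec.lookup ρ c ≡ [] → Vec.lookup ρ i ≡ y →
              Exec W (push c true) ρ (just (put (true ∷ []) (Vec.lookup ρ d) y))
      raise {y} ec ei = exec-from (sym (put-jkl ec refl ei))
        (exec-to (trans (set-j _) (cong (λ z → put (true ∷ z) (Vec.lookup ρ d) y) (get-j _ _ _))) push)

    readNum-exec : ∀ m w z → Vec.lookup ρ c ≡ [] → Vec.lookup ρ i ≡ dbl (encℕ m ++ w) ++ z → suc m ≤ W →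
      Exec W (readNum c d i) ρ (just ((ρ [ d ]≔ (ones m ++ Vec.lookup ρ d)) [ i ]≔ (dbl w ++ z)))
    readNum-exec m w z ec ei m<W = raise ec ei ⨾
      exec-to (cong (λ v → (v [ d ]≔ _) [ i ]≔ _) (trans (cong (ρ [ c ]≔_) (sym ec)) (Vecₚ.[]≔-lookup ρ c)))
        (loop≤ W m<W (readNum-iter m (Vec.lookup ρ d) w z))

    readNum-cut : ∀ m z → Vec.lookup ρ c ≡ [] → Vec.lookup ρ i ≡ dbl (ones m) ++ false ∷ true ∷ z → suc m ≤ W →
      Exec W (readNum c d i) ρ nothing
    readNum-cut m z ec ei m<W = raise ec ei ⨾ loop≤ W m<W (readNum-iter-cut m (Vec.lookup ρ d) z)

  module _ {j o : Fin K} (j≢o : j ≢ o) where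

    private
      push²-exec : ∀ b ρ → Exec W (pick (push o false ⨾ push o false) (push o true ⨾ push o true) b) ρ
                     (just (ρ [ o ]≔ (b ∷ b ∷ Vec.lookup ρ o)))
      push²-exec false ρ = push ⨾ exec-to (trans (Vecₚ.[]≔-idempotent ρ o) (cong (λ z → ρ [ o ]≔ (false ∷ z)) (Vecₚ.lookup∘update o ρ _))) push
      push²-exec true  ρ = push ⨾ exec-to (trans (Vecₚ.[]≔-idempotent ρ o) (cong (λ z → ρ [ o ]≔ (true ∷ z)) (Vecₚ.lookup∘update o ρ _))) push

    drain-iter : ∀ ρ x y → Iter W j (push o false ⨾ push o false) (push o true ⨾ push o true) (length x)
                   ((ρ [ j ]≔ x) [ o ]≔ y) (just ((ρ [ j ]≔ []) [ o ]≔ drained x y))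
    drain-iter ρ []      y = stop (trans (Vecₚ.lookup∘update′ j≢o (ρ [ j ]≔ []) y) (Vecₚ.lookup∘update j ρ []))
    drain-iter ρ (b ∷ x) y = more (trans (Vecₚ.lookup∘update′ j≢o (ρ [ j ]≔ (b ∷ x)) y) (Vecₚ.lookup∘update j ρ (b ∷ x)))
      (exec-from (trans (Vecₚ.[]≔-commutes _ o j (j≢o ∘ sym)) (cong (_[ o ]≔ y) (Vecₚ.[]≔-idempotent ρ j)))
        (exec-to (trans (Vecₚ.[]≔-idempotent _ o) (cong (λ z → (ρ [ j ]≔ x) [ o ]≔ (b ∷ b ∷ z)) (Vecₚ.lookup∘update o (ρ [ j ]≔ x) y)))
          (push²-exec b _)))
      (drain-iter ρ x (b ∷ b ∷ y))

    drain-exec : ∀ ρ → length (Vec.lookup ρ j) ≤ W →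
      Exec W (drain j o) ρ (just ((ρ [ j ]≔ []) [ o ]≔ drained (Vec.lookup ρ j) (Vec.lookup ρ o)))
    drain-exec ρ x≤W = loop≤ W x≤W (iter-from
      (sym (trans (cong (_[ o ]≔ Vec.lookup ρ o) (Vecₚ.[]≔-lookup ρ j)) (Vecₚ.[]≔-lookup ρ o)))
      (drain-iter ρ (Vec.lookup ρ j) (Vec.lookup ρ o)))

-- The reduction as a stack program

record Trail : Set where
  constructor trail
  field
    v  : ℕ                -- the vertex being worked on
    xb : Str              -- the membership bits of X so far, last first
    es : List (ℕ × ℕ)     -- the edges so far, last first

open Trail

record State : Set where
  constructor state
  field
    kx             : ℕ
    tr′            : Trail
    nn y bs        : ℕ
    c₁ c₂ c₃ cF cL : ℕ
    inp            : Str
    par            : ℕ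

open State

-- The mirror image of the edge code: read backwards, the edges appear in order of creation, each
-- endpoint as ones closed by `false`.
encE : List (ℕ × ℕ) → Str
encE []             = []
encE ((a , b) ∷ es) = false ∷ ones b ++ (false ∷ ones a ++ encE es)

input : Str → ℕ → Str
input w p = dbl w ++ false ∷ true ∷ ones p

-- rO: output; rT: scratch; rE, rM: code and number of the edges; rV: vertex;
-- rX: bits of X; rN: n; rY: a vertex of X; rB: first vertex of the slot;
-- rZ: always empty; rC: loop flag; r₁ to rL: counters; rI: input.
pattern rO = 0F
pattern rT = 1F
pattern rE = 2F
pattern rM = 3F
pattern rV = 4F
pattern rX = 5F
pattern rN = 6F
pattern rY = 7F
pattern rB = 8F
pattern rZ = 9F
pattern rC = suc 9F
pattern r₁ = suc (suc 9F)
pattern r₂ = suc (suc (suc 9F))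
pattern r₃ = suc (suc (suc (suc 9F)))
pattern rF = suc (suc (suc (suc (suc 9F))))
pattern rL = suc (suc (suc (suc (suc (suc 9F)))))
pattern rI = suc (suc (suc (suc (suc (suc (suc 9F))))))

vec : State → Vec Str 17
vec σ = ones (kx σ) ∷ [] ∷ encE (es (tr′ σ)) ∷ ones (length (es (tr′ σ))) ∷ ones (v (tr′ σ)) ∷ xb (tr′ σ) ∷ ones (nn σ)
      ∷ ones (y σ) ∷ ones (bs σ) ∷ [] ∷ [] ∷ ones (c₁ σ) ∷ ones (c₂ σ) ∷ ones (c₃ σ) ∷ ones (cF σ) ∷ ones (cL σ)
      ∷ input (inp σ) (par σ) ∷ []

data Source : Set where
  V Y Z : Source

reg : Source → Fin 17
reg V = rV
reg Y = rY
reg Z = rZ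

val : State → Source → ℕ
val σ V = v (tr′ σ)
val σ Y = y σ
val σ Z = 0

addEdge : ℕ → ℕ → State → State
addEdge a b σ = record σ { tr′ = record (tr′ σ) { es = (a , b) ∷ es (tr′ σ) } }

foldUp : {A : Set} → (ℕ → A → A) → ℕ → A → A
foldUp f zero    a = a
foldUp f (suc i) a = f i (foldUp f i a)

-- The number of the first vertex of slot `i`, in the incremental form in which the program computes
-- it; `base n n` is the size of X.
base : ℕ → ℕ → ℕ
base n zero    = 5
base n (suc i) = n * 2 + base n i

base-mono : ∀ n {i j} → i ≤ j → base n i ≤ base n j
base-mono n {j = j} z≤n = go′ j
  where
  go′ : ∀ j → 5 ≤ base n j
  go′ zero    = ≤-refl
  go′ (suc j) = ≤-trans (go′ j) (m≤n+m _ (n * 2))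
base-mono n (s≤s i≤j) = +-monoʳ-≤ (n * 2) (base-mono n i≤j)

link : ℕ → ℕ → ℕ × ℕ
link a b = a , b

-- On the path `v` is the last vertex present, not the next one, so that the edge to the new vertex
-- can be written.
vertex : List ℕ → Trail → Trail
vertex d t = trail (suc (v t)) (false ∷ xb t) (map (link (suc (v t))) d ʳ++ ((v t , suc (v t)) ∷ es t))

seg : List (List ℕ) → Trail → Trail
seg []      t = t
seg (d ∷ D) t = seg D (vertex d t)

seg-++ : ∀ D D′ t → seg (D ++ D′) t ≡ seg D′ (seg D t)
seg-++ []      D′ t = refl
seg-++ (d ∷ D) D′ t = seg-++ D D′ (vertex d t)

seg-v : ∀ D t → v (seg D t) ≡ length D + v t
seg-v []      t = refl
seg-v (d ∷ D) t = trans (seg-v D (vertex d t)) (+-suc (length D) (v t))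

-- `b + 0` is literally what copying `rB` to the empty `rY` leaves. The round of the element itself
-- writes a loop, which `Adj` ignores.
cliqueStep : ℕ → ℕ → ℕ → List (ℕ × ℕ) → List (ℕ × ℕ)
cliqueStep x b i e = (suc x , suc (i * 2 + (b + 0))) ∷ e

-- Here `x` and `suc x` are the numbers of `sel i u` and `neg i u`, while 0 to 4 stand for `a₁`,
-- `a₂`, `b₁`, `b₂` and `hub`.
selStep : ℕ → ℕ → ℕ → List (ℕ × ℕ) → List (ℕ × ℕ)
selStep n b x e = foldUp (cliqueStep x b) n
  ((x , suc x) ∷ (suc x , 1) ∷ (suc x , 0) ∷ (x , 3) ∷ (x , 2) ∷ e)

slotStep : ℕ → ℕ → List (ℕ × ℕ) → List (ℕ × ℕ)
slotStep n i = foldUp (λ u → selStep n (base n i) (u * 2 + base n i)) n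

constEdges : List (ℕ × ℕ)
constEdges = (4 , 3) ∷ (4 , 2) ∷ (4 , 1) ∷ (4 , 0) ∷ (2 , 3) ∷ (0 , 1) ∷ []

slotsD : ℕ → ℕ → ℕ → List (List ℕ)
slotsD n u zero    = []
slotsD n u (suc i) = slotsD n u i ++ ((u * 2 + base n i) ∷ []) ∷ ((u * 2 + base n i) ∷ 4 ∷ []) ∷ []

length-slotsD : ∀ n u i → length (slotsD n u i) ≡ i * 2
length-slotsD n u zero    = refl
length-slotsD n u (suc i) = trans (length-++ (slotsD n u i)) (trans (cong (_+ 2) (length-slotsD n u i)) (+-comm (i * 2) 2))

elemD : ∀ {n} → Fin n → List (List ℕ)
elemD {n} u = slotsD n (toℕ u) n

chunkD : ∀ {n} → List (Fin n) → List (List ℕ)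
chunkD us = (0 ∷ 1 ∷ 2 ∷ []) ∷ (0 ∷ 4 ∷ []) ∷ concatMap elemD us ++ ((2 ∷ 4 ∷ []) ∷ [])

disableRow : ℕ → ℕ → List (ℕ × ℕ) → List (ℕ × ℕ)
disableRow n b = foldUp (λ u e → (u * 2 + b , 0) ∷ e) n

-- Kept apart from `slotStep` because `m` is known only after the family has been read.
disableStep : ℕ → ℕ → ℕ → List (ℕ × ℕ) → List (ℕ × ℕ)
disableStep n m i e with m ≤? i
... | yes _ = disableRow n (base n i) e
... | no  _ = e

edge : Source → ℕ → Source → ℕ → Prog 17
edge A a B b = (copy (reg A) rT rE ⨾ pushes a rE ⨾ push rE false) ⨾ (copy (reg B) rT rE ⨾ pushes b rE ⨾ push rE false) ⨾ push rM true

for : Fin 17 → Prog 17 → Prog 17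
for c body = copy rN rT c ⨾ loop c skip body

addN² : Fin 17 → Prog 17
addN² c = copy rN rT c ⨾ copy rN rT c

newX : Prog 17
newX = push rV true ⨾ push rX true ⨾ push rO true

cliqueBody selBody slotBody xPart : Prog 17
cliqueBody = edge V 1 Y 1 ⨾ push rY true ⨾ push rY true
selBody = edge V 0 Z 2 ⨾ edge V 0 Z 3 ⨾ edge V 1 Z 0 ⨾ edge V 1 Z 1 ⨾ edge V 0 V 1 ⨾ copy rB rT rY ⨾
          for r₃ cliqueBody ⨾ clear rY ⨾ newX ⨾ newX
slotBody = for r₂ selBody ⨾ addN² rB
xPart = newX ⨾ newX ⨾ newX ⨾ newX ⨾ newX ⨾
        edge Z 0 Z 1 ⨾ edge Z 2 Z 3 ⨾ edge Z 4 Z 0 ⨾ edge Z 4 Z 1 ⨾ edge Z 4 Z 2 ⨾ edge Z 4 Z 3 ⨾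
        pushes 5 rB ⨾ for r₁ slotBody

xEdges : ℕ → List (ℕ × ℕ)
xEdges n = foldUp (slotStep n) n constEdges

-- Running the program part that writes X

module Reduction (W : ℕ) where

  open Programs {17} W

  -- Wrapped in a record so that states are compared without unfolding vec.
  record Step (p : Prog 17) (σ σ′ : State) : Set where
    constructor by
    field run : Exec W p (vec σ) (just (vec σ′))

  open Step public

  infixr 5 _▸_

  _▸_ : ∀ {p q σ σ′ σ″} → Step p σ σ′ → Step q σ′ σ″ → Step (p ⨾ q) σ σ″
  by x ▸ by y = by (x ⨾ y)

  private
    number-exec : ∀ σ A a x → val σ A ≤ W →
      Exec W (copy (reg A) rT rE ⨾ pushes a rE ⨾ push rE false) (vec σ [ rE ]≔ x)
             (just (vec σ [ rE ]≔ (false ∷ ones (a + val σ A) ++ x)))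
    number-exec σ A a x le = copy-exec (vec σ [ rE ]≔ x) (reg≢T A) (reg≢E A) (λ ()) (val σ A) (get A) refl le ⨾
      exec-to (cong (vec σ [ rE ]≔_) (ones-+ a (val σ A) x)) (pushes-exec a rE _) ⨾ push
      where
      reg≢T : ∀ A → reg A ≢ rT
      reg≢T V ()
      reg≢T Y ()
      reg≢T Z ()
      reg≢E : ∀ A → reg A ≢ rE
      reg≢E V ()
      reg≢E Y ()
      reg≢E Z ()
      get : ∀ A → Vec.lookup (vec σ [ rE ]≔ x) (reg A) ≡ ones (val σ A)
      get V = refl
      get Y = refl
      get Z = refl

  edge-step : ∀ {σ} A a B b → val σ A ≤ W → val σ B ≤ W →
    Step (edge A a B b) σ (addEdge (a + val σ A) (b + val σ B) σ)
  edge-step {σ} A a B b leA leB = by (number-exec σ A a _ leA ⨾ number-exec σ B b _ leB ⨾ push)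

  -- With explicit states and literal registers `vec` computes, so in every use the conditions on
  -- `τ` hold by `refl`.
  for-step : ∀ {c body} (τ : ℕ → ℕ → State) m → rN ≢ c → rT ≢ c →
    (∀ r i → Vec.lookup (vec (τ r i)) c ≡ ones r) → (∀ r i → vec (τ (suc r) i) [ c ]≔ ones r ≡ vec (τ r i)) →
    nn (τ 0 0) ≡ m → vec (τ 0 0) [ c ]≔ ones m ≡ vec (τ m 0) → m ≤ W →
    (∀ r i → i < m → Step body (τ r i) (τ r (suc i))) →
    Step (for c body) (τ 0 0) (τ 0 m)
  for-step {c} τ m N≢c T≢c get set refl init m≤W body = by (
    exec-to (trans (cong (vec (τ 0 0) [ c ]≔_) (trans (cong (ones m ++_) (get 0 0)) (++-identityʳ (ones m)))) init)
      (copy-exec (vec (τ 0 0)) (λ ()) N≢c T≢c m refl refl m≤W) ⨾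
    loop≤ W m≤W (loop-family (λ r i → vec (τ r i)) get set m (λ r i i<m → run (body r i i<m)) m 0 (+-identityʳ m)))

  n²-ones : ∀ n x → ones n ++ (ones n ++ ones x) ≡ ones (n * 2 + x)
  n²-ones n x = trans (ones-+ n n (ones x)) (trans (ones-++-ones (n + n) x)
    (cong (λ z → ones (z + x)) (trans (cong (n +_) (sym (+-identityʳ n))) (*-comm 2 n))))

  setY setB : ℕ → State → State
  setY a σ = record σ { y = a }
  setB a σ = record σ { bs = a }

  addN²-Y : ∀ {σ} → nn σ ≤ W → Step (addN² rY) σ (setY (nn σ * 2 + y σ) σ)
  addN²-Y {σ} le = by (exec-to (cong (vec σ [ rY ]≔_) (n²-ones (nn σ) (y σ)))
    (copy-exec (vec σ) (λ ()) (λ ()) (λ ()) (nn σ) refl refl le ⨾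
     copy-exec (vec σ [ rY ]≔ (ones (nn σ) ++ ones (y σ))) (λ ()) (λ ()) (λ ()) (nn σ) refl refl le))

  addN²-B : ∀ {σ} → nn σ ≤ W → Step (addN² rB) σ (setB (nn σ * 2 + bs σ) σ)
  addN²-B {σ} le = by (exec-to (cong (vec σ [ rB ]≔_) (n²-ones (nn σ) (bs σ)))
    (copy-exec (vec σ) (λ ()) (λ ()) (λ ()) (nn σ) refl refl le ⨾
     copy-exec (vec σ [ rB ]≔ (ones (nn σ) ++ ones (bs σ))) (λ ()) (λ ()) (λ ()) (nn σ) refl refl le))

  pushY : ∀ {σ} → Step (push rY true) σ (setY (suc (y σ)) σ)
  pushY = by push

  clearY : ∀ {σ} → y σ ≤ W → Step (clear rY) σ (setY 0 σ)
  clearY {σ} le = by (clear-exec rY (vec σ) (y σ) refl le)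

  copyBY : ∀ {σ} → bs σ ≤ W → Step (copy rB rT rY) σ (setY (bs σ + y σ) σ)
  copyBY {σ} le = by (exec-to (cong (vec σ [ rY ]≔_) (ones-++-ones (bs σ) (y σ)))
    (copy-exec (vec σ) (λ ()) (λ ()) (λ ()) (bs σ) refl refl le))

  addX : State → State
  addX σ = record σ { kx = suc (kx σ) ; tr′ = trail (suc (v (tr′ σ))) (true ∷ xb (tr′ σ)) (es (tr′ σ)) }

  newX-step : ∀ {σ} → Step newX σ (addX σ)
  newX-step = by (push ⨾ push ⨾ push)

  -- While X is built, the next vertex, the size of X and its bits agree.
  xState : ∀ (n x b c₁ c₂ : ℕ) (e : List (ℕ × ℕ)) (w : Str) (p : ℕ) → State
  xState n x b c₁ c₂ e w p = state x (trail x (ones x) e) n 0 b c₁ c₂ 0 0 0 w p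

  selBody-step : ∀ n x b c₁ c₂ e w p → n ≤ W → x ≤ W → n * 2 + b ≤ W →
    Step selBody (xState n x b c₁ c₂ e w p) (xState n (2 + x) b c₁ c₂ (selStep n b x e) w p)
  selBody-step n x b c₁ c₂ e w p n≤W x≤W nb≤W =
    edge-step V 0 Z 2 x≤W z≤n ▸ edge-step V 0 Z 3 x≤W z≤n ▸ edge-step V 1 Z 0 x≤W z≤n ▸
    edge-step V 1 Z 1 x≤W z≤n ▸ edge-step V 0 V 1 x≤W x≤W ▸
    copyBY (≤-trans (m≤n+m b (n * 2)) nb≤W) ▸
    for-step τ n (λ ()) (λ ()) (λ _ _ → refl) (λ _ _ → refl) refl refl n≤W body ▸
    clearY nb0≤W ▸ newX-step ▸ newX-step
    where
    e₀ = (x , suc x) ∷ (suc x , 1) ∷ (suc x , 0) ∷ (x , 3) ∷ (x , 2) ∷ e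
    τ : ℕ → ℕ → State
    τ r i = state x (trail x (ones x) (foldUp (cliqueStep x b) i e₀)) n (i * 2 + (b + 0)) b c₁ c₂ r 0 0 w p
    nb0≤W : n * 2 + (b + 0) ≤ W
    nb0≤W = ≤-trans (≤-reflexive (cong (n * 2 +_) (+-identityʳ b))) nb≤W
    body : ∀ r i → i < n → Step cliqueBody (τ r i) (τ r (suc i))
    body r i i<n = edge-step V 1 Y 1 x≤W (≤-trans (+-monoˡ-≤ (b + 0) (*-monoˡ-≤ 2 (<⇒≤ i<n))) nb0≤W) ▸ pushY ▸ pushY

  slotBody-step : ∀ n i c e w p → i < n → n ≤ W → base n n ≤ W →
    Step slotBody (xState n (base n i) (base n i) c 0 e w p)
                  (xState n (base n (suc i)) (base n (suc i)) c 0 (slotStep n i e) w p)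
  slotBody-step n i c e w p i<n n≤W base≤W =
    for-step τ n (λ ()) (λ ()) (λ _ _ → refl) (λ _ _ → refl) refl refl n≤W body ▸ addN²-B n≤W
    where
    τ : ℕ → ℕ → State
    τ r u = xState n (u * 2 + base n i) (base n i) c r (foldUp (λ u → selStep n (base n i) (u * 2 + base n i)) u e) w p
    body : ∀ r u → u < n → Step selBody (τ r u) (τ r (suc u))
    body r u u<n = selBody-step n (u * 2 + base n i) (base n i) c r _ w p n≤W
      (≤-trans (+-monoˡ-≤ (base n i) (*-monoˡ-≤ 2 (<⇒≤ u<n))) next≤W) next≤W
      where
      next≤W : n * 2 + base n i ≤ W
      next≤W = ≤-trans (base-mono n i<n) base≤W

  xPart-step : ∀ n w p → n ≤ W → base n n ≤ W →
    Step xPart (xState n 0 0 0 0 [] w p) (xState n (base n n) (base n n) 0 0 (xEdges n) w p)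
  xPart-step n w p n≤W base≤W =
    newX-step ▸ newX-step ▸ newX-step ▸ newX-step ▸ newX-step ▸
    edge-step Z 0 Z 1 z≤n z≤n ▸ edge-step Z 2 Z 3 z≤n z≤n ▸ edge-step Z 4 Z 0 z≤n z≤n ▸
    edge-step Z 4 Z 1 z≤n z≤n ▸ edge-step Z 4 Z 2 z≤n z≤n ▸ edge-step Z 4 Z 3 z≤n z≤n ▸
    by {σ′ = τ 0 0} (pushes-exec 5 rB _) ▸
    for-step τ n (λ ()) (λ ()) (λ _ _ → refl) (λ _ _ → refl) refl refl n≤W
      (λ r i i<n → slotBody-step n i r _ w p i<n n≤W base≤W)
    where
    τ : ℕ → ℕ → State
    τ r i = xState n (base n i) (base n i) r 0 (foldUp (slotStep n) i constEdges) w p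

-- Prefix-free codes

PrefixFree : {A : Set} → (A → Str) → Set
PrefixFree e = ∀ a b x y → e a ++ x ≡ e b ++ y → a ≡ b × x ≡ y

pf-ℕ : PrefixFree encℕ
pf-ℕ zero    zero    x y eq = refl , proj₂ (∷-injective eq)
pf-ℕ (suc a) (suc b) x y eq = let (p , q) = pf-ℕ a b x y (proj₂ (∷-injective eq)) in cong suc p , q

ones≢encℕ : ∀ m a x → ones m ≢ encℕ a ++ x
ones≢encℕ zero    zero    x ()
ones≢encℕ zero    (suc a) x ()
ones≢encℕ (suc m) zero    x ()
ones≢encℕ (suc m) (suc a) x eq = ones≢encℕ m a x (proj₂ (∷-injective eq))

pf-Fin : ∀ {n} → PrefixFree (encFin {n})
pf-Fin a b x y eq = let (p , q) = pf-ℕ (toℕ a) (toℕ b) x y eq in toℕ-injective p , q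

module _ {A : Set} {e : A → Str} (pf : PrefixFree e) where

  pf-concat : ∀ as bs x y → length as ≡ length bs → concatMap e as ++ x ≡ concatMap e bs ++ y → as ≡ bs × x ≡ y
  pf-concat []       []       x y _ eq = refl , eq
  pf-concat (a ∷ as) (b ∷ bs) x y l eq =
    let (p , q) = pf a b _ _ (trans (sym (++-assoc (e a) (concatMap e as) x)) (trans eq (++-assoc (e b) (concatMap e bs) y)))
        (r , s) = pf-concat as bs x y (suc-injective l) q
    in cong₂ _∷_ p r , s

  pf-List : PrefixFree (encList e)
  pf-List as bs x y eq =
    let (p , q) = pf-ℕ (length as) (length bs) _ _
                    (trans (sym (++-assoc (encℕ (length as)) (concatMap e as) x)) (trans eq (++-assoc (encℕ (length bs)) (concatMap e bs) y)))
    in pf-concat as bs x y p q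

-- The two cases mirror `readNum`: it succeeds in the first and runs into the end mark in the
-- second.
viewNum : ∀ w → (∃₂ λ m w′ → w ≡ encℕ m ++ w′) ⊎ (∃ λ m → w ≡ ones m)
viewNum []          = inj₂ (0 , refl)
viewNum (false ∷ w) = inj₁ (0 , w , refl)
viewNum (true ∷ w) with viewNum w
... | inj₁ (m , w′ , eq) = inj₁ (suc m , w′ , cong (true ∷_) eq)
... | inj₂ (m , eq)      = inj₂ (suc m , cong (true ∷_) eq)

length-encℕ : ∀ m → length (encℕ m) ≡ suc m
length-encℕ zero    = refl
length-encℕ (suc m) = cong suc (length-encℕ m)

length-encℕ-++ : ∀ m w → length (encℕ m ++ w) ≡ suc m + length w
length-encℕ-++ m w = trans (length-++ (encℕ m)) (cong (_+ length w) (length-encℕ m))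

-- Parsing the family while writing the path

newP attY stepBody lessBody elem set sets : Prog 17
att : ℕ → Prog 17
newP = edge V 0 V 1 ⨾ push rV true ⨾ push rX false
attY = edge V 0 Y 0
att a = edge V 0 Z a
stepBody = newP ⨾ attY ⨾ newP ⨾ attY ⨾ att 4 ⨾ addN² rY
-- One pass does two things: it compares `u` with the copy of `n` in `r₂`, and it adds `u * 2` to
-- `rY`. The further pop of `r₂` in `elem` makes the comparison strict.
lessBody = pop r₂ fail skip skip ⨾ push rY true ⨾ push rY true
-- Starting from 5, `rY` becomes the number of `sel i u` for the slot `i = 0`, and `stepBody`
-- advances it by one slot per round.
elem = pushes 5 rY ⨾ readNum rC r₁ rI ⨾ copy rN rT r₂ ⨾ loop r₁ skip lessBody ⨾ pop r₂ fail skip skip ⨾ clear r₂ ⨾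
       for r₁ stepBody ⨾ clear rY
set = (readNum rC rL rI ⨾ newP ⨾ att 0 ⨾ att 1 ⨾ att 2 ⨾ newP ⨾ att 0 ⨾ att 4) ⨾ loop rL skip elem ⨾ newP ⨾ att 2 ⨾ att 4
sets = readNum rC rF rI ⨾ loop rF skip set

setT : Trail → State → State
setT t σ = record σ { tr′ = t }

module Path (W : ℕ) where

  open Programs {17} W
  open Reduction W


  record Fails (p : Prog 17) (σ : State) : Set where
    constructor fails
    field run⊥ : Exec W p (vec σ) nothing

  open Fails public

  infixr 5 _▹_

  _▹_ : ∀ {p q σ σ′} → Step p σ σ′ → Fails q σ′ → Fails (p ⨾ q) σ
  by x ▹ fails y = fails (x ⨾ y)

  stops : ∀ {p q σ} → Fails p σ → Fails (p ⨾ q) σ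
  stops (fails x) = fails (abort x)

  step-to : ∀ {p σ σ′ σ″} → σ′ ≡ σ″ → Step p σ σ′ → Step p σ σ″
  step-to refl x = x

  grow : Trail → Trail
  grow t = trail (suc (v t)) (false ∷ xb t) ((v t , suc (v t)) ∷ es t)

  newP-step : ∀ {σ} → v (tr′ σ) ≤ W → Step newP σ (setT (grow (tr′ σ)) σ)
  newP-step {σ} le = edge-step V 0 V 1 le le ▸ by {σ′ = setT (grow (tr′ σ)) σ} (push ⨾ push)

  readNum-step : ∀ {D} σ σ′ m w → rC ≢ D → D ≢ rI → inp σ ≡ encℕ m ++ w → Vec.lookup (vec σ) D ≡ [] →
    (vec σ [ D ]≔ ones m) [ rI ]≔ input w (par σ) ≡ vec σ′ → suc m ≤ W → Step (readNum rC D rI) σ σ′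
  readNum-step {D} σ σ′ m w C≢D D≢I eq empty σ′≡ le = by (exec-to
    (trans (cong (λ z → (vec σ [ D ]≔ z) [ rI ]≔ input w (par σ)) (trans (cong (ones m ++_) empty) (++-identityʳ (ones m)))) σ′≡)
    (readNum-exec (vec σ) C≢D (λ ()) D≢I m w (false ∷ true ∷ ones (par σ)) refl
      (cong (λ z → input z (par σ)) eq) le))

  readNum-fails : ∀ {D} σ m → rC ≢ D → D ≢ rI → inp σ ≡ ones m → suc m ≤ W → Fails (readNum rC D rI) σ
  readNum-fails σ m C≢D D≢I eq le =
    fails (readNum-cut (vec σ) C≢D (λ ()) D≢I m (ones (par σ)) refl (cong (λ z → input z (par σ)) eq) le)

  module _ (n : ℕ) (n≤W : n ≤ W) (base≤W : base n (suc n) ≤ W) where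

    private
      k : ℕ
      -- An element contributes `n * 2` path vertices, and a set 3 of its own.
      k = n * 2 + 3

    pState : ∀ (p cF cL : ℕ) (t : Trail) (w : Str) → State
    pState p cF cL t w = state (base n n) t n 0 (base n n) 0 0 0 cF cL w p

    -- Every input symbol still to be read pays for k further vertices.
    Room : ℕ → Trail → Str → Set
    Room s t w = suc s + (v t + length w * k) ≤ W

    -- Parser and writer in one: either a code is consumed and its stretch of path written, or no
    -- code begins here and the program rejects.
    Reads : {A : Set} (e : A → Str) (D : A → List (List ℕ)) (P : Prog 17) (S : Trail → Str → State) → Trail → Str → Set
    Reads e D P S t w =
      (∃₂ λ a w′ → w ≡ e a ++ w′ × Step P (S t w) (S (seg (D a) t) w′)) ⊎
      ((∀ a w′ → w ≢ e a ++ w′) × Fails P (S t w))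

    1≤k : 1 ≤ k
    1≤k = ≤-trans (s≤s z≤n) (m≤n+m 3 (n * 2))

    length≤W : ∀ s t w → Room s t w → suc (length w) ≤ W
    length≤W s t w room = ≤-trans (s≤s (≤-trans (m≤m*n′ (length w)) (≤-trans (m≤n+m _ (v t)) (m≤n+m _ s)))) room
      where
      m≤m*n′ : ∀ x → x ≤ x * k
      m≤m*n′ x = ≤-trans (≤-reflexive (sym (*-identityʳ x))) (*-monoʳ-≤ x 1≤k)

    ones<W : ∀ s t m → Room s t (ones m) → suc m ≤ W
    ones<W s t m room = subst (λ z → suc z ≤ W) (length-replicate m) (length≤W s t (ones m) room)

    number<W : ∀ s t m w → Room s t (encℕ m ++ w) → suc m ≤ W
    number<W s t m w room = ≤-trans (m≤n⇒m≤1+n (≤-trans (m≤m+n (suc m) (length w)) (≤-reflexive (sym (length-encℕ-++ m w)))))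
                                    (length≤W s t (encℕ m ++ w) room)

    base≤ : ∀ {u i} → u ≤ n → i ≤ n → u * 2 + base n i ≤ W
    base≤ {u} {i} u≤n i≤n = ≤-trans (+-mono-≤ (*-monoˡ-≤ 2 u≤n) (base-mono n i≤n)) base≤W

    stepBody-step : ∀ {σ} → nn σ ≡ n → 2 + v (tr′ σ) ≤ W → y σ ≤ W →
      Step stepBody σ (setY (n * 2 + y σ) (setT (seg ((y σ ∷ []) ∷ (y σ ∷ 4 ∷ []) ∷ []) (tr′ σ)) σ))
    stepBody-step refl v≤W y≤W =
      newP-step (≤-trans (m≤n+m _ 2) v≤W) ▸ edge-step V 0 Y 0 (≤-trans (n≤1+n _) v≤W) y≤W ▸
      newP-step (≤-trans (n≤1+n _) v≤W) ▸ edge-step V 0 Y 0 v≤W y≤W ▸ edge-step V 0 Z 4 v≤W z≤n ▸ addN²-Y n≤W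

    module _ (p cF cL : ℕ) (t : Trail) (w : Str) where

      private
        lState : ℕ → ℕ → ℕ → State
        lState c₁ c₂ y = state (base n n) t n y (base n n) c₁ c₂ 0 cF cL w p

      less-iter : ∀ u d y → Iter W r₁ skip lessBody u (vec (lState u (u + d) y)) (just (vec (lState 0 d (u * 2 + y))))
      less-iter zero    d y = stop refl
      less-iter (suc u) d y = more refl (pop-∷ refl skip ⨾ push ⨾ push)
        (subst (λ z → Iter W r₁ skip lessBody u (vec (lState u (u + d) (2 + y))) (just (vec (lState 0 d z))))
          (trans (+-suc (u * 2) (suc y)) (cong suc (+-suc (u * 2) y))) (less-iter u d (2 + y)))

      less-iter-fails : ∀ c d y → Iter W r₁ skip lessBody (c + suc d) (vec (lState (c + suc d) c y)) nothing
      less-iter-fails zero    d y = abort refl (abort (pop-[] refl fail))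
      less-iter-fails (suc c) d y = more refl (pop-∷ refl skip ⨾ push ⨾ push) (less-iter-fails c d (2 + y))

      slots-step : ∀ u → u < n → n * 2 + v t ≤ W →
        Step (for r₁ stepBody) (lState 0 0 (u * 2 + 5)) (setT (seg (slotsD n u n) t) (lState 0 0 (u * 2 + base n n)))
      slots-step u u<n vt≤W =
        for-step τ n (λ ()) (λ ()) (λ _ _ → refl) (λ _ _ → refl) refl refl n≤W body
        where
        τ : ℕ → ℕ → State
        τ r i = setT (seg (slotsD n u i) t) (lState r 0 (u * 2 + base n i))
        body : ∀ r i → i < n → Step stepBody (τ r i) (τ r (suc i))
        body r i i<n = step-to
          (cong₂ (λ a b → setT a (lState r 0 b)) (sym (seg-++ (slotsD n u i) _ t))
            (solve 3 (λ a b c → a :+ (b :+ c) := b :+ (a :+ c)) refl (n * 2) (u * 2) (base n i)))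
          (stepBody-step refl room (base≤ (<⇒≤ u<n) (<⇒≤ i<n)))
          where
          open +-*-Solver
          room : 2 + v (seg (slotsD n u i) t) ≤ W
          room = ≤-trans (≤-reflexive (cong (2 +_) (trans (seg-v (slotsD n u i) t) (cong (_+ v t) (length-slotsD n u i)))))
                         (≤-trans (+-monoˡ-≤ (v t) (*-monoˡ-≤ 2 i<n)) vt≤W)

    -- Rejection has two causes: a number cut off by the end of the string, and a number that is not
    -- below `n`.
    elem-reads : ∀ p cF s cL t w → Room s t w → Reads encFin elemD elem (pState p cF cL) t w
    elem-reads p cF s cL t w room with viewNum w
    ... | inj₂ (m , refl) = inj₂ ((λ a w′ → ones≢encℕ m (toℕ a) w′) ,
      (by {σ′ = σ₁} (pushes-exec 5 rY _) ▹ stops (readNum-fails σ₁ m (λ ()) (λ ()) refl (ones<W s t m room))))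
      where
      σ₁ = setY 5 (pState p cF cL t (ones m))
    ... | inj₁ (u , w′ , refl) = go′ (u <? n)
      where
      lState : ℕ → ℕ → ℕ → State
      lState c₁ c₂ y = state (base n n) t n y (base n n) c₁ c₂ 0 cF cL w′ p
      u<W : suc u ≤ W
      u<W = number<W s t u w′ room
      vt≤W : n * 2 + v t ≤ W
      vt≤W = begin
        n * 2 + v t                                    ≤⟨ +-monoˡ-≤ (v t) (≤-trans (m≤m+n (n * 2) 3) (m≤m+n k ((u + length w′) * k))) ⟩
        (suc u + length w′) * k + v t                  ≡⟨ trans (cong (λ z → z * k + v t) (sym (length-encℕ-++ u w′))) (+-comm _ (v t)) ⟩
        v t + length (encℕ u ++ w′) * k                ≤⟨ ≤-trans (m≤n+m _ (suc s)) room ⟩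
        W                                              ∎
        where open ≤-Reasoning
      prefix : Step (pushes 5 rY ⨾ readNum rC r₁ rI ⨾ copy rN rT r₂) (pState p cF cL t (encℕ u ++ w′)) (lState u n 5)
      prefix = by {σ′ = setY 5 (pState p cF cL t (encℕ u ++ w′))} (pushes-exec 5 rY _) ▸
               readNum-step _ (lState u 0 5) u w′ (λ ()) (λ ()) refl refl refl u<W ▸
               by (exec-to (cong (vec (lState u 0 5) [ r₂ ]≔_) (++-identityʳ (ones n)))
                    (copy-exec (vec (lState u 0 5)) (λ ()) (λ ()) (λ ()) n refl refl n≤W))
      regroup : ∀ {a b c d : Prog 17} {ρ o} → Exec W ((a ⨾ b ⨾ c) ⨾ d) ρ o → Exec W (a ⨾ b ⨾ c ⨾ d) ρ o
      regroup ((x ⨾ y ⨾ z) ⨾ r) = x ⨾ y ⨾ z ⨾ r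
      regroup (abort (abort x)) = abort x
      regroup (abort (x ⨾ abort y)) = x ⨾ abort y
      regroup (abort (x ⨾ y ⨾ z)) = x ⨾ y ⨾ abort z
      go′ : Dec (u < n) → Reads encFin elemD elem (pState p cF cL) t (encℕ u ++ w′)
      go′ (yes u<n) = inj₁ (fromℕ< u<n , w′ , cong (λ z → encℕ z ++ w′) (sym u≡) ,
        by (regroup (run (prefix ▸ rest (_ , m+[n∸m]≡n u<n)))))
        where
        u≡ : toℕ (fromℕ< u<n) ≡ u
        u≡ = toℕ-fromℕ< u<n
        rest : (∃ λ d → suc u + d ≡ n) →
               Step (loop r₁ skip lessBody ⨾ pop r₂ fail skip skip ⨾ clear r₂ ⨾ for r₁ stepBody ⨾ clear rY)
                    (lState u n 5) (pState p cF cL (seg (elemD (fromℕ< u<n)) t) w′)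
        rest (d , d≡) =
          by {σ′ = lState 0 (suc d) (u * 2 + 5)} (loop≤ W (<⇒≤ u<W)
            (subst (λ z → Iter W r₁ skip lessBody u (vec (lState u z 5)) (just (vec (lState 0 (suc d) (u * 2 + 5)))))
              (trans (+-suc u d) d≡) (less-iter p cF cL t w′ u (suc d) 5))) ▸
          by {σ′ = lState 0 d (u * 2 + 5)} (pop-∷ refl skip) ▸
          by {σ′ = lState 0 0 (u * 2 + 5)} (clear-exec r₂ (vec (lState 0 d (u * 2 + 5))) d refl
            (≤-trans (≤-trans (m≤n+m d (suc u)) (≤-reflexive d≡)) n≤W)) ▸
          slots-step p cF cL t w′ u u<n vt≤W ▸
          step-to (cong (λ z → pState p cF cL (seg (slotsD n z n) t) w′) (sym u≡)) (clearY (base≤ (<⇒≤ u<n) ≤-refl))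
      go′ (no u≮n) = inj₂ ((λ a w″ eq → u≮n (subst (_< n) (sym (proj₁ (pf-ℕ u (toℕ a) w′ w″ eq))) (toℕ<n a))) ,
        fails (regroup (run⊥ (prefix ▹ rest (_ , m+[n∸m]≡n (≮⇒≥ u≮n))))))
        where
        rest : (∃ λ d → n + d ≡ u) →
               Fails (loop r₁ skip lessBody ⨾ pop r₂ fail skip skip ⨾ clear r₂ ⨾ for r₁ stepBody ⨾ clear rY) (lState u n 5)
        -- For `u ≡ n` the loop itself succeeds, and only the extra pop finds `r₂` empty.
        rest (zero , d≡) = by {σ′ = lState 0 0 (u * 2 + 5)} (loop≤ W (<⇒≤ u<W)
            (subst (λ z → Iter W r₁ skip lessBody u (vec (lState u z 5)) (just (vec (lState 0 0 (u * 2 + 5)))))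
              (trans (+-identityʳ u) (trans (sym d≡) (+-identityʳ n))) (less-iter p cF cL t w′ u 0 5))) ▹
          stops (fails (pop-[] refl fail))
        rest (suc d , d≡) = stops (fails (loop≤ W (<⇒≤ u<W)
            (subst (λ z → Iter W r₁ skip lessBody z (vec (lState z n 5)) nothing) d≡ (less-iter-fails p cF cL t w′ n d 5))))

    Cheap : {A : Set} (e : A → Str) (D : A → List (List ℕ)) → Set
    Cheap e D = ∀ a → length (D a) ≤ length (e a) * k

    cheap-concat : {A : Set} {e : A → Str} {D : A → List (List ℕ)} → Cheap e D → Cheap (concatMap e) (concatMap D)
    cheap-concat cheap [] = z≤n
    cheap-concat {e = e} {D} cheap (a ∷ as) = begin
      length (D a ++ concatMap D as)                    ≡⟨ length-++ (D a) ⟩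
      length (D a) + length (concatMap D as)            ≤⟨ +-mono-≤ (cheap a) (cheap-concat {e = e} {D} cheap as) ⟩
      length (e a) * k + length (concatMap e as) * k    ≡⟨ sym (*-distribʳ-+ k (length (e a)) _) ⟩
      (length (e a) + length (concatMap e as)) * k      ≡⟨ cong (_* k) (sym (length-++ (e a))) ⟩
      length (e a ++ concatMap e as) * k                ∎
      where open ≤-Reasoning

    cheap-elem : Cheap (encFin {n}) elemD
    cheap-elem u = begin
      length (elemD u)         ≡⟨ length-slotsD n (toℕ u) n ⟩
      n * 2                    ≤⟨ m≤m+n (n * 2) 3 ⟩
      k                        ≤⟨ m≤m+n k (toℕ u * k) ⟩
      suc (toℕ u) * k          ≡⟨ cong (_* k) (sym (length-encℕ (toℕ u))) ⟩
      length (encFin u) * k    ∎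
      where open ≤-Reasoning

    cheap-chunk : Cheap (encList (encFin {n})) chunkD
    cheap-chunk us = begin
      2 + length (concatMap elemD us ++ _)          ≡⟨ cong (2 +_) (trans (length-++ (concatMap elemD us)) (+-comm _ 1)) ⟩
      3 + length (concatMap elemD us)               ≤⟨ +-mono-≤ 3≤ (cheap-concat {e = encFin {n}} {elemD} cheap-elem us) ⟩
      length (encℕ (length us)) * k + length (concatMap encFin us) * k ≡⟨ sym (*-distribʳ-+ k (length (encℕ (length us))) _) ⟩
      (length (encℕ (length us)) + length (concatMap encFin us)) * k   ≡⟨ cong (_* k) (sym (length-++ (encℕ (length us)))) ⟩
      length (encList encFin us) * k                ∎
      where
      open ≤-Reasoning
      3≤ : 3 ≤ length (encℕ (length us)) * k
      3≤ = ≤-trans (m≤n+m 3 (n * 2)) (≤-trans (m≤m+n k (length us * k)) (≤-reflexive (cong (_* k) (sym (length-encℕ (length us))))))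

    room-after : ∀ s t x w D → length D ≤ length x * k → Room s t (x ++ w) → Room s (seg D t) w
    room-after s t x w D D≤ room = ≤-trans (+-monoʳ-≤ (suc s) (begin
      v (seg D t) + length w * k              ≡⟨ cong (_+ length w * k) (seg-v D t) ⟩
      length D + v t + length w * k           ≤⟨ +-monoˡ-≤ (length w * k) (+-monoˡ-≤ (v t) D≤) ⟩
      length x * k + v t + length w * k       ≡⟨ solve 4 (λ a b c d → a :* d :+ b :+ c :* d := b :+ (a :+ c) :* d) refl (length x) (v t) (length w) k ⟩
      v t + (length x + length w) * k         ≡⟨ cong (λ z → v t + z * k) (sym (length-++ x)) ⟩
      v t + length (x ++ w) * k               ∎)) room
      where
      open ≤-Reasoning
      open +-*-Solver

    module _ {A : Set} {e : A → Str} {D : A → List (List ℕ)} {body : Prog 17} (pf : PrefixFree e) (cheap : Cheap e D)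
             {c : Fin 17} (S : ℕ → Trail → Str → State)
             (get : ∀ l t w → Vec.lookup (vec (S l t w)) c ≡ ones l)
             (set : ∀ l t w → vec (S (suc l) t w) [ c ]≔ ones l ≡ vec (S l t w))
             (s : ℕ) (reads : ∀ l t w → Room s t w → Reads e D body (S l) t w) where

      -- By `Cheap` the symbols consumed by an item pay for the vertices it writes, so `Room`
      -- survives each round. In the rejecting case prefix-freeness shows that no other first item
      -- could have been read.
      items-read : ∀ l t w → Room s t w →
        (∃₂ λ as w′ → length as ≡ l × w ≡ concatMap e as ++ w′ ×
           Iter W c skip body l (vec (S l t w)) (just (vec (S 0 (seg (concatMap D as) t) w′)))) ⊎
        ((∀ as w′ → length as ≡ l → w ≢ concatMap e as ++ w′) × Iter W c skip body l (vec (S l t w)) nothing)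
      items-read zero    t w room = inj₁ ([] , w , refl , refl , stop (get 0 t w))
      items-read (suc l) t w room with reads l t w room
      ... | inj₂ (bad , fails x) =
        inj₂ ((λ { [] w′ () ; (a ∷ as) w′ _ eq → bad a (concatMap e as ++ w′) (trans eq (++-assoc (e a) (concatMap e as) w′)) }) ,
              abort (get (suc l) t w) (exec-from (set l t w) x))
      ... | inj₁ (a , w₁ , refl , by x) with items-read l (seg (D a) t) w₁ (room-after s t (e a) w₁ (D a) (cheap a) room)
      ... | inj₁ (as , w′ , l≡ , w₁≡ , i) =
        inj₁ (a ∷ as , w′ , cong suc l≡ , trans (cong (e a ++_) w₁≡) (sym (++-assoc (e a) (concatMap e as) w′)) ,
          more (get (suc l) t w) (exec-from (set l t w) x)
            (subst (λ z → Iter W c skip body l (vec (S l (seg (D a) t) w₁)) (just (vec (S 0 z w′)))) (sym (seg-++ (D a) (concatMap D as) t)) i))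
      ... | inj₂ (bad , i) =
        inj₂ ((λ { [] w′ () ; (a′ ∷ as) w′ l≡ eq →
                   bad as w′ (suc-injective l≡) (proj₂ (pf a a′ _ _ (trans eq (++-assoc (e a′) (concatMap e as) w′)))) }) ,
              more (get (suc l) t w) (exec-from (set l t w) x) i)

    set-reads : ∀ p s cF t w → Room s t w → Reads (encList encFin) chunkD set (λ t w → pState p cF 0 t w) t w
    set-reads p s cF t w room with viewNum w
    ... | inj₂ (m , refl) = inj₂
      ((λ us w′ eq → ones≢encℕ m (length us) _ (trans eq (++-assoc (encℕ (length us)) (concatMap encFin us) w′))) ,
       stops (stops (readNum-fails _ m (λ ()) (λ ()) refl (ones<W s t m room))))
    ... | inj₁ (l , w₁ , refl) = finish (items-read {e = encFin {n}} {elemD} pf-Fin cheap-elem (pState p cF) (λ _ _ _ → refl) (λ _ _ _ → refl)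
                                           (suc s) (elem-reads p cF (suc s)) l t₁ w₁ room₁)
      where
      t₁ = seg ((0 ∷ 1 ∷ 2 ∷ []) ∷ (0 ∷ 4 ∷ []) ∷ []) t
      -- The header of the set pays for the two vertices already written and leaves one unit of
      -- slack for the closing vertex, written after the loop.
      room₁ : Room (suc s) t₁ w₁
      room₁ = ≤-trans (≤-reflexive (sym (+-suc (suc s) (v t₁ + length w₁ * k)))) (≤-trans (+-monoʳ-≤ (suc s) (begin
        suc (2 + v t + length w₁ * k)               ≡⟨ solve 2 (λ a b → con 1 :+ (con 2 :+ a :+ b) := a :+ (con 3 :+ b)) refl (v t) (length w₁ * k) ⟩
        v t + (3 + length w₁ * k)                   ≤⟨ +-monoʳ-≤ (v t) (+-mono-≤ (m≤n+m 3 (n * 2)) (*-monoˡ-≤ k (m≤n+m (length w₁) l))) ⟩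
        v t + (suc l + length w₁) * k               ≡⟨ cong (λ z → v t + z * k) (sym (length-encℕ-++ l w₁)) ⟩
        v t + length (encℕ l ++ w₁) * k             ∎)) room)
        where
        open ≤-Reasoning
        open +-*-Solver
      v≤ : ∀ t w → Room (suc s) t w → suc (v t) ≤ W
      v≤ t w room = ≤-trans (s≤s (≤-trans (m≤m+n (v t) _) (m≤n+m _ (suc s)))) room
      l<W : suc l ≤ W
      l<W = number<W s t l w₁ room
      v₂ : 2 + v t ≤ W
      v₂ = ≤-trans (n≤1+n _) (v≤ t₁ w₁ room₁)
      v₁ : 1 + v t ≤ W
      v₁ = ≤-trans (n≤1+n _) v₂
      v₀ : v t ≤ W
      v₀ = ≤-trans (n≤1+n _) v₁
      before-loop : Step (readNum rC rL rI ⨾ newP ⨾ att 0 ⨾ att 1 ⨾ att 2 ⨾ newP ⨾ att 0 ⨾ att 4)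
                         (pState p cF 0 t (encℕ l ++ w₁)) (pState p cF l t₁ w₁)
      before-loop = readNum-step _ (pState p cF l t w₁) l w₁ (λ ()) (λ ()) refl refl refl l<W ▸
        newP-step v₀ ▸ edge-step V 0 Z 0 v₁ z≤n ▸ edge-step V 0 Z 1 v₁ z≤n ▸ edge-step V 0 Z 2 v₁ z≤n ▸
        newP-step v₁ ▸ edge-step V 0 Z 0 v₂ z≤n ▸ edge-step V 0 Z 4 v₂ z≤n
      finish : _ → _
      finish (inj₁ (us , w′ , refl , refl , i)) = inj₁ (us , w′ , sym (++-assoc (encℕ l) (concatMap encFin us) w′) ,
        (before-loop ▸ by {σ′ = pState p cF 0 t₂ w′} (loop≤ W (<⇒≤ l<W) i) ▸
         step-to (cong (λ z → pState p cF 0 z w′) (sym (seg-++ (concatMap elemD us) _ t₁)))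
           (newP-step (≤-trans (n≤1+n _) v₃) ▸ edge-step V 0 Z 2 v₃ z≤n ▸ edge-step V 0 Z 4 v₃ z≤n)))
        where
        t₂ = seg (concatMap elemD us) t₁
        v₃ : suc (v t₂) ≤ W
        v₃ = v≤ t₂ w′ (room-after (suc s) t₁ (concatMap encFin us) w′ (concatMap elemD us)
               (cheap-concat {e = encFin {n}} {elemD} cheap-elem us) room₁)
      finish (inj₂ (bad , i)) = inj₂
        ((λ us w′ eq → let (p , q) = pf-ℕ l (length us) _ _ (trans eq (++-assoc (encℕ (length us)) (concatMap encFin us) w′))
                       in bad us w′ (sym p) q) ,
         (before-loop ▹ stops (fails (loop≤ W (<⇒≤ l<W) i))))

    sets-read : ∀ p t w → Room 0 t w →
      Reads (encList (encList encFin)) (concatMap chunkD) sets (λ t w → pState p 0 0 t w) t w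
    sets-read p t w room with viewNum w
    ... | inj₂ (m , refl) = inj₂
      ((λ us w′ eq → ones≢encℕ m (length us) _ (trans eq (++-assoc (encℕ (length us)) (concatMap (encList encFin) us) w′))) ,
       stops (readNum-fails _ m (λ ()) (λ ()) refl (ones<W 0 t m room)))
    ... | inj₁ (l , w₁ , refl) = finish (items-read {e = encList (encFin {n})} {chunkD} (pf-List pf-Fin) cheap-chunk (λ l → pState p l 0)
                                           (λ _ _ _ → refl) (λ _ _ _ → refl) 0 (set-reads p 0) l t w₁
                                           (room-after 0 t (encℕ l) w₁ [] z≤n room))
      where
      l<W : suc l ≤ W
      l<W = number<W 0 t l w₁ room
      header : Step (readNum rC rF rI) (pState p 0 0 t (encℕ l ++ w₁)) (pState p l 0 t w₁)
      header = readNum-step _ (pState p l 0 t w₁) l w₁ (λ ()) (λ ()) refl refl refl l<W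
      finish : _ → _
      finish (inj₁ (us , w′ , refl , refl , i)) = inj₁ (us , w′ , sym (++-assoc (encℕ l) (concatMap (encList encFin) us) w′) ,
        (header ▸ by (loop≤ W (<⇒≤ l<W) i)))
      finish (inj₂ (bad , i)) = inj₂
        ((λ us w′ eq → let (p , q) = pf-ℕ l (length us) _ _ (trans eq (++-assoc (encℕ (length us)) (concatMap (encList encFin) us) w′))
                       in bad us w′ (sym p) q) ,
         (header ▹ fails (loop≤ W (<⇒≤ l<W) i)))

-- The bound on the slots, the final checks and the output

path₀ disBody upBody rowBody disabled ending main assemble : Prog 17
-- `rV` is not advanced: from now on it holds the last vertex instead of the next one, which `main`
-- corrects after the path.
path₀ = push rX false ⨾ att 0 ⨾ att 1
disBody = edge Y 0 Z 0 ⨾ push rY true ⨾ push rY true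
upBody = push rY true ⨾ push rY true
-- In row `i` the stack `r₁` holds `m ∸ i` ones, so it is empty iff the slot has to be switched off;
-- otherwise `rY` just passes over the slot.
rowBody = pop r₁ (for r₃ disBody) fail (for r₃ upBody)
disabled = pushes 5 rY ⨾ for r₂ rowBody ⨾ clear rY
-- After the end mark the input stack holds the parameter in unary; one bit is taken for each unit
-- of `n`, and nothing may remain.
ending = readBit rI fail fail skip ⨾ loop rN skip (pop rI fail fail skip) ⨾ pop rI skip fail fail
main = (readNum rC rN rI ⨾ xPart ⨾ path₀) ⨾ sets ⨾ push rV true ⨾ readNum rC r₁ rI ⨾ disabled ⨾ ending
-- `rO` already holds the parameter as ones. The rest is stacked on it from back to front; each pair
-- of `false` is the doubled terminator of the number drained next.
assemble = push rO true ⨾ push rO false ⨾ drain rX rO ⨾ drain rE rO ⨾ push rO false ⨾ push rO false ⨾ drain rM rO ⨾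
           push rO false ⨾ push rO false ⨾ drain rV rO

pathTrail : ∀ n → List (List (Fin n)) → Trail
pathTrail n 𝓕 = seg (concatMap chunkD 𝓕)
  (trail (base n n) (false ∷ ones (base n n)) ((base n n , 1) ∷ (base n n , 0) ∷ xEdges n))

finalTrail : ∀ n → List (List (Fin n)) → ℕ → Trail
finalTrail n 𝓕 m = trail (suc (v t)) (xb t) (foldUp (disableStep n m) n (es t))
  where t = pathTrail n 𝓕

payload : Trail → Str
payload t = ones (v t) ʳ++ (false ∷ (ones (length (es t)) ʳ++ (false ∷ (encE (es t) ʳ++ (xb t ʳ++ [])))))

finalVec : ℕ → Trail → Vec Str 17
finalVec n t = vec (state (base n n) t 0 0 (base n n) 0 0 0 0 0 [] 0) [ rI ]≔ []

Instance : Str → ℕ → Set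
Instance x p = Σ ℕ λ n → Σ (List (List (Fin n))) λ 𝓕 → Σ ℕ λ m → x ≡ encHS n 𝓕 m × p ≡ n

-- For a code of length at most `b`, the term `base b (suc b)` bounds the vertex numbers that occur
-- in X, and the product bounds the vertices added by the rest of the path.
loopBound : ℕ → ℕ
loopBound b = 2 + (base b (suc b) + b * (b * 2 + 3))

base-closed : ∀ n i → base n i ≡ i * (n * 2) + 5
base-closed n zero    = refl
base-closed n (suc i) = trans (cong (n * 2 +_) (base-closed n i)) (sym (+-assoc (n * 2) (i * (n * 2)) 5))

base-mono² : ∀ {n b i j} → n ≤ b → i ≤ j → base n i ≤ base b j
base-mono² {n} {b} {i} {j} n≤b i≤j = subst₂ _≤_ (sym (base-closed n i)) (sym (base-closed b j))
  (+-monoˡ-≤ 5 (*-mono-≤ i≤j (*-monoˡ-≤ 2 n≤b)))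

b<loopBound : ∀ b → b < loopBound b
b<loopBound b = s≤s (begin
  b                                              ≡⟨ sym (*-identityʳ b) ⟩
  b * 1                                          ≤⟨ *-monoʳ-≤ b (≤-trans (s≤s z≤n) (m≤n+m 3 (b * 2))) ⟩
  b * (b * 2 + 3)                                ≤⟨ m≤n+m _ (suc (base b (suc b))) ⟩
  suc (base b (suc b) + b * (b * 2 + 3))         ∎)
  where open ≤-Reasoning

module Main (W : ℕ) where

  open Programs {17} W
  open Reduction W
  open Path W

  module _ (n m : ℕ) (w : Str) (p : ℕ) (vv : ℕ) (xx : Str) (c : ℕ) (n≤W : n ≤ W) (base≤W : base n (suc n) ≤ W) where

    private
      dState : (c₁ c₂ c₃ y : ℕ) → List (ℕ × ℕ) → State
      dState c₁ c₂ c₃ y e = state c (trail vv xx e) n y c c₁ c₂ c₃ 0 0 w p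

    rowBody-step : ∀ r i e → i < n → Step rowBody (dState (m ∸ i) r 0 (base n i) e)
                                                 (dState (m ∸ suc i) r 0 (base n (suc i)) (disableStep n m i e))
    rowBody-step r i e i<n with m ≤? i
    ... | yes m≤i rewrite m≤n⇒m∸n≡0 m≤i | m≤n⇒m∸n≡0 (m≤n⇒m≤1+n m≤i) =
      by (pop-[] refl (run (for-step τ n (λ ()) (λ ()) (λ _ _ → refl) (λ _ _ → refl) refl refl n≤W body)))
      where
      τ : ℕ → ℕ → State
      τ q u = dState 0 r q (u * 2 + base n i) (disableRow u (base n i) e)
      body : ∀ q u → u < n → Step disBody (τ q u) (τ q (suc u))
      body q u u<n = edge-step Y 0 Z 0 (base≤ n n≤W base≤W (<⇒≤ u<n) (<⇒≤ i<n)) z≤n ▸ pushY ▸ pushY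
    ... | no m≰i rewrite +-∸-assoc 1 (≰⇒> m≰i) =
      by (pop-∷ refl (run (for-step τ n (λ ()) (λ ()) (λ _ _ → refl) (λ _ _ → refl) refl refl n≤W (λ _ _ _ → pushY ▸ pushY))))
      where
      τ : ℕ → ℕ → State
      τ q u = dState (m ∸ suc i) r q (u * 2 + base n i) e

    disabled-step : ∀ e → Step disabled (dState m 0 0 0 e) (dState (m ∸ n) 0 0 0 (foldUp (disableStep n m) n e))
    disabled-step e = by {σ′ = τ 0 0} (pushes-exec 5 rY _) ▸
      for-step τ n (λ ()) (λ ()) (λ _ _ → refl) (λ _ _ → refl) refl refl n≤W (λ r i i<n → rowBody-step r i _ i<n) ▸
      clearY (≤-trans (base-mono n (n≤1+n n)) base≤W)
      where
      τ : ℕ → ℕ → State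
      τ r i = dState (m ∸ i) r 0 (base n i) (foldUp (disableStep n m) i e)

  module _ (c n d : ℕ) (t : Trail) where

    private
      eVec : ℕ → Str → Vec Str 17
      eVec a z = vec (state c t a 0 c d 0 0 0 0 [] 0) [ rI ]≔ z

      cmp : Prog 17
      cmp = pop rI fail fail skip

    compare-iter : ∀ a b → Iter W rN skip cmp a (eVec a (ones (a + b))) (just (eVec 0 (ones b)))
    compare-iter zero    b = stop refl
    compare-iter (suc a) b = more refl (pop-∷ refl skip) (compare-iter a b)

    compare-iter-fails : ∀ b a → Iter W rN skip cmp (b + suc a) (eVec (b + suc a) (ones b)) nothing
    compare-iter-fails zero    a = abort refl (pop-[] refl fail)
    compare-iter-fails (suc b) a = more refl (pop-∷ refl skip) (compare-iter-fails b a)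

    ending-exec : ∀ w p → n ≤ W →
      (w ≡ [] × p ≡ n × Exec W ending (vec (state c t n 0 c d 0 0 0 0 w p)) (just (eVec 0 []))) ⊎
      (¬ (w ≡ [] × p ≡ n) × Exec W ending (vec (state c t n 0 c d 0 0 0 0 w p)) nothing)
    ending-exec (false ∷ w) p n≤W = inj₂ ((λ { (() , _) }) , abort (pop-∷ refl (pop-∷ refl fail)))
    ending-exec (true ∷ w)  p n≤W = inj₂ ((λ { (() , _) }) , abort (pop-∷ refl (pop-∷ refl fail)))
    ending-exec [] p n≤W with n ≤? p
    ... | no n≰p = inj₂ ((λ { (_ , refl) → n≰p ≤-refl }) , (pop-∷ refl (pop-∷ refl skip) ⨾
            abort (loop≤ W n≤W (subst (λ z → Iter W rN skip cmp z (eVec z (ones p)) nothing) p+≡n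
              (compare-iter-fails p (n ∸ suc p))))))
      where
      p+≡n : p + suc (n ∸ suc p) ≡ n
      p+≡n = trans (+-suc p _) (m+[n∸m]≡n (≰⇒> n≰p))
    ... | yes n≤p with p ∸ n in eq | m+[n∸m]≡n n≤p
    ...   | zero | n+≡p = inj₁ (refl , trans (sym n+≡p) (+-identityʳ n) ,
            (pop-∷ refl (pop-∷ refl skip) ⨾ loop≤ W n≤W
              (subst (λ z → Iter W rN skip cmp n (eVec n (ones z)) (just (eVec 0 []))) n+≡p (compare-iter n 0)) ⨾
             pop-[] refl skip))
    ...   | suc q | n+≡p = inj₂ ((λ { (_ , refl) → case-zero (trans (sym (n∸n≡0 n)) eq) }) ,
            (pop-∷ refl (pop-∷ refl skip) ⨾ loop≤ W n≤W
              (subst (λ z → Iter W rN skip cmp n (eVec n (ones z)) (just (eVec 0 (ones (suc q))))) n+≡p (compare-iter n (suc q))) ⨾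
             pop-∷ refl fail))
      where
      case-zero : ∀ {x} → 0 ≢ suc x
      case-zero ()

  initState : Str → ℕ → State
  initState x p = state 0 (trail 0 [] []) 0 0 0 0 0 0 0 0 x p

  Outcome : Str → ℕ → Set
  Outcome x p =
    (Σ (Instance x p) λ (n , 𝓕 , m , _) → ∃ λ d →
       Exec W main (vec (initState x p)) (just (finalVec n (finalTrail n 𝓕 m) [ r₁ ]≔ ones d))) ⊎
    ((¬ Instance x p) × Exec W main (vec (initState x p)) nothing)

  -- The stages follow the layout of the code: `n`, the family, `m`, end mark and parameter. What
  -- has been read is the only possible reading, as the codes are prefix-free, so a failure at any
  -- stage excludes every instance.
  main-exec : ∀ b x p → length x ≤ b → W ≡ loopBound b → Outcome x p
  main-exec b x p x≤b refl with viewNum x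
  ... | inj₂ (k , refl) =
    inj₂ ((λ { (n , 𝓕 , m , eq , _) → ones≢encℕ k n _ eq }) ,
      run⊥ (stops (stops (readNum-fails (initState (ones k) p) k (λ ()) (λ ()) refl
        (≤-trans (s≤s (≤-trans (≤-reflexive (sym (length-replicate k))) x≤b)) (b<loopBound b))))))
  ... | inj₁ (n , w , refl) = stage₁ (sets-read n n≤W base≤W p t₁ w room)
    where
    n<b : suc n ≤ b
    n<b = ≤-trans (≤-trans (m≤m+n (suc n) (length w)) (≤-reflexive (sym (length-encℕ-++ n w)))) x≤b
    w≤b : length w ≤ b
    w≤b = ≤-trans (≤-trans (m≤n+m (length w) (suc n)) (≤-reflexive (sym (length-encℕ-++ n w)))) x≤b
    b≤W : b ≤ W
    b≤W = <⇒≤ (b<loopBound b)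
    n≤W : n ≤ W
    n≤W = ≤-trans (≤-trans (n≤1+n n) n<b) b≤W
    base≤W : base n (suc n) ≤ W
    base≤W = ≤-trans (base-mono² (≤-trans (n≤1+n n) n<b) (≤-trans n<b (n≤1+n b))) (≤-trans (m≤m+n _ _) (m≤n+m _ 2))
    baseₙ≤W : base n n ≤ W
    baseₙ≤W = ≤-trans (base-mono n (n≤1+n n)) base≤W
    t₁ : Trail
    t₁ = trail (base n n) (false ∷ ones (base n n)) ((base n n , 1) ∷ (base n n , 0) ∷ xEdges n)
    room : Room n n≤W base≤W 0 t₁ w
    room = ≤-trans (+-monoʳ-≤ 1 (+-mono-≤ (base-mono² (≤-trans (n≤1+n n) n<b) (≤-trans (n≤1+n n) (≤-trans n<b (n≤1+n b))))
                     (*-mono-≤ w≤b (+-monoˡ-≤ 3 (*-monoˡ-≤ 2 (≤-trans (n≤1+n n) n<b)))))) (n≤1+n _)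
    S : Trail → Str → State
    S t w = pState n n≤W base≤W p 0 0 t w

    stage₀ : Step (readNum rC rN rI ⨾ xPart ⨾ path₀) (initState (encℕ n ++ w) p) (S t₁ w)
    stage₀ = readNum-step (initState (encℕ n ++ w) p) (xState n 0 0 0 0 [] w p) n w (λ ()) (λ ()) refl refl refl (≤-trans n<b b≤W) ▸
      xPart-step n w p n≤W baseₙ≤W ▸
      by {σ′ = S (trail (base n n) (false ∷ ones (base n n)) (xEdges n)) w} push ▸
      edge-step V 0 Z 0 baseₙ≤W z≤n ▸ edge-step V 0 Z 1 baseₙ≤W z≤n

    Goal : Set
    Goal = Outcome (encℕ n ++ w) p

    stage₁ : _ → Goal
    stage₁ (inj₂ (bad , f)) = inj₂
      ((λ { (n′ , 𝓕 , m , eq , _) → refute n′ 𝓕 m eq (proj₁ (pf-ℕ n n′ w _ eq)) }) , run⊥ (stage₀ ▹ stops f))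
      where
      refute : ∀ n′ (𝓕 : List (List (Fin n′))) m → encℕ n ++ w ≡ encHS n′ 𝓕 m → n ≡ n′ → Empty
      refute n′ 𝓕 m eq refl = bad 𝓕 (encℕ m) (proj₂ (pf-ℕ n n w _ eq))
    stage₁ (inj₁ (𝓕 , w₁ , w≡ , st₁)) = stage₂ (viewNum w₁)
      where
      t₂ = pathTrail n 𝓕
      t₂⁺ = trail (suc (v t₂)) (xb t₂) (es t₂)

      w₁≤b : length w₁ ≤ b
      w₁≤b = ≤-trans (≤-trans (m≤n+m (length w₁) _) (≤-reflexive (sym (trans (cong length w≡) (length-++ (encList (encList encFin) 𝓕)))))) w≤b

      not-instance : (∀ m → w₁ ≡ encℕ m → p ≢ n) → ¬ Instance (encℕ n ++ w) p
      not-instance bad (n′ , 𝓕′ , m , eq , p≡) = refute (proj₁ (pf-ℕ n n′ w _ eq)) 𝓕′ eq p≡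
        where
        refute : ∀ {n′} → n ≡ n′ → (𝓕′ : List (List (Fin n′))) → encℕ n ++ w ≡ encHS n′ 𝓕′ m → p ≡ n′ → Empty
        refute refl 𝓕′ eq p≡ = bad m (proj₂ (pf-List (pf-List pf-Fin) 𝓕 𝓕′ w₁ (encℕ m)
          (trans (sym w≡) (proj₂ (pf-ℕ n n w _ eq))))) p≡

      stage₁⁺ : ∀ {o} → Exec W (readNum rC r₁ rI ⨾ disabled ⨾ ending) (vec (S t₂⁺ w₁)) o → Exec W main (vec (initState (encℕ n ++ w) p)) o
      stage₁⁺ x = run stage₀ ⨾ run st₁ ⨾ run pushV ⨾ x
        where
        pushV : Step (push rV true) (S t₂ w₁) (S t₂⁺ w₁)
        pushV = by push

      stage₂ : _ → Goal
      stage₂ (inj₂ (k , eq)) = inj₂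
        (not-instance (λ m eq′ _ → ones≢encℕ k m [] (trans (sym eq) (trans eq′ (sym (++-identityʳ (encℕ m)))))) ,
         stage₁⁺ (abort (run⊥ (readNum-fails (S t₂⁺ w₁) k (λ ()) (λ ()) eq
           (≤-trans (s≤s (≤-trans (≤-reflexive (trans (sym (length-replicate k)) (cong length (sym eq)))) w₁≤b)) (b<loopBound b))))))
      stage₂ (inj₁ (m , w₂ , eq)) = stage₃ (ending-exec (base n n) n (m ∸ n) (finalTrail n 𝓕 m) w₂ p n≤W)
        where
        m<W : suc m ≤ W
        m<W = ≤-trans (≤-trans (≤-trans (m≤m+n (suc m) (length w₂)) (≤-reflexive (sym (trans (cong length eq) (length-encℕ-++ m w₂))))) w₁≤b) b≤W
        mState : ℕ → List (ℕ × ℕ) → State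
        mState c e = state (base n n) (trail (suc (v t₂)) (xb t₂) e) n 0 (base n n) c 0 0 0 0 w₂ p
        st₂ : Step (readNum rC r₁ rI) (S t₂⁺ w₁) (mState m (es t₂))
        st₂ = readNum-step (S t₂⁺ w₁) (mState m (es t₂)) m w₂ (λ ()) (λ ()) eq refl refl m<W
        st₃ : Step disabled (mState m (es t₂)) (mState (m ∸ n) (foldUp (disableStep n m) n (es t₂)))
        st₃ = disabled-step n m w₂ p (suc (v t₂)) (xb t₂) (base n n) n≤W base≤W (es t₂)
        stage₃ : _ → Goal
        stage₃ (inj₁ (refl , refl , x)) = inj₁
          ((n , 𝓕 , m , cong (encℕ n ++_) (trans w≡ (cong (encList (encList encFin) 𝓕 ++_) (trans eq (++-identityʳ (encℕ m))))) , refl) ,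
           m ∸ n , stage₁⁺ (run st₂ ⨾ run st₃ ⨾ x))
        stage₃ (inj₂ (bad , x)) = inj₂
          (not-instance (λ m′ eq′ p≡ → bad (sym (proj₂ (pf-ℕ m′ m [] w₂ (trans (++-identityʳ (encℕ m′)) (trans (sym eq′) eq)))) , p≡)) ,
           stage₁⁺ (run st₂ ⨾ run st₃ ⨾ x))

length-lookup : ∀ {k} (ρ : Vec Str k) j → length (Vec.lookup ρ j) ≤ total ρ
length-lookup (r ∷ ρ) zero    = ≤-trans (n≤1+n _) (m≤m+n _ _)
length-lookup (r ∷ ρ) (suc j) = ≤-trans (length-lookup ρ j) (m≤n+m _ _)

assemble-exec : ∀ W n t d → total (finalVec n t [ r₁ ]≔ ones d) ≤ W →
  ∃ λ ρ → Exec W assemble (finalVec n t [ r₁ ]≔ ones d) (just (encPair (payload t) (base n n) ∷ ρ))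
assemble-exec W n t d le = replace out≡
  (push ⨾ push ⨾ drain-exec (λ ()) _ (len rX) ⨾ drain-exec (λ ()) _ (len rE) ⨾ push ⨾ push ⨾ drain-exec (λ ()) _ (len rM) ⨾
   push ⨾ push ⨾ drain-exec (λ ()) _ (len rV))
  where
  open Programs {17} W
  len : ∀ j → length (Vec.lookup (finalVec n t [ r₁ ]≔ ones d) j) ≤ W
  len j = ≤-trans (length-lookup (finalVec n t [ r₁ ]≔ ones d) j) le
  replace : ∀ {p ρ o o′ ρ′} → o ≡ o′ → Exec W p ρ (just (o ∷ ρ′)) → ∃ λ ρ″ → Exec {17} W p ρ (just (o′ ∷ ρ″))
  replace refl x = _ , x
  tail = false ∷ true ∷ ones (base n n)
  out≡ : drained (ones (v t)) (false ∷ false ∷ drained (ones (length (es t))) (false ∷ false ∷ drained (encE (es t)) (drained (xb t) tail)))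
         ≡ dbl (payload t) ++ tail
  out≡ rewrite drained-ʳ++ (xb t) [] tail | drained-ʳ++ (encE (es t)) (xb t ʳ++ []) tail
             | drained-ʳ++ (ones (length (es t))) (false ∷ (encE (es t) ʳ++ (xb t ʳ++ []))) tail
             = drained-ʳ++ (ones (v t)) (false ∷ (ones (length (es t)) ʳ++ (false ∷ (encE (es t) ʳ++ (xb t ʳ++ []))))) tail

-- The graph

-- The vertices of X. The cutset separates a₁, a₂ from b₁, b₂ and contains
-- the hub. Slot i (of n) holds the element u iff `sel i u` is not in the
-- cutset, iff `neg i u` is.
data XV (n : ℕ) : Set where
  cst : Fin 5 → XV n
  lit : Fin 2 → Fin n → Fin n → XV n

pattern a₁ = cst 0F
pattern a₂ = cst 1F
pattern b₁ = cst 2F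
pattern b₂ = cst 3F
pattern hub = cst 4F
pattern sel i u = lit 0F i u
pattern neg i u = lit 1F i u

-- The neighbours in X of the vertices of the path, in order.
slotV : ∀ {n} → Fin n → Fin n → List (List (XV n))
slotV u i = (sel i u ∷ []) ∷ (sel i u ∷ hub ∷ []) ∷ []

elemV : ∀ {n} → Fin n → List (List (XV n))
elemV u = concatMap (slotV u) (allFin _)

-- The first vertex sees both sides and is forced into the cutset, which separates this stretch from
-- the previous one. The second and the last see the hub, hence lie outside the cutset, on the sides
-- of a and b.
chunkV : ∀ {n} → List (Fin n) → List (List (XV n))
chunkV us = (a₁ ∷ a₂ ∷ b₁ ∷ []) ∷ (a₁ ∷ hub ∷ []) ∷ concatMap elemV us ++ ((b₁ ∷ hub ∷ []) ∷ [])

pathV : ∀ {n} → List (List (Fin n)) → List (List (XV n))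
pathV 𝓕 = (a₁ ∷ a₂ ∷ []) ∷ concatMap chunkV 𝓕

∣X∣ : ℕ → ℕ
∣X∣ n = 5 + n * n * 2

codeX : ∀ {n} → XV n → Fin (∣X∣ n)
codeX {n} (cst c)     = c ↑ˡ (n * n * 2)
codeX {n} (lit b i u) = 5 ↑ʳ combine (combine i u) b

decodeX′ : ∀ {n} → Fin 5 ⊎ Fin (n * n * 2) → XV n
decodeX′ {n} (inj₁ c) = cst c
decodeX′ {n} (inj₂ q) = let (iu , b) = remQuot {n * n} 2 q ; (i , u) = remQuot {n} n iu in lit b i u

decodeX : ∀ {n} → Fin (∣X∣ n) → XV n
decodeX {n} f = decodeX′ (splitAt 5 f)

decodeX-codeX : ∀ {n} (x : XV n) → decodeX (codeX x) ≡ x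
decodeX-codeX {n} (cst c)     = cong decodeX′ (splitAt-↑ˡ 5 c (n * n * 2))
decodeX-codeX {n} (lit b i u) = trans (cong (decodeX′ {n}) (splitAt-↑ʳ 5 (n * n * 2) (combine (combine i u) b)))
  (trans (cong (λ (iu , b) → let (i , u) = remQuot {n} n iu in lit b i u) (remQuot-combine (combine i u) b))
         (cong (λ (i , u) → lit b i u) (remQuot-combine i u)))

codeX-decodeX : ∀ {n} (f : Fin (∣X∣ n)) → codeX {n} (decodeX f) ≡ f
codeX-decodeX {n} f = trans (lemma (splitAt 5 f)) (join-splitAt 5 (n * n * 2) f)
  where
  lemma : ∀ z → codeX {n} (decodeX′ z) ≡ join 5 (n * n * 2) z
  lemma (inj₁ c) = refl
  lemma (inj₂ q) = cong (5 ↑ʳ_) (trans (cong (λ z → combine z (proj₂ (remQuot {n * n} 2 q))) (combine-remQuot {n} n (proj₁ (remQuot {n * n} 2 q))))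
                                       (combine-remQuot {n * n} 2 q))

-- The index ranges over `Fin (length (tabulate f))`, so it is translated to a `t` in `Fin k` with
-- the same value.
lookup-tabulate-at : ∀ {A : Set} {k} (f : Fin k → A) i → ∃ λ t → lookup (tabulate f) i ≡ f t × toℕ t ≡ toℕ i
lookup-tabulate-at {k = suc k} f zero    = zero , refl , refl
lookup-tabulate-at {k = suc k} f (suc i) =
  let (t , eq , it) = lookup-tabulate-at (f ∘ suc) i in suc t , eq , cong suc it

module Construction {n : ℕ} (m : ℕ) (D : List (List (XV n))) where

  T : ℕ
  T = length D

  Vtx : Set
  Vtx = XV n ⊎ Fin T

  code : Vtx → Fin (∣X∣ n + T)
  code (inj₁ x) = codeX x ↑ˡ T
  code (inj₂ t) = ∣X∣ n ↑ʳ t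

  decode′ : Fin (∣X∣ n) ⊎ Fin T → Vtx
  decode′ (inj₁ f) = inj₁ (decodeX f)
  decode′ (inj₂ t) = inj₂ t

  decode : Fin (∣X∣ n + T) → Vtx
  decode f = decode′ (splitAt (∣X∣ n) f)

  decode-code : ∀ a → decode (code a) ≡ a
  decode-code (inj₁ x) = trans (cong decode′ (splitAt-↑ˡ (∣X∣ n) (codeX x) T)) (cong inj₁ (decodeX-codeX x))
  decode-code (inj₂ t) = cong decode′ (splitAt-↑ʳ (∣X∣ n) T t)

  code-decode : ∀ f → code (decode f) ≡ f
  code-decode f = trans (lemma (splitAt (∣X∣ n) f)) (join-splitAt (∣X∣ n) T f)
    where
    lemma : ∀ z → code (decode′ z) ≡ join (∣X∣ n) T z
    lemma (inj₁ f) = cong (_↑ˡ T) (codeX-decodeX {n} f)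
    lemma (inj₂ t) = refl

  code-injective : ∀ {a b} → code a ≡ code b → a ≡ b
  code-injective {a} {b} eq = trans (sym (decode-code a)) (trans (cong decode eq) (decode-code b))

  pattern ex x   = inj₁ x
  pattern path t = inj₂ t

  -- Directed as in the written list, and with the loops at `neg i u` that the program writes;
  -- `Adjacent` removes both features.
  data Edge : Vtx → Vtx → Set where
    a₁a₂ : Edge (ex a₁) (ex a₂)
    b₁b₂ : Edge (ex b₁) (ex b₂)
    sa₁  : Edge (ex hub) (ex a₁)
    sa₂  : Edge (ex hub) (ex a₂)
    sb₁  : Edge (ex hub) (ex b₁)
    sb₂  : Edge (ex hub) (ex b₂)
    selb₁ : ∀ {i u} → Edge (ex (sel i u)) (ex b₁)
    selb₂ : ∀ {i u} → Edge (ex (sel i u)) (ex b₂)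
    nega₁ : ∀ {i u} → Edge (ex (neg i u)) (ex a₁)
    nega₂ : ∀ {i u} → Edge (ex (neg i u)) (ex a₂)
    selneg : ∀ {i u} → Edge (ex (sel i u)) (ex (neg i u))
    clique : ∀ {i u u′} → Edge (ex (neg i u)) (ex (neg i u′))
    off    : ∀ {i u} → m ≤ toℕ i → Edge (ex (sel i u)) (ex a₁)
    hang    : ∀ {t x} → x ∈ₗ lookup D t → Edge (path t) (ex x)
    along  : ∀ {t t′} → toℕ t′ ≡ suc (toℕ t) → Edge (path t) (path t′)

  Adjacent : Vtx → Vtx → Set
  Adjacent a b = a ≢ b × (Edge a b ⊎ Edge b a)

  -- All that the graph argument requires of the edge list; order and repetitions stay open.
  record Presents (es : List (Fin (∣X∣ n + T) × Fin (∣X∣ n + T))) : Set where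
    field
      edge⁺ : ∀ {a b} → Edge a b → (code a , code b) ∈ₗ es
      edge⁻ : ∀ {a b} → (code a , code b) ∈ₗ es → Edge a b

  X : Subset (∣X∣ n + T)
  X = Vec.replicate (∣X∣ n) true Vec.++ Vec.replicate T false

  ∣X∣-size : ∣ X ∣ ≡ ∣X∣ n
  ∣X∣-size = go′ (∣X∣ n)
    where
    none : ∀ k → ∣ Vec.replicate k false ∣ ≡ 0
    none zero    = refl
    none (suc k) = none k
    go′ : ∀ k → ∣ Vec.replicate k true Vec.++ Vec.replicate T false ∣ ≡ k
    go′ zero    = none T
    go′ (suc k) = cong suc (go′ k)

  ex∈X : ∀ x → code (ex x) ∈ X
  ex∈X x = Vecₚ.lookup⇒[]= _ X (trans (Vecₚ.lookup-++ˡ (Vec.replicate (∣X∣ n) true) _ (codeX x)) (Vecₚ.lookup-replicate (codeX x) true))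

  path∉X : ∀ t → code (path t) ∉ X
  path∉X t p with trans (sym (Vecₚ.[]=⇒lookup p))
                   (trans (Vecₚ.lookup-++ʳ (Vec.replicate (∣X∣ n) true) (Vec.replicate T false) t) (Vecₚ.lookup-replicate t false))
  ... | ()

  module Facts {es : List (Fin (∣X∣ n + T) × Fin (∣X∣ n + T))} (pres : Presents es) where

    open Presents pres

    G : Graph
    G = graph (∣X∣ n + T) es

    adj⁺ : ∀ {a b} → Adjacent a b → Adj G (code a) (code b)
    adj⁺ (a≢b , inj₁ e) = a≢b ∘ code-injective , inj₁ (edge⁺ e)
    adj⁺ (a≢b , inj₂ e) = a≢b ∘ code-injective , inj₂ (edge⁺ e)

    adj⁻ : ∀ {a b} → Adj G (code a) (code b) → Adjacent a b
    adj⁻ (a≢b , inj₁ e) = a≢b ∘ cong code , inj₁ (edge⁻ e)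
    adj⁻ (a≢b , inj₂ e) = a≢b ∘ cong code , inj₂ (edge⁻ e)

    adj-decode : ∀ {f g} → Adj G f g → Adjacent (decode f) (decode g)
    adj-decode {f} {g} e = adj⁻ (subst₂ (Adj G) (sym (code-decode f)) (sym (code-decode g)) e)

    P : List (Fin (∣X∣ n + T))
    P = tabulate (code ∘ inj₂)

    path∈P : ∀ {f} → f ∉ X → f ∈ₗ P
    path∈P {f} f∉X = subst (_∈ₗ P) (code-decode f) (lemma (decode f) (subst (_∉ X) (sym (code-decode f)) f∉X))
      where
      lemma : ∀ a → code a ∉ X → code a ∈ₗ P
      lemma (ex x)   a∉X = ⊥-elim (a∉X (ex∈X x))
      lemma (path t) a∉X = ∈-tabulate⁺ {f = code ∘ inj₂} t

    linearForest : LinearForestMinus G X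
    linearForest f f∉X = P , Uniqueₚ.tabulate⁺ (λ eq → inj₂-injective (code-injective eq)) , Allₚ.tabulate⁺ path∉X , path∈P f∉X ,
      (λ p q p∈P q∉X adj → path∈P q∉X) , consecutive , adjacent
      where
      consecutive : ∀ i j → Adj G (lookup P i) (lookup P j) → (suc (toℕ i) ≡ toℕ j) ⊎ (suc (toℕ j) ≡ toℕ i)
      consecutive i j adj with lookup-tabulate-at (code ∘ inj₂) i | lookup-tabulate-at (code ∘ inj₂) j
      ... | t , eq , it | t′ , eq′ , jt with proj₂ (adj⁻ {path t} {path t′} (subst₂ (Adj G) eq eq′ adj))
      ... | inj₁ (along e) = inj₁ (trans (cong suc (sym it)) (trans (sym e) jt))
      ... | inj₂ (along e) = inj₂ (trans (cong suc (sym jt)) (trans (sym e) it))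
      adjacent : ∀ i j → suc (toℕ i) ≡ toℕ j → Adj G (lookup P i) (lookup P j)
      adjacent i j e with lookup-tabulate-at (code ∘ inj₂) i | lookup-tabulate-at (code ∘ inj₂) j
      ... | t , eq , it | t′ , eq′ , jt = subst₂ (Adj G) (sym eq) (sym eq′)
        (adj⁺ {path t} {path t′} ((λ { refl → 1+n≢n (trans e (trans (sym jt) it)) }) , inj₁ (along (trans jt (trans (sym e) (cong suc (sym it)))))))

-- From a hitting set to a stable cutset

data Label : Set where
  A S B : Label

data Compatible : Label → Label → Set where
  AA : Compatible A A
  BB : Compatible B B
  AS : Compatible A S
  SA : Compatible S A
  BS : Compatible B S
  SB : Compatible S B

compatible-sym : ∀ {x y} → Compatible x y → Compatible y x
compatible-sym AA = AA
compatible-sym BB = BB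
compatible-sym AS = SA
compatible-sym SA = AS
compatible-sym BS = SB
compatible-sym SB = BS

data Side : Label → Set where
  sideA : Side A
  sideB : Side B

side-S : ∀ {x} → Side x → Compatible x S
side-S sideA = AS
side-S sideB = BS

side-side : ∀ {x} → Side x → Compatible x x
side-side sideA = AA
side-side sideB = BB

-- The number of members of the set before `u`, used as the slot that holds `u`.
rank : ∀ {n} → Subset n → Fin n → ℕ
rank (b ∷ H)     zero    = 0
rank (true ∷ H)  (suc u) = suc (rank H u)
rank (false ∷ H) (suc u) = rank H u

rank<∣∣ : ∀ {n} (H : Subset n) {u} → u ∈ H → rank H u < ∣ H ∣
rank<∣∣ (true ∷ H)  Vec.here       = s≤s z≤n
rank<∣∣ (true ∷ H)  (Vec.there u∈) = s≤s (rank<∣∣ H u∈)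
rank<∣∣ (false ∷ H) (Vec.there u∈) = rank<∣∣ H u∈

rank-injective : ∀ {n} (H : Subset n) {u u′} → u ∈ H → u′ ∈ H → rank H u ≡ rank H u′ → u ≡ u′
rank-injective (true ∷ H)  Vec.here       Vec.here        eq = refl
rank-injective (true ∷ H)  (Vec.there u∈) (Vec.there u′∈) eq = cong suc (rank-injective H u∈ u′∈ (suc-injective eq))
rank-injective (false ∷ H) (Vec.there u∈) (Vec.there u′∈) eq = cong suc (rank-injective H u∈ u′∈ eq)

module Forward {n : ℕ} (𝓕 : List (List (Fin n))) (m : ℕ) (H : Subset n) (H≤m : ∣ H ∣ ≤ m)
               (hits : All (λ F → Any (_∈ H) F) 𝓕) where

  open Construction m (pathV 𝓕)

  Chosen : Fin n → Fin n → Set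
  Chosen i u = u ∈ H × rank H u ≡ toℕ i

  chosen? : ∀ i u → Dec (Chosen i u)
  chosen? i u = (u ∈? H) ×-dec (rank H u ≟ toℕ i)

  ifYes : {C : Set} → Dec C → Label → Label → Label
  ifYes (yes _) x y = x
  ifYes (no  _) x y = y

  labX : XV n → Label
  labX a₁        = A
  labX a₂        = A
  labX b₁        = B
  labX b₂        = B
  labX hub       = S
  labX (sel i u) = ifYes (chosen? i u) B S
  labX (neg i u) = ifYes (chosen? i u) S A

  data Trace : Label → List (List (XV n)) → Label → Set where
    []    : ∀ {p} → Trace p [] p
    visit : ∀ {p d D r} q → Compatible p q → All (λ x → Compatible q (labX x)) d → Trace q D r → Trace p (d ∷ D) r

  infixr 5 _++ᵗ_

  _++ᵗ_ : ∀ {p D q D′ r} → Trace p D q → Trace q D′ r → Trace p (D ++ D′) r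
  []            ++ᵗ t = t
  visit q c a s ++ᵗ t = visit q c a (s ++ᵗ t)

  -- A trace that may end in B early, and certainly does if C holds.
  Reaches : Label → List (List (XV n)) → Set → Set
  Reaches p D C = ∃ λ q → Side q × Trace p D q × (C ⊎ p ≡ B → q ≡ B)

  slot-trace : ∀ u i {p} → Side p → Reaches p (slotV u i) (Chosen i u)
  slot-trace u i {p} side with chosen? i u in eq
  ... | yes c = B , sideB ,
    visit S (side-S side) (subst (λ z → Compatible S (ifYes z B S)) (sym eq) SB ∷ [])
      (visit B SB (subst (λ z → Compatible B (ifYes z B S)) (sym eq) BB ∷ BS ∷ []) []) , (λ _ → refl)
  ... | no ¬c = p , side ,
    visit p (side-side side) (subst (λ z → Compatible p (ifYes z B S)) (sym eq) (side-S side) ∷ [])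
      (visit p (side-side side) (subst (λ z → Compatible p (ifYes z B S)) (sym eq) (side-S side) ∷ side-S side ∷ []) []) ,
    (λ { (inj₁ c) → ⊥-elim (¬c c) ; (inj₂ e) → e })

  -- A stretch that has reached `B` stays there, so a single hit among the parts is enough.
  concat-trace : ∀ {I : Set} {E : I → List (List (XV n))} {C : I → Set} →
    (∀ i {p} → Side p → Reaches p (E i) (C i)) → ∀ is {p} → Side p → Reaches p (concatMap E is) (Any C is)
  concat-trace f []       {p} side = p , side , [] , λ { (inj₁ ()) ; (inj₂ e) → e }
  concat-trace f (i ∷ is) side =
    let (q , side′ , t , e) = f i side
        (r , side″ , t′ , e′) = concat-trace f is side′
    in r , side″ , t ++ᵗ t′ ,
       λ { (inj₁ (here c)) → e′ (inj₂ (e (inj₁ c))) ; (inj₁ (there c)) → e′ (inj₁ c) ; (inj₂ p≡B) → e′ (inj₂ (e (inj₂ p≡B))) }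

  -- A member of `H` is held by the slot of its rank, which exists because `H` has at most `n`
  -- members.
  elem-trace : ∀ u {p} → Side p → Reaches p (elemV u) (u ∈ H)
  elem-trace u side = let (q , side′ , t , e) = concat-trace (slot-trace u) (allFin n) side in q , side′ , t ,
    λ { (inj₁ u∈) → e (inj₁ (Any.map (λ { refl → u∈ , sym (toℕ-fromℕ< (r<n u∈)) }) (∈-allFin (fromℕ< (r<n u∈))))) ; (inj₂ eq) → e (inj₂ eq) }
    where
    r<n : u ∈ H → rank H u < n
    r<n u∈ = ≤-trans (rank<∣∣ H u∈) (∣p∣≤n H)

  -- Labelling the first vertex `S` allows the change from whatever side came before to `A`; the hit
  -- then yields `B` in time for the last vertex.
  chunk-trace : ∀ us → Any (_∈ H) us → ∀ {p} → Side p → Trace p (chunkV us) B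
  chunk-trace us hit side with concat-trace elem-trace us sideA
  ... | q , _ , t , e with e (inj₁ hit)
  ... | refl = visit S (side-S side) (SA ∷ SA ∷ SB ∷ []) (visit A SA (AA ∷ AS ∷ [])
                 (t ++ᵗ visit B BB (BB ∷ BS ∷ []) []))

  chunks-trace : ∀ {𝓖} → All (λ F → Any (_∈ H) F) 𝓖 → ∀ {p} → Side p → ∃ λ q → Trace p (concatMap chunkV 𝓖) q
  chunks-trace []         {p} side = p , []
  chunks-trace (hit ∷ hs) side = let (q , t) = chunks-trace hs sideB in q , chunk-trace _ hit side ++ᵗ t

  labelAt : ∀ {p E r} → Trace p E r → Fin (length E) → Label
  labelAt (visit q _ _ t) zero    = q
  labelAt (visit q _ _ t) (suc j) = labelAt t j

  labelAt-att : ∀ {p E r} (t : Trace p E r) j {x} → x ∈ₗ lookup E j → Compatible (labelAt t j) (labX x)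
  labelAt-att (visit q _ a t) zero    x∈ = All.lookup a x∈
  labelAt-att (visit q _ a t) (suc j) x∈ = labelAt-att t j x∈

  labelAt-along : ∀ {p E r} (t : Trace p E r) j j′ → toℕ j′ ≡ suc (toℕ j) → Compatible (labelAt t j) (labelAt t j′)
  labelAt-along (visit q _ _ (visit q′ c _ t)) zero    (suc zero) eq = c
  labelAt-along (visit q _ _ t)                (suc j) (suc j′)   eq = labelAt-along t j j′ (suc-injective eq)

  trace : ∃ λ q → Trace A (pathV 𝓕) q
  trace = let (q , t) = chunks-trace hits sideA in q , visit A AA (AA ∷ AA ∷ []) t

  lab : Vtx → Label
  lab (ex x)   = labX x
  lab (path t) = labelAt (proj₂ trace) t

  edge-compatible : ∀ {a b} → a ≢ b → Edge a b → Compatible (lab a) (lab b)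
  edge-compatible _ a₁a₂ = AA
  edge-compatible _ b₁b₂ = BB
  edge-compatible _ sa₁  = SA
  edge-compatible _ sa₂  = SA
  edge-compatible _ sb₁  = SB
  edge-compatible _ sb₂  = SB
  edge-compatible _ (selb₁ {i} {u}) with chosen? i u
  ... | yes _ = BB
  ... | no  _ = SB
  edge-compatible _ (selb₂ {i} {u}) with chosen? i u
  ... | yes _ = BB
  ... | no  _ = SB
  edge-compatible _ (nega₁ {i} {u}) with chosen? i u
  ... | yes _ = SA
  ... | no  _ = AA
  edge-compatible _ (nega₂ {i} {u}) with chosen? i u
  ... | yes _ = SA
  ... | no  _ = AA
  edge-compatible _ (selneg {i} {u}) with chosen? i u
  ... | yes _ = BS
  ... | no  _ = SA
  edge-compatible a≢b (clique {i} {u} {u′}) with chosen? i u | chosen? i u′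
  ... | yes (u∈ , r) | yes (u′∈ , r′) = ⊥-elim (a≢b (cong {B = Vtx} (λ z → ex (neg i z)) (rank-injective H u∈ u′∈ (trans r (sym r′)))))
  ... | yes _ | no  _ = SA
  ... | no  _ | yes _ = AS
  ... | no  _ | no  _ = AA
  edge-compatible _ (off {i} {u} m≤i) with chosen? i u
  -- Ranks are below the size of `H` and thus below `m`, so no switched-off slot is occupied.
  ... | yes (u∈ , r) = ⊥-elim (<⇒≱ (≤-trans (rank<∣∣ H u∈) H≤m) (≤-trans m≤i (≤-reflexive (sym r))))
  ... | no  _ = SA
  edge-compatible _ (hang {t} x∈) = labelAt-att (proj₂ trace) t x∈
  edge-compatible _ (along {t} {t′} eq) = labelAt-along (proj₂ trace) t t′ eq

  isS : Label → Bool
  isS A = false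
  isS S = true
  isS B = false

  cut : Subset (∣X∣ n + T)
  cut = Vec.tabulate (isS ∘ lab ∘ decode)

  ∈cut : ∀ f → f ∈ cut → lab (decode f) ≡ S
  ∈cut f f∈ = lemma _ (trans (sym (Vecₚ.lookup∘tabulate (isS ∘ lab ∘ decode) f)) (Vecₚ.[]=⇒lookup f∈))
    where
    lemma : ∀ x → isS x ≡ true → x ≡ S
    lemma S _ = refl

  ∉cut : ∀ f → f ∉ cut → Side (lab (decode f))
  ∉cut f f∉ = lemma _ (λ eq → f∉ (Vecₚ.lookup⇒[]= f cut (trans (Vecₚ.lookup∘tabulate (isS ∘ lab ∘ decode) f) (cong isS eq))))
    where
    lemma : ∀ x → x ≢ S → Side x
    lemma A _ = sideA
    lemma S n = ⊥-elim (n refl)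
    lemma B _ = sideB

  side∉cut : ∀ a → Side (lab a) → code a ∉ cut
  side∉cut a side a∈ with subst Side (trans (sym (cong lab (decode-code a))) (∈cut (code a) a∈)) side
  ... | ()

  module _ {es : List (Fin (∣X∣ n + T) × Fin (∣X∣ n + T))} (pres : Presents es) where

    open Facts pres

    adj-compatible : ∀ {f g} → Adj G f g → Compatible (lab (decode f)) (lab (decode g))
    adj-compatible e with adj-decode e
    ... | a≢b , inj₁ e′ = edge-compatible a≢b e′
    ... | a≢b , inj₂ e′ = compatible-sym (edge-compatible (a≢b ∘ sym) e′)

    cut-stable : Stable G cut
    cut-stable f g f∈ g∈ e with subst₂ Compatible (∈cut f f∈) (∈cut g g∈) (adj-compatible e)
    ... | ()

    walk-A : ∀ {f g} → Walk G cut f g → lab (decode f) ≡ A → lab (decode g) ≡ A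
    walk-A (here _) eq = eq
    walk-A (next {v = v} _ e w) eq = walk-A w (stay (∉cut v (start-out w)) (subst (λ z → Compatible z _) eq (adj-compatible e)))
      where
      start-out : ∀ {f g} → Walk G cut f g → f ∉ cut
      start-out (here o)     = o
      start-out (next o _ _) = o
      stay : ∀ {x} → Side x → Compatible A x → x ≡ A
      stay sideA AA = refl

    stableCutset : StableCutset G cut
    stableCutset = cut-stable , code (ex a₁) , code (ex b₁) , side∉cut (ex a₁) sideA , side∉cut (ex b₁) sideB , separated
      where
      separated : ¬ Walk G cut (code (ex a₁)) (code (ex b₁))
      separated w with trans (sym (cong lab (decode-code (ex b₁)))) (walk-A w (cong lab (decode-code (ex a₁))))
      ... | ()

-- From a stable cutset to a hitting set

∣∪∣≤ : ∀ {k} (p q : Subset k) → ∣ p ∪ q ∣ ≤ ∣ p ∣ + ∣ q ∣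
∣∪∣≤ []          []          = z≤n
∣∪∣≤ (true ∷ p)  (true ∷ q)  = s≤s (≤-trans (∣∪∣≤ p q) (+-monoʳ-≤ ∣ p ∣ (n≤1+n _)))
∣∪∣≤ (true ∷ p)  (false ∷ q) = s≤s (∣∪∣≤ p q)
∣∪∣≤ (false ∷ p) (true ∷ q)  = ≤-trans (s≤s (∣∪∣≤ p q)) (≤-reflexive (sym (+-suc ∣ p ∣ ∣ q ∣)))
∣∪∣≤ (false ∷ p) (false ∷ q) = ∣∪∣≤ p q

module Backward {n : ℕ} (𝓕 : List (List (Fin n))) (m : ℕ)
  {es : List (Fin (∣X∣ n + length (pathV 𝓕)) × Fin (∣X∣ n + length (pathV 𝓕)))}
  (pres : Construction.Presents m (pathV 𝓕) es)
  (K : Subset (∣X∣ n + length (pathV 𝓕))) (stable : Stable (graph _ es) K) where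

  open Construction m (pathV 𝓕)
  open Facts pres

  record In (a : Vtx) : Set where
    constructor cut
    field in-cut : code a ∈ K

  open In

  Out : Vtx → Set
  Out a = ¬ In a

  in? : ∀ a → Dec (In a)
  in? a with code a ∈? K
  ... | yes a∈ = yes (cut a∈)
  ... | no  a∉ = no (a∉ ∘ in-cut)

  walk-trans : ∀ {f g h} → Walk G K f g → Walk G K g h → Walk G K f h
  walk-trans (here _)     w = w
  walk-trans (next o e v) w = next o e (walk-trans v w)

  Adj-sym : ∀ {f g} → Adj G f g → Adj G g f
  Adj-sym (f≢g , inj₁ e) = f≢g ∘ sym , inj₂ e
  Adj-sym (f≢g , inj₂ e) = f≢g ∘ sym , inj₁ e

  walk-start : ∀ {f g} → Walk G K f g → f ∉ K
  walk-start (here o)     = o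
  walk-start (next o _ _) = o

  walk-sym : ∀ {f g} → Walk G K f g → Walk G K g f
  walk-sym (here o)     = here o
  walk-sym (next o e w) = walk-trans (walk-sym w) (next (walk-start w) (Adj-sym e) (here o))

  infix 4 _~_

  record _~_ (a b : Vtx) : Set where
    constructor joined
    field walk : Walk G K (code a) (code b)

  open _~_

  ~-refl : ∀ {a} → Out a → a ~ a
  ~-refl o = joined (here (o ∘ cut))

  ~-trans : ∀ {a b c} → a ~ b → b ~ c → a ~ c
  ~-trans (joined v) (joined w) = joined (walk-trans v w)

  ~-sym : ∀ {a b} → a ~ b → b ~ a
  ~-sym (joined w) = joined (walk-sym w)

  ~-edge : ∀ {a b} → Adjacent a b → Out a → Out b → a ~ b
  ~-edge e oa ob = joined (next (oa ∘ cut) (adj⁺ e) (here (ob ∘ cut)))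

  other-out : ∀ {a b} → Adjacent a b → In b → Out a
  other-out e (cut b∈) (cut a∈) = stable _ _ a∈ b∈ (adj⁺ e)

  -- The tool behind all triangles: a vertex that sees two adjacent vertices always has a neighbour
  -- outside the cutset.
  one-out : ∀ {a b} → Adjacent a b → Out a ⊎ Out b
  one-out {a} {b} e with in? b
  ... | yes b∈ = inj₁ (other-out e b∈)
  ... | no  b∉ = inj₂ b∉

  flip : ∀ {a b} → Adjacent a b → Adjacent b a
  flip (a≢b , inj₁ e) = a≢b ∘ sym , inj₂ e
  flip (a≢b , inj₂ e) = a≢b ∘ sym , inj₁ e

  -- The counterpart of `Trace` with actual vertices: matching on the list of attachments yields the
  -- adjacencies of a stretch.
  data Real : Vtx → List (List (XV n)) → Vtx → Set where
    []    : ∀ {p} → Real p [] p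
    visit : ∀ {p d E r} q → Adjacent p q → All (λ x → Adjacent q (ex x)) d → Real q E r → Real p (d ∷ E) r

  verts : ∀ {p E r} → Real p E r → List Vtx
  verts []              = []
  verts (visit q _ _ ω) = q ∷ verts ω

  split : ∀ E {E′ p r} (ω : Real p (E ++ E′) r) →
          ∃ λ q → Σ (Real p E q) λ ω₁ → Σ (Real q E′ r) λ ω₂ → verts ω ≡ verts ω₁ ++ verts ω₂
  split []      ω               = _ , [] , ω , refl
  split (d ∷ E) (visit q e a ω) = let (s , ω₁ , ω₂ , eq) = split E ω in s , visit q e a ω₁ , ω₂ , cong (q ∷_) eq

  build : ∀ E (pos : Fin (length E) → Fin T) p →
    (∀ j → toℕ j ≡ 0 → Adjacent p (path (pos j))) →
    (∀ j j′ → toℕ j′ ≡ suc (toℕ j) → Adjacent (path (pos j)) (path (pos j′))) →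
    (∀ j {x} → x ∈ₗ lookup E j → Adjacent (path (pos j)) (ex x)) →
    ∃ λ r → Σ (Real p E r) λ ω → ∀ j → path (pos j) ∈ₗ verts ω
  build []      pos p first next′ att′ = p , [] , λ ()
  build (d ∷ E) pos p first next′ att′ =
    let (r , ω , mem) = build E (pos ∘ suc) (path (pos zero))
                          (λ j j≡ → next′ zero (suc j) (cong suc j≡)) (λ j j′ eq → next′ (suc j) (suc j′) (cong suc eq)) (λ j → att′ (suc j))
    in r , visit (path (pos zero)) (first zero refl) (All.tabulate (att′ zero)) ω , λ { zero → here refl ; (suc j) → there (mem j) }

  along-adjacent : ∀ {t t′} → toℕ t′ ≡ suc (toℕ t) → Adjacent (path t) (path t′)
  along-adjacent eq = (λ { refl → 1+n≢n (sym eq) }) , inj₁ (along eq)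

  att-adjacent : ∀ {t x} → x ∈ₗ lookup (pathV 𝓕) t → Adjacent (path t) (ex x)
  att-adjacent x∈ = (λ ()) , inj₁ (hang x∈)

  real : ∃ λ r → Σ (Real (path zero) (concatMap chunkV 𝓕) r) λ ω → ∀ j → path (suc j) ∈ₗ verts ω
  real = build (concatMap chunkV 𝓕) suc (path zero) (λ j j≡ → along-adjacent (cong suc j≡))
           (λ j j′ eq → along-adjacent (cong suc eq)) (λ j x∈ → att-adjacent x∈)

  -- If all vertices of X outside the cutset hang together, so does the rest.
  module Connected (c : Vtx) (X~c : ∀ x → Out (ex x) → ex x ~ c) where

    Conn : Vtx → Set
    Conn a = Out a → a ~ c

    near : ∀ {a b} → Adjacent a b → Out b → b ~ c → Conn a
    near e ob b~c oa = ~-trans (~-edge e oa ob) b~c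

    near-pair : ∀ {a x y} → Adjacent a (ex x) → Adjacent a (ex y) → Adjacent (ex x) (ex y) → Conn a
    near-pair ax ay xy with one-out xy
    ... | inj₁ ox = near ax ox (X~c _ ox)
    ... | inj₂ oy = near ay oy (X~c _ oy)

    -- The invariant for the predecessor of a slot: if the hub is in the cutset, the predecessor is
    -- outside and can hand its connection on.
    Good : Vtx → Set
    Good p = Adjacent p (ex hub) × Conn p

    Passes : List (List (XV n)) → Set
    Passes E = ∀ {p r} (ω : Real p E r) → Good p → Good r × All Conn (verts ω)

    passes-concat : ∀ {I : Set} {E : I → List (List (XV n))} → (∀ i → Passes (E i)) → ∀ is → Passes (concatMap E is)
    passes-concat f []       [] good = good , []
    passes-concat {E = E} f (i ∷ is) ω good with split (E i) ω
    ... | q , ω₁ , ω₂ , eq rewrite eq =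
      let (good₁ , all₁) = f i ω₁ good
          (good₂ , all₂) = passes-concat f is ω₂ good₁
      in good₂ , Allₚ.++⁺ all₁ all₂

    -- If `sel i u` is outside, both vertices hang on it. If it is inside, both vertices are
    -- outside: with the hub inside they continue the predecessor, with the hub outside they are
    -- reached from the hub through the second vertex.
    passes-slot : ∀ u i → Passes (slotV u i)
    passes-slot u i {p} (visit q₁ pq₁ (q₁sel ∷ []) (visit q₂ q₁q₂ (q₂sel ∷ q₂hub ∷ []) [])) (phub , conn-p) =
      (q₂hub , conn-q₂) , conn-q₁ ∷ conn-q₂ ∷ []
      where
      both : Conn q₁ × Conn q₂
      both with in? (ex (sel i u))
      ... | no sel∉ = near q₁sel sel∉ (X~c _ sel∉) , near q₂sel sel∉ (X~c _ sel∉)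
      ... | yes sel∈ with in? (ex hub)
      ...   | yes hub∈ = near pq₁′ op (conn-p op) , near (flip q₁q₂) oq₁ (near pq₁′ op (conn-p op) oq₁)
        where
        pq₁′ = flip pq₁
        op = other-out phub hub∈
        oq₁ = other-out q₁sel sel∈
      ...   | no hub∉ = near q₁q₂ oq₂ (near q₂hub hub∉ (X~c _ hub∉) oq₂) , near q₂hub hub∉ (X~c _ hub∉)
        where
        oq₂ = other-out q₂sel sel∈
      conn-q₁ = proj₁ both
      conn-q₂ = proj₂ both

    -- The first, second and last vertex each see two adjacent vertices of X, one of which is
    -- outside the cutset. This is why the first one sees `a₂` besides `a₁`.
    conn-chunk : ∀ us {p r} (ω : Real p (chunkV us) r) → All Conn (verts ω)
    conn-chunk us (visit z _ (za₁ ∷ za₂ ∷ _ ∷ []) (visit q _ (qa₁ ∷ qhub ∷ []) ω)) with split (concatMap elemV us) ω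
    ... | _ , ω₁ , visit t _ (tb₁ ∷ thub ∷ []) [] , eq rewrite eq =
      conn-z ∷ conn-q ∷ Allₚ.++⁺ (proj₂ (passes-concat (λ u → passes-concat (passes-slot u) (allFin n)) us ω₁ (qhub , conn-q))) (conn-t ∷ [])
      where
      conn-z = near-pair za₁ za₂ ((λ ()) , inj₁ a₁a₂)
      conn-q = near-pair qa₁ qhub ((λ ()) , inj₂ sa₁)
      conn-t = near-pair tb₁ thub ((λ ()) , inj₂ sb₁)

    conn-chunks : ∀ 𝓖 {p r} (ω : Real p (concatMap chunkV 𝓖) r) → All Conn (verts ω)
    conn-chunks []      [] = []
    conn-chunks (F ∷ 𝓖) ω with split (chunkV F) ω
    ... | _ , ω₁ , ω₂ , eq rewrite eq = Allₚ.++⁺ (conn-chunk F ω₁) (conn-chunks 𝓖 ω₂)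

    connected : ∀ a → Conn a
    connected (ex x)         = X~c x
    connected (path zero)    = near-pair (att-adjacent (here refl)) (att-adjacent (there (here refl))) ((λ ()) , inj₁ a₁a₂)
    connected (path (suc j)) = let (_ , ω , mem) = real in All.lookup (conn-chunks 𝓕 ω) (mem j)

  module _ (f g : Fin (∣X∣ n + T)) (f∉ : f ∉ K) (g∉ : g ∉ K) (separated : ¬ Walk G K f g) where

    disconnected : ∀ c → ¬ (∀ x → Out (ex x) → ex x ~ c)
    disconnected c X~c = separated (walk-trans (to f f∉) (walk-sym (to g g∉)))
      where
      open Connected c X~c
      to : ∀ f → f ∉ K → Walk G K f (code c)
      to f f∉ = subst (λ z → Walk G K z (code c)) (code-decode f)
                  (walk (connected (decode f) (λ (cut f∈) → f∉ (subst (_∈ K) (code-decode f) f∈))))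

    -- A hub outside the cutset would collect all of X: `sel i u` sees the adjacent pair `b₁`, `b₂`
    -- and `neg i u` the pair `a₁`, `a₂`, and all four are neighbours of the hub.
    hub-in : In (ex hub)
    hub-in with in? (ex hub)
    ... | yes hub∈ = hub∈
    ... | no  hub∉ = ⊥-elim (disconnected (ex hub) X~hub)
      where
      via : ∀ {x y z} → Adjacent (ex z) (ex x) → Adjacent (ex z) (ex y) → Adjacent (ex x) (ex y) →
            Adjacent (ex x) (ex hub) → Adjacent (ex y) (ex hub) → Out (ex z) → ex z ~ ex hub
      via zx zy xy xh yh oz with one-out xy
      ... | inj₁ ox = ~-trans (~-edge zx oz ox) (~-edge xh ox hub∉)
      ... | inj₂ oy = ~-trans (~-edge zy oz oy) (~-edge yh oy hub∉)
      X~hub : ∀ x → Out (ex x) → ex x ~ ex hub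
      X~hub a₁  o = ~-edge ((λ ()) , inj₂ sa₁) o hub∉
      X~hub a₂  o = ~-edge ((λ ()) , inj₂ sa₂) o hub∉
      X~hub b₁  o = ~-edge ((λ ()) , inj₂ sb₁) o hub∉
      X~hub b₂  o = ~-edge ((λ ()) , inj₂ sb₂) o hub∉
      X~hub hub o = ~-refl o
      X~hub (sel i u) = via ((λ ()) , inj₁ selb₁) ((λ ()) , inj₁ selb₂) ((λ ()) , inj₁ b₁b₂) ((λ ()) , inj₂ sb₁) ((λ ()) , inj₂ sb₂)
      X~hub (neg i u) = via ((λ ()) , inj₁ nega₁) ((λ ()) , inj₁ nega₂) ((λ ()) , inj₁ a₁a₂) ((λ ()) , inj₂ sa₁) ((λ ()) , inj₂ sa₂)

    a₁-out : Out (ex a₁)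
    a₁-out = other-out ((λ ()) , inj₂ sa₁) hub-in

    b₁-out : Out (ex b₁)
    b₁-out = other-out ((λ ()) , inj₂ sb₁) hub-in

    a≁b : ¬ (ex a₁ ~ ex b₁)
    a≁b a~b = disconnected (ex a₁) X~a₁
      where
      X~a₁ : ∀ x → Out (ex x) → ex x ~ ex a₁
      X~a₁ a₁  o = ~-refl o
      X~a₁ a₂  o = ~-edge ((λ ()) , inj₂ a₁a₂) o a₁-out
      X~a₁ b₁  o = ~-sym a~b
      X~a₁ b₂  o = ~-trans (~-edge ((λ ()) , inj₂ b₁b₂) o b₁-out) (~-sym a~b)
      X~a₁ hub o = ⊥-elim (o hub-in)
      X~a₁ (sel i u) o = ~-trans (~-edge ((λ ()) , inj₁ selb₁) o b₁-out) (~-sym a~b)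
      X~a₁ (neg i u) o = ~-edge ((λ ()) , inj₁ nega₁) o a₁-out

    sel~b₁ : ∀ {i u} → Out (ex (sel i u)) → ex (sel i u) ~ ex b₁
    sel~b₁ o = ~-edge ((λ ()) , inj₁ selb₁) o b₁-out

    -- Otherwise `a₁`, `neg i u`, `sel i u`, `b₁` would be a walk from a to b.
    neg-in : ∀ {i u} → Out (ex (sel i u)) → In (ex (neg i u))
    neg-in {i} {u} o with in? (ex (neg i u))
    ... | yes n∈ = n∈
    ... | no  n∉ = ⊥-elim (a≁b (~-trans (~-edge ((λ ()) , inj₂ nega₁) a₁-out n∉)
                     (~-trans (~-edge ((λ ()) , inj₂ selneg) n∉ o) (sel~b₁ o))))

    sel-unique : ∀ {i u u′} → Out (ex (sel i u)) → Out (ex (sel i u′)) → u ≡ u′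
    sel-unique {i} {u} {u′} o o′ with u Finₚ.≟ u′
    ... | yes eq = eq
    ... | no u≢u′ = ⊥-elim (other-out ((λ { refl → u≢u′ refl }) , inj₁ clique) (neg-in o′) (neg-in o))

    sel-active : ∀ {i u} → Out (ex (sel i u)) → toℕ i < m
    sel-active {i} {u} o with m ≤? toℕ i
    ... | no  m≰i = ≰⇒> m≰i
    ... | yes m≤i = ⊥-elim (a≁b (~-trans (~-edge ((λ ()) , inj₂ (off m≤i)) a₁-out o) (sel~b₁ o)))

    Selected : Fin n → Set
    Selected u = ∃ λ i → Out (ex (sel i u))

    selected? : ∀ u → Dec (Selected u)
    selected? u = Finₚ.any? (λ i → ¬? (in? (ex (sel i u))))

    -- If no element of F is selected, the path through the chunk of F
    -- avoids the cutset.
    module Cross (us : List (Fin n)) (unselected : ¬ Any Selected us) where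

      Reached : Vtx → Set
      Reached p = Out p × ex a₁ ~ p

      extend : ∀ {p q} → Adjacent p q → Out q → Reached p → Reached q
      extend e oq (op , w) = oq , ~-trans w (~-edge e op oq)

      sel-in : ∀ {u} i → u ∈ₗ us → In (ex (sel i u))
      sel-in {u} i u∈ with in? (ex (sel i u))
      ... | yes s∈ = s∈
      ... | no  s∉ = ⊥-elim (unselected (Any.map (λ { refl → i , s∉ }) u∈))

      cross-slots : ∀ {u} → u ∈ₗ us → ∀ is {p r} → Real p (concatMap (slotV u) is) r → Reached p → Reached r
      cross-slots u∈ []       [] w = w
      cross-slots u∈ (i ∷ is) (visit q₁ pq₁ (q₁sel ∷ []) (visit q₂ q₁q₂ (q₂sel ∷ _ ∷ []) ω)) w =
        cross-slots u∈ is ω (extend q₁q₂ (other-out q₂sel (sel-in i u∈)) (extend pq₁ (other-out q₁sel (sel-in i u∈)) w))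

      cross-elems : ∀ vs → (∀ {u} → u ∈ₗ vs → u ∈ₗ us) → ∀ {p r} → Real p (concatMap elemV vs) r → Reached p → Reached r
      cross-elems []       sub [] w = w
      cross-elems (u ∷ vs) sub ω  w with split (elemV u) ω
      ... | _ , ω₁ , ω₂ , _ = cross-elems vs (sub ∘ there) ω₂ (cross-slots (sub (here refl)) (allFin n) ω₁ w)

      cross : ∀ {p r} → Real p (chunkV us) r → Empty
      cross (visit z _ _ (visit q _ (qa₁ ∷ qhub ∷ []) ω)) with split (concatMap elemV us) ω
      ... | _ , ω₁ , visit t rt (tb₁ ∷ thub ∷ []) [] , _ =
        a≁b (~-trans (proj₂ reached) (~-edge tb₁ (proj₁ reached) b₁-out))
        where
        oq = other-out qhub hub-in
        reached : Reached t
        reached = extend rt (other-out thub hub-in)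
          (cross-elems us id ω₁ (oq , ~-edge (flip qa₁) a₁-out oq))

    chunk-of : ∀ 𝓖 {F p r} → F ∈ₗ 𝓖 → Real p (concatMap chunkV 𝓖) r → ∃₂ λ p′ r′ → Real p′ (chunkV F) r′
    chunk-of (F ∷ 𝓖) (here refl) ω = let (_ , ω₁ , _) = split (chunkV F) ω in _ , _ , ω₁
    chunk-of (F ∷ 𝓖) (there F∈)  ω = let (_ , _ , ω₂ , _) = split (chunkV F) ω in chunk-of 𝓖 F∈ ω₂

    hit : ∀ {F} → F ∈ₗ 𝓕 → Any Selected F
    hit {F} F∈ with Any.any? selected? F
    ... | yes h = h
    ... | no ¬h = let (_ , ω , _) = real ; (_ , _ , ω₁) = chunk-of 𝓕 F∈ ω in ⊥-elim (Cross.cross F ¬h ω₁)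

    -- By `sel-unique` it does not matter which element the search returns. Slots from `n` on are
    -- empty, so `union m` makes sense even for `m` above `n`.
    slotSet : ℕ → Subset n
    slotSet j with j <? n
    ... | no _ = ⊥
    ... | yes j<n with Finₚ.any? (λ u → ¬? (in? (ex (sel (fromℕ< j<n) u))))
    ...   | yes (u , _) = ⁅ u ⁆
    ...   | no _ = ⊥

    ∣slotSet∣≤1 : ∀ j → ∣ slotSet j ∣ ≤ 1
    ∣slotSet∣≤1 j with j <? n
    ... | no _ = ≤-trans (≤-reflexive (∣⊥∣≡0 n)) z≤n
    ... | yes j<n with Finₚ.any? (λ u → ¬? (in? (ex (sel (fromℕ< j<n) u))))
    ...   | yes (u , _) = ≤-reflexive (∣⁅x⁆∣≡1 u)
    ...   | no _ = ≤-trans (≤-reflexive (∣⊥∣≡0 n)) z≤n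

    ∈slotSet : ∀ {i u} → Out (ex (sel i u)) → u ∈ slotSet (toℕ i)
    ∈slotSet {i} {u} o with toℕ i <? n
    ... | no i≮n = ⊥-elim (i≮n (toℕ<n i))
    ... | yes i<n with Finₚ.any? (λ u → ¬? (in? (ex (sel (fromℕ< i<n) u))))
    ...   | yes (u′ , o′) = subst (λ z → u ∈ ⁅ z ⁆) (sel-unique o (subst (λ z → Out (ex (sel z u′))) (Finₚ.fromℕ<-toℕ i i<n) o′)) (x∈⁅x⁆ u)
    ...   | no none = ⊥-elim (none (u , subst (λ z → Out (ex (sel z u))) (sym (Finₚ.fromℕ<-toℕ i i<n)) o))

    union : ℕ → Subset n
    union zero    = ⊥
    union (suc j) = slotSet j ∪ union j

    ∣union∣≤ : ∀ j → ∣ union j ∣ ≤ j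
    ∣union∣≤ zero    = ≤-reflexive (∣⊥∣≡0 n)
    ∣union∣≤ (suc j) = ≤-trans (∣∪∣≤ (slotSet j) (union j)) (+-mono-≤ (∣slotSet∣≤1 j) (∣union∣≤ j))

    ∈union : ∀ {u} j k → u ∈ slotSet j → j < k → u ∈ union k
    ∈union j (suc k) u∈ (s≤s j≤k) with j ≟ k
    ... | yes refl = x∈p∪q⁺ (inj₁ u∈)
    ... | no  j≢k  = x∈p∪q⁺ (inj₂ (∈union j k u∈ (≤∧≢⇒< j≤k j≢k)))

    hittingSet : HasHittingSet n 𝓕 m
    hittingSet = union m , ∣union∣≤ m ,
      All.tabulate (λ F∈ → Any.map (λ (i , o) → ∈union (toℕ i) m (∈slotSet o) (sel-active o)) (hit F∈))

-- The written edge list presents the graph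

module _ {A : Set} {P : A → Set} where

  All-ʳ++ : ∀ {xs ys} → All P xs → All P ys → All P (xs ʳ++ ys)
  All-ʳ++ []       qs = qs
  All-ʳ++ (p ∷ ps) qs = All-ʳ++ ps (p ∷ qs)

  -- The index ranges over `Fin k` so that a round of the loop can be identified with a slot or an
  -- element.
  foldUp-All : ∀ k (f : ℕ → List A → List A) → (∀ (i : Fin k) {e} → All P e → All P (f (toℕ i) e)) →
               ∀ {e} → All P e → All P (foldUp f k e)
  foldUp-All zero    f step′ ps = ps
  foldUp-All (suc k) f step′ ps = subst (λ z → All P (f z (foldUp f k _))) (toℕ-fromℕ k) (step′ (fromℕ k)
    (foldUp-All k f (λ i qs → subst (λ z → All P (f z _)) (toℕ-inject₁ i) (step′ (inject₁ i) qs)) ps))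

module _ {A : Set} {z : A} where

  foldUp-keeps : ∀ k (f : ℕ → List A → List A) → (∀ i {e} → z ∈ₗ e → z ∈ₗ f i e) → ∀ {e} → z ∈ₗ e → z ∈ₗ foldUp f k e
  foldUp-keeps zero    f keep z∈ = z∈
  foldUp-keeps (suc k) f keep z∈ = keep k (foldUp-keeps k f keep z∈)

  foldUp-∈ : ∀ k (f : ℕ → List A → List A) → (∀ i {e} → z ∈ₗ e → z ∈ₗ f i e) →
             (i : Fin k) → (∀ e → z ∈ₗ f (toℕ i) e) → ∀ {e} → z ∈ₗ foldUp f k e
  foldUp-∈ (suc k) f keep i new {e} with toℕ i ≟ k
  ... | yes i≡k = subst (λ j → z ∈ₗ f j (foldUp f k e)) i≡k (new (foldUp f k e))
  ... | no  i≢k  = keep k (foldUp-∈ k f keep (fromℕ< i<k) (λ e → subst (λ j → z ∈ₗ f j e) (sym (toℕ-fromℕ< i<k)) (new e)))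
    where
    i<k : toℕ i < k
    i<k = ≤∧≢⇒< (≤-pred (toℕ<n i)) i≢k

seg-keeps : ∀ {z} (E : List (List ℕ)) t → z ∈ₗ es t → z ∈ₗ es (seg E t)
seg-keeps []      t z∈ = z∈
seg-keeps (d ∷ E) t z∈ = seg-keeps E _ (Anyₚ.reverseAcc⁺ _ (map (link (suc (v t))) d) (inj₁ (there z∈)))

module _ {X : Set} (f : X → ℕ) where

  -- As `v t` is the last vertex before the segment, the `j`-th new vertex is `suc (v t + toℕ j)`
  -- and its predecessor `v t + toℕ j`.
  seg-All : ∀ {P : ℕ × ℕ → Set} (E : List (List X)) t →
    (∀ j {x} → x ∈ₗ lookup E j → P (suc (v t + toℕ j) , f x)) → (∀ (j : Fin (length E)) → P (v t + toℕ j , suc (v t + toℕ j))) →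
    All P (es t) → All P (es (seg (map (map f) E) t))
  seg-All []      t attP alongP ps = ps
  seg-All {P} (d ∷ E) t attP alongP ps = seg-All E (vertex (map f d) t)
    (λ j {x} x∈ → subst (λ z → P (suc z , f x)) (+-suc (v t) (toℕ j)) (attP (suc j) x∈))
    (λ j → subst (λ z → P (z , suc z)) (+-suc (v t) (toℕ j)) (alongP (suc j)))
    (All-ʳ++ (Allₚ.map⁺ (Allₚ.map⁺ (All.tabulate (λ {x} x∈ → subst (λ z → P (suc z , f x)) (+-identityʳ (v t)) (attP zero x∈)))))
             (subst (λ z → P (z , suc z)) (+-identityʳ (v t)) (alongP zero) ∷ ps))

  seg-att : ∀ (E : List (List X)) t j {x} → x ∈ₗ lookup E j → (suc (v t + toℕ j) , f x) ∈ₗ es (seg (map (map f) E) t)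
  seg-att (d ∷ E) t zero {x} x∈ = seg-keeps (map (map f) E) _ (Anyₚ.reverseAcc⁺ _ (map (link (suc (v t))) (map f d))
    (inj₂ (subst (λ z → (suc z , f x) ∈ₗ map (link (suc (v t))) (map f d)) (sym (+-identityʳ (v t))) (∈-map⁺ (link (suc (v t))) (∈-map⁺ f x∈)))))
  seg-att (d ∷ E) t (suc j) {x} x∈ = subst (λ z → (suc z , f x) ∈ₗ es (seg (map (map f) E) (vertex (map f d) t))) (sym (+-suc (v t) (toℕ j)))
    (seg-att E (vertex (map f d) t) j x∈)

  seg-along : ∀ (E : List (List X)) t (j : Fin (length E)) → (v t + toℕ j , suc (v t + toℕ j)) ∈ₗ es (seg (map (map f) E) t)
  seg-along (d ∷ E) t zero = seg-keeps (map (map f) E) _ (Anyₚ.reverseAcc⁺ _ (map (link (suc (v t))) (map f d))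
    (inj₁ (here (cong (λ z → z , suc z) (+-identityʳ (v t))))))
  seg-along (d ∷ E) t (suc j) = subst (λ z → (z , suc z) ∈ₗ es (seg (map (map f) E) (vertex (map f d) t))) (sym (+-suc (v t) (toℕ j)))
    (seg-along E (vertex (map f d) t) j)

seg-xb : ∀ E t → xb (seg E t) ≡ replicate (length E) false ++ xb t
seg-xb []      t = refl
seg-xb (d ∷ E) t = trans (seg-xb E (vertex d t)) (replicate-++-∷ false (length E) (xb t))

value : ∀ {n} → XV n → ℕ
value {n} (cst c)     = toℕ c
value {n} (lit b i u) = toℕ b + (toℕ u * 2 + base n (toℕ i))

base≡∣X∣ : ∀ n → base n n ≡ ∣X∣ n
base≡∣X∣ n = trans (base-closed n n) (trans (+-comm (n * (n * 2)) 5) (cong (5 +_) (sym (*-assoc n n 2))))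

toℕ-codeX : ∀ {n} (x : XV n) → toℕ (codeX x) ≡ value x
toℕ-codeX {n} (cst c)     = toℕ-↑ˡ c (n * n * 2)
toℕ-codeX {n} (lit b i u) = begin
  toℕ (5 ↑ʳ combine (combine i u) b)          ≡⟨ toℕ-↑ʳ 5 (combine (combine i u) b) ⟩
  5 + toℕ (combine (combine i u) b)           ≡⟨ cong (5 +_) (toℕ-combine (combine i u) b) ⟩
  5 + (2 * toℕ (combine i u) + toℕ b)         ≡⟨ cong (λ z → 5 + (2 * z + toℕ b)) (toℕ-combine i u) ⟩
  5 + (2 * (n * toℕ i + toℕ u) + toℕ b)       ≡⟨ solve 4 (λ n i u b → con 5 :+ (con 2 :* (n :* i :+ u) :+ b) := b :+ (u :* con 2 :+ (i :* (n :* con 2) :+ con 5)))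
                                                   refl n (toℕ i) (toℕ u) (toℕ b) ⟩
  toℕ b + (toℕ u * 2 + (toℕ i * (n * 2) + 5)) ≡⟨ cong (λ z → toℕ b + (toℕ u * 2 + z)) (sym (base-closed n (toℕ i))) ⟩
  value (lit b i u)                           ∎
  where
  open ≡-Reasoning
  open +-*-Solver

-- Mediates between the program, which appends one slot after another, and `elemV`, which
-- concatenates over `allFin`.
snocs : {A : Set} → (ℕ → List A) → ℕ → List A
snocs g zero    = []
snocs g (suc k) = snocs g k ++ g k

snocs-suc : ∀ {A : Set} (g : ℕ → List A) k → snocs g (suc k) ≡ g 0 ++ snocs (g ∘ suc) k
snocs-suc g zero    = sym (++-identityʳ (g 0))
snocs-suc g (suc k) = trans (cong (_++ g (suc k)) (snocs-suc g k)) (++-assoc (g 0) (snocs (g ∘ suc) k) (g (suc k)))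

snocs-tabulate : ∀ {A : Set} (g : ℕ → List A) k → snocs g k ≡ concat (tabulate {n = k} (g ∘ toℕ))
snocs-tabulate g zero    = refl
snocs-tabulate g (suc k) = trans (snocs-suc g k) (cong (g 0 ++_) (snocs-tabulate (g ∘ suc) k))

slotsD-snocs : ∀ n u k → slotsD n u k ≡ snocs (λ i → ((u * 2 + base n i) ∷ []) ∷ ((u * 2 + base n i) ∷ 4 ∷ []) ∷ []) k
slotsD-snocs n u zero    = refl
slotsD-snocs n u (suc k) = cong (_++ ((u * 2 + base n k) ∷ []) ∷ ((u * 2 + base n k) ∷ 4 ∷ []) ∷ []) (slotsD-snocs n u k)

elemD-values : ∀ {n} (u : Fin n) → elemD u ≡ map (map value) (elemV u)
elemD-values {n} u = begin
  slotsD n (toℕ u) n                                          ≡⟨ slotsD-snocs n (toℕ u) n ⟩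
  snocs _ n                                                   ≡⟨ snocs-tabulate _ n ⟩
  concat (tabulate (map (map value) ∘ slotV u))               ≡⟨ cong concat (sym (map-tabulate id (map (map value) ∘ slotV u))) ⟩
  concatMap (map (map value) ∘ slotV u) (allFin n)            ≡⟨ sym (map-concatMap (map value) (slotV u) (allFin n)) ⟩
  map (map value) (elemV u)                                   ∎
  where open ≡-Reasoning

chunkD-values : ∀ {n} (us : List (Fin n)) → chunkD us ≡ map (map value) (chunkV us)
chunkD-values us = cong (λ z → (0 ∷ 1 ∷ 2 ∷ []) ∷ (0 ∷ 4 ∷ []) ∷ z) (begin
  concatMap elemD us ++ _                                ≡⟨ cong (_++ _) (trans (concatMap-cong elemD-values us) (sym (map-concatMap (map value) elemV us))) ⟩
  map (map value) (concatMap elemV us) ++ _              ≡⟨ sym (map-++ (map value) (concatMap elemV us) _) ⟩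
  map (map value) (concatMap elemV us ++ ((b₁ ∷ hub ∷ []) ∷ [])) ∎)
  where open ≡-Reasoning

chunksD-values : ∀ {n} (𝓕 : List (List (Fin n))) → concatMap chunkD 𝓕 ≡ map (map value) (concatMap chunkV 𝓕)
chunksD-values 𝓕 = trans (concatMap-cong chunkD-values 𝓕) (sym (map-concatMap (map value) chunkV 𝓕))

module Written {n : ℕ} (𝓕 : List (List (Fin n))) (m : ℕ) where

  open Construction m (pathV 𝓕)

  E : List (List (XV n))
  E = concatMap chunkV 𝓕

  number : Vtx → ℕ
  number (ex x)   = value x
  number (path t) = base n n + toℕ t

  toℕ-code : ∀ a → toℕ (code a) ≡ number a
  toℕ-code (ex x)   = trans (toℕ-↑ˡ (codeX x) T) (toℕ-codeX x)
  toℕ-code (path t) = trans (toℕ-↑ʳ (∣X∣ n) t) (cong (_+ toℕ t) (sym (base≡∣X∣ n)))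

  Good : ℕ × ℕ → Set
  Good (p , q) = ∃₂ λ a b → Edge a b × number a ≡ p × number b ≡ q

  good : ∀ {a b} → Edge a b → Good (number a , number b)
  good e = _ , _ , e , refl , refl

  start₁ : Trail
  start₁ = trail (base n n) (false ∷ ones (base n n)) ((base n n , 1) ∷ (base n n , 0) ∷ xEdges n)

  pathTrail≡ : pathTrail n 𝓕 ≡ seg (map (map value) E) start₁
  pathTrail≡ = cong (λ z → seg z start₁) (chunksD-values 𝓕)

  written : List (ℕ × ℕ)
  written = es (finalTrail n 𝓕 m)

  written≡ : written ≡ foldUp (disableStep n m) n (es (seg (map (map value) E) start₁))
  written≡ = cong (λ z → foldUp (disableStep n m) n (es z)) pathTrail≡

  xEdges-good : All Good (xEdges n)
  xEdges-good = foldUp-All n (slotStep n) (λ i → foldUp-All n _ (λ u → sel-good i u))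
    (good sb₂ ∷ good sb₁ ∷ good sa₂ ∷ good sa₁ ∷ good b₁b₂ ∷ good a₁a₂ ∷ [])
    where
    sel-good : ∀ (i u : Fin n) {e} → All Good e → All Good (selStep n (base n (toℕ i)) (toℕ u * 2 + base n (toℕ i)) e)
    sel-good i u ps = foldUp-All n _
      (λ u′ qs → (ex (neg i u) , ex (neg i u′) , clique , refl , cong (λ z → suc (toℕ u′ * 2 + z)) (sym (+-identityʳ _))) ∷ qs)
      (good (selneg {i} {u}) ∷ good (nega₂ {i} {u}) ∷ good (nega₁ {i} {u}) ∷ good (selb₂ {i} {u}) ∷ good (selb₁ {i} {u}) ∷ ps)

  number-zero : number (path zero) ≡ base n n
  number-zero = +-identityʳ _

  start-good : All Good (es start₁)
  start-good = (path zero , ex a₂ , hang (there (here refl)) , number-zero , refl) ∷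
               (path zero , ex a₁ , hang (here refl) , number-zero , refl) ∷ xEdges-good

  number-inject₁ : (j : Fin (length E)) → number (path (inject₁ j)) ≡ base n n + toℕ j
  number-inject₁ j = cong (base n n +_) (toℕ-inject₁ j)

  written-good : All Good written
  written-good = subst (All Good) (sym written≡) (foldUp-All n (disableStep n m) row
    (seg-All value E start₁
      (λ j x∈ → path (suc j) , _ , hang x∈ , +-suc (base n n) (toℕ j) , refl)
      (λ j → path (inject₁ j) , path (suc j) , along (cong suc (sym (toℕ-inject₁ j))) , number-inject₁ j , +-suc (base n n) (toℕ j))
      start-good))
    where
    row : ∀ (i : Fin n) {e} → All Good e → All Good (disableStep n m (toℕ i) e)
    row i ps with m ≤? toℕ i
    ... | yes m≤i = foldUp-All n _ (λ u qs → good (off {i} {u} m≤i) ∷ qs) ps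
    ... | no  _   = ps

  private
    keep-sel : ∀ {z} b x {e} → z ∈ₗ e → z ∈ₗ selStep n b x e
    keep-sel b x z∈ = foldUp-keeps n (cliqueStep x b) (λ _ → there) (there (there (there (there (there z∈)))))

    keep-slot : ∀ {z} i {e} → z ∈ₗ e → z ∈ₗ slotStep n i e
    keep-slot i = foldUp-keeps n _ (λ u → keep-sel (base n i) (u * 2 + base n i))

    keep-disable : ∀ {z} i {e} → z ∈ₗ e → z ∈ₗ disableStep n m i e
    keep-disable i z∈ with m ≤? i
    ... | yes _ = foldUp-keeps n _ (λ _ → there) z∈
    ... | no  _ = z∈

    from-seg : ∀ {z} → z ∈ₗ es (seg (map (map value) E) start₁) → z ∈ₗ written
    from-seg z∈ = subst (_ ∈ₗ_) (sym written≡) (foldUp-keeps n (disableStep n m) keep-disable z∈)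

    from-start : ∀ {z} → z ∈ₗ es start₁ → z ∈ₗ written
    from-start z∈ = from-seg (seg-keeps (map (map value) E) start₁ z∈)

    from-x : ∀ {z} → z ∈ₗ xEdges n → z ∈ₗ written
    from-x z∈ = from-start (there (there z∈))

    from-const : ∀ {z} → z ∈ₗ constEdges → z ∈ₗ written
    from-const z∈ = from-x (foldUp-keeps n (slotStep n) keep-slot z∈)

    from-sel : ∀ {z} (i u : Fin n) → (∀ e → z ∈ₗ selStep n (base n (toℕ i)) (toℕ u * 2 + base n (toℕ i)) e) → z ∈ₗ written
    from-sel i u new = from-x (foldUp-∈ n (slotStep n) keep-slot i
      (λ e → foldUp-∈ n _ (λ u → keep-sel (base n (toℕ i)) (u * 2 + base n (toℕ i))) u new))

    from-sel₅ : ∀ {z} (i u : Fin n) → let x = toℕ u * 2 + base n (toℕ i) in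
      (∀ e → z ∈ₗ (x , suc x) ∷ (suc x , 1) ∷ (suc x , 0) ∷ (x , 3) ∷ (x , 2) ∷ e) → z ∈ₗ written
    from-sel₅ i u new = from-sel i u (λ e → foldUp-keeps n (cliqueStep _ _) (λ _ → there) (new e))

  written-all : ∀ {a b} → Edge a b → (number a , number b) ∈ₗ written
  written-all a₁a₂ = from-const (there (there (there (there (there (here refl))))))
  written-all b₁b₂ = from-const (there (there (there (there (here refl)))))
  written-all sa₁  = from-const (there (there (there (here refl))))
  written-all sa₂  = from-const (there (there (here refl)))
  written-all sb₁  = from-const (there (here refl))
  written-all sb₂  = from-const (here refl)
  written-all (selb₁ {i} {u})  = from-sel₅ i u (λ _ → there (there (there (there (here refl)))))
  written-all (selb₂ {i} {u})  = from-sel₅ i u (λ _ → there (there (there (here refl))))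
  written-all (nega₁ {i} {u})  = from-sel₅ i u (λ _ → there (there (here refl)))
  written-all (nega₂ {i} {u})  = from-sel₅ i u (λ _ → there (here refl))
  written-all (selneg {i} {u}) = from-sel₅ i u (λ _ → here refl)
  written-all (clique {i} {u} {u′}) = from-sel i u (λ e → foldUp-∈ n _ (λ _ → there) u′
    (λ _ → here (cong (λ z → suc (toℕ u * 2 + base n (toℕ i)) , suc (toℕ u′ * 2 + z)) (sym (+-identityʳ _)))))
  written-all (off {i} {u} m≤i) = subst (_ ∈ₗ_) (sym written≡) (foldUp-∈ n (disableStep n m) keep-disable i row)
    where
    row : ∀ e → (toℕ u * 2 + base n (toℕ i) , 0) ∈ₗ disableStep n m (toℕ i) e
    row e with m ≤? toℕ i
    ... | yes _   = foldUp-∈ n _ (λ _ → there) u (λ _ → here refl)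
    ... | no  m≰i = ⊥-elim (m≰i m≤i)
  written-all (hang {zero} (here refl))         = from-start (there (here (cong (_, 0) number-zero)))
  written-all (hang {zero} (there (here refl))) = from-start (here (cong (_, 1) number-zero))
  written-all (hang {suc j} {x} x∈) = from-seg (subst (λ z → (z , value x) ∈ₗ es (seg (map (map value) E) start₁)) (sym (+-suc (base n n) (toℕ j))) (seg-att value E start₁ j x∈))
  written-all (along {t} {suc j} eq) = from-seg (subst₂ (λ k z → (k , z) ∈ₗ es (seg (map (map value) E) start₁))
    (cong (base n n +_) (suc-injective eq)) (sym (+-suc (base n n) (toℕ j))) (seg-along value E start₁ j))

  Pair : Set
  Pair = Fin (∣X∣ n + T) × Fin (∣X∣ n + T)

  -- The edges of the graph are extracted from the proof that each written pair of numbers is an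
  -- edge; this proof carries the vertices.
  pairs : ∀ {l} → All Good l → List Pair
  pairs []                     = []
  pairs ((a , b , _) ∷ goods)  = (code a , code b) ∷ pairs goods

  pairs⁻ : ∀ {l a b} (goods : All Good l) → (code a , code b) ∈ₗ pairs goods → Edge a b
  pairs⁻ {a = a} {b} ((a′ , b′ , e , _) ∷ goods) (here eq) =
    subst₂ Edge (code-injective {a′} {a} (sym (proj₁ (,-injective eq)))) (code-injective {b′} {b} (sym (proj₂ (,-injective eq)))) e
  pairs⁻ (_ ∷ goods) (there e∈) = pairs⁻ goods e∈

  pairs⁺ : ∀ {l a b} (goods : All Good l) → (number a , number b) ∈ₗ l → (code a , code b) ∈ₗ pairs goods
  pairs⁺ {a = a} {b} ((a′ , b′ , _ , refl , refl) ∷ goods) (here eq) =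
    here (cong₂ _,_ (number-injective {a} {a′} (proj₁ (,-injective eq))) (number-injective {b} {b′} (proj₂ (,-injective eq))))
    where
    number-injective : ∀ {a b} → number a ≡ number b → code a ≡ code b
    number-injective {a} {b} eq = toℕ-injective (trans (toℕ-code a) (trans eq (sym (toℕ-code b))))
  pairs⁺ {a = a} {b} (_ ∷ goods) (there e∈) = there (pairs⁺ {a = a} {b} goods e∈)

  edgeList : List Pair
  -- The program collects its edges last first, and `assemble` reverses them.
  edgeList = reverse (pairs written-good)

  presents : Presents edgeList
  presents = record
    { edge⁺ = λ {a} {b} e → Anyₚ.reverse⁺ (pairs⁺ {a = a} {b} written-good (written-all e))
    ; edge⁻ = λ {a} {b} e∈ → pairs⁻ {a = a} {b} written-good (Anyₚ.reverse⁻ e∈)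
    }

  open Facts presents public

  encPairF : Pair → Str
  encPairF e = encFin (proj₁ e) ++ encFin (proj₂ e)

  ones-ʳ++ : ∀ k x → ones k ʳ++ (false ∷ x) ≡ encℕ k ++ x
  ones-ʳ++ k x = trans (replicate-ʳ++ true k (false ∷ x)) (sym (++-assoc (ones k) (false ∷ []) x))

  -- `acc` collects the edges already reversed, so that the induction follows the accumulator of
  -- `ʳ++`.
  encE-pairs : ∀ {l} (goods : All Good l) acc x →
    encE l ʳ++ (concatMap encPairF acc ++ x) ≡ concatMap encPairF (pairs goods ʳ++ acc) ++ x
  encE-pairs [] acc x = refl
  encE-pairs {(_ , _) ∷ l} ((a , b , _ , refl , refl) ∷ goods) acc x = begin
    (ones q ++ (false ∷ ones p ++ encE l)) ʳ++ (false ∷ tl)            ≡⟨ ++-ʳ++ (ones q) ⟩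
    (ones p ++ encE l) ʳ++ (false ∷ (ones q ʳ++ (false ∷ tl)))         ≡⟨ ++-ʳ++ (ones p) ⟩
    encE l ʳ++ (ones p ʳ++ (false ∷ (ones q ʳ++ (false ∷ tl))))        ≡⟨ cong (encE l ʳ++_) (trans (ones-ʳ++ p _) (cong (encℕ p ++_) (ones-ʳ++ q tl))) ⟩
    encE l ʳ++ (encℕ p ++ (encℕ q ++ tl))                              ≡⟨ cong₂ (λ p q → encE l ʳ++ (encℕ p ++ (encℕ q ++ tl))) (sym (toℕ-code a)) (sym (toℕ-code b)) ⟩
    encE l ʳ++ (encFin (code a) ++ (encFin (code b) ++ tl))            ≡⟨ cong (encE l ʳ++_) (sym (++-assoc (encFin (code a)) (encFin (code b)) tl)) ⟩
    encE l ʳ++ (encPairF (code a , code b) ++ tl)                      ≡⟨ cong (encE l ʳ++_) (sym (++-assoc (encPairF (code a , code b)) (concatMap encPairF acc) x)) ⟩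
    encE l ʳ++ (concatMap encPairF ((code a , code b) ∷ acc) ++ x)    ≡⟨ encE-pairs goods ((code a , code b) ∷ acc) x ⟩
    concatMap encPairF (pairs goods ʳ++ ((code a , code b) ∷ acc)) ++ x ∎
    where
    open ≡-Reasoning
    p = number a
    q = number b
    tl = concatMap encPairF acc ++ x

  length-pairs : ∀ {l} (goods : All Good l) → length (pairs goods) ≡ length l
  length-pairs []          = refl
  length-pairs (_ ∷ goods) = cong suc (length-pairs goods)

  bits-X : xb (finalTrail n 𝓕 m) ʳ++ [] ≡ Vec.toList X
  bits-X = begin
    xb (pathTrail n 𝓕) ʳ++ []                                        ≡⟨ cong (λ z → xb z ʳ++ []) pathTrail≡ ⟩
    xb (seg (map (map value) E) start₁) ʳ++ []                       ≡⟨ cong (_ʳ++ []) (seg-xb (map (map value) E) start₁) ⟩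
    (replicate (length (map (map value) E)) false ++ false ∷ ones (base n n)) ʳ++ []
                                                                     ≡⟨ ++-ʳ++ (replicate (length (map (map value) E)) false) ⟩
    ones (base n n) ʳ++ (false ∷ (replicate (length (map (map value) E)) false ʳ++ []))
      ≡⟨ trans (ones-ʳ++ (base n n) _) (++-assoc (ones (base n n)) (false ∷ []) _) ⟩
    ones (base n n) ++ false ∷ (replicate (length (map (map value) E)) false ʳ++ [])
      ≡⟨ cong₂ (λ k z → ones k ++ false ∷ z) (base≡∣X∣ n) (trans (replicate-ʳ++ false (length (map (map value) E)) []) (trans (++-identityʳ _) (cong (λ k → replicate k false) (length-map (map value) E)))) ⟩
    replicate (∣X∣ n) true ++ replicate T false
      ≡⟨ cong₂ _++_ (sym (Vecₚ.toList-replicate (∣X∣ n) true)) (sym (Vecₚ.toList-replicate T false)) ⟩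
    Vec.toList (Vec.replicate (∣X∣ n) true) ++ Vec.toList (Vec.replicate T false)
      ≡⟨ sym (Vecₚ.toList-++ (Vec.replicate (∣X∣ n) true) (Vec.replicate T false)) ⟩
    Vec.toList X ∎
    where open ≡-Reasoning

  order : v (finalTrail n 𝓕 m) ≡ ∣X∣ n + T
  order = begin
    suc (v (pathTrail n 𝓕))                      ≡⟨ cong (suc ∘ v) pathTrail≡ ⟩
    suc (v (seg (map (map value) E) start₁))     ≡⟨ cong suc (seg-v (map (map value) E) start₁) ⟩
    suc (length (map (map value) E) + base n n)  ≡⟨ cong₂ (λ a b → suc (a + b)) (length-map (map value) E) (base≡∣X∣ n) ⟩
    T + ∣X∣ n                                    ≡⟨ +-comm T (∣X∣ n) ⟩
    ∣X∣ n + T                                    ∎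
    where open ≡-Reasoning

  payload-encSC : payload (finalTrail n 𝓕 m) ≡ encSC G X
  payload-encSC = begin
    payload (finalTrail n 𝓕 m)
      ≡⟨ trans (ones-ʳ++ (v (finalTrail n 𝓕 m)) _) (cong₂ (λ k z → encℕ k ++ z) order (ones-ʳ++ (length written) _)) ⟩
    encℕ (∣X∣ n + T) ++ (encℕ (length written) ++ (encE written ʳ++ (xb (finalTrail n 𝓕 m) ʳ++ [])))
      ≡⟨ cong₂ (λ k z → encℕ (∣X∣ n + T) ++ (encℕ k ++ z)) (sym (trans (length-reverse (pairs written-good)) (length-pairs written-good)))
           (trans (cong (encE written ʳ++_) bits-X) (encE-pairs written-good [] (Vec.toList X))) ⟩
    encℕ (∣X∣ n + T) ++ (encℕ (length edgeList) ++ (concatMap encPairF edgeList ++ Vec.toList X))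
      ≡⟨ cong (encℕ (∣X∣ n + T) ++_) (sym (++-assoc (encℕ (length edgeList)) (concatMap encPairF edgeList) (Vec.toList X))) ⟩
    encSC G X ∎
    where open ≡-Reasoning

-- Injectivity of the instance codes and the reduction

encHS-injective : ∀ {n n′ 𝓕 𝓕′ m m′} → encHS n 𝓕 m ≡ encHS n′ 𝓕′ m′ →
                  _≡_ {A = Σ ℕ λ n → List (List (Fin n)) × ℕ} (n , 𝓕 , m) (n′ , 𝓕′ , m′)
encHS-injective {n} {n′} {𝓕} {𝓕′} {m} {m′} eq with pf-ℕ n n′ _ _ eq
... | refl , eq₁ with pf-List (pf-List pf-Fin) 𝓕 𝓕′ _ _ eq₁
... | refl , eq₂ with pf-ℕ m m′ [] [] (cong (_++ []) eq₂)
... | refl , _ = refl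

pf-pair : ∀ {k} → PrefixFree {Fin k × Fin k} (λ e → encFin (proj₁ e) ++ encFin (proj₂ e))
pf-pair (a , b) (c , d) x y eq =
  let (p , q) = pf-Fin a c _ _ (trans (sym (++-assoc (encFin a) (encFin b) x)) (trans eq (++-assoc (encFin c) (encFin d) y)))
      (r , s) = pf-Fin b d x y q
  in cong₂ _,_ p r , s

toList-injective : ∀ {k} (x y : Vec Bool k) → Vec.toList x ≡ Vec.toList y → x ≡ y
toList-injective x y eq = trans (sym (Vecₚ.cast-is-id refl x)) (Vecₚ.toList-injective refl x y eq)

-- A yes-instance only provides some graph with the given code; injectivity identifies it with the
-- constructed one.
encSC-injective : ∀ {G G′ X X′} → encSC G X ≡ encSC G′ X′ →
                  _≡_ {A = Σ Graph λ G → Subset (Graph.n G)} (G , X) (G′ , X′)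
encSC-injective {graph n₁ es₁} {graph n₂ es₂} {X} {X′} eq with pf-ℕ n₁ n₂ _ _ eq
... | refl , eq₁ with pf-List pf-pair es₁ es₂ _ _ eq₁
... | refl , eq₂ with toList-injective X X′ eq₂
... | refl = refl

Target : ∀ {n} → List (List (Fin n)) → ℕ → Str × ℕ
Target {n} 𝓕 m = payload (finalTrail n 𝓕 m) , base n n

target-correct : ∀ {n} (𝓕 : List (List (Fin n))) m →
  (HasHittingSet n 𝓕 m → StableCutset-modLinForest (proj₁ (Target 𝓕 m)) (proj₂ (Target 𝓕 m))) ×
  (StableCutset-modLinForest (proj₁ (Target 𝓕 m)) (proj₂ (Target 𝓕 m)) → HasHittingSet n 𝓕 m)
target-correct {n} 𝓕 m = to , from
  where
  open Construction m (pathV 𝓕) using (X; ∣X∣-size)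
  open Written 𝓕 m using (G; presents; payload-encSC; linearForest)
  to : HasHittingSet n 𝓕 m → StableCutset-modLinForest (proj₁ (Target 𝓕 m)) (proj₂ (Target 𝓕 m))
  to (H , H≤m , hits) = G , X , payload-encSC , trans (base≡∣X∣ n) (sym ∣X∣-size) , linearForest ,
    Forward.cut 𝓕 m H H≤m hits , Forward.stableCutset 𝓕 m H H≤m hits presents
  from : StableCutset-modLinForest (proj₁ (Target 𝓕 m)) (proj₂ (Target 𝓕 m)) → HasHittingSet n 𝓕 m
  from (G′ , X′ , eq , _ , _ , cutset) = back (encSC-injective {G′} {G} {X′} {X} (trans (sym eq) payload-encSC)) cutset
    where
    back : _≡_ {A = Σ Graph λ G → Subset (Graph.n G)} (G′ , X′) (G , X) → HasStableCutset G′ → HasHittingSet n 𝓕 m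
    back refl (K , stable , f , g , f∉ , g∉ , separated) = Backward.hittingSet 𝓕 m presents K stable f g f∉ g∉ separated

outcome : ∀ x p → Main.Outcome (loopBound (length x)) x p
outcome x p = Main.main-exec _ (length x) x p ≤-refl refl

reduce-with : ∀ {x p W} → Main.Outcome W x p → Str × ℕ
reduce-with (inj₁ ((n , 𝓕 , m , _) , _)) = Target 𝓕 m
-- The empty string codes no graph, so this is a no-instance; `refuse` writes the code of this pair.
reduce-with (inj₂ _)                     = [] , 0

reduce : Str → ℕ → Str × ℕ
reduce x p = reduce-with {x} {p} (outcome x p)

-- The machine runs with a larger loop bound than the one in `reduce`. The result is the same,
-- because the instance is determined by its code.
reduce-with-unique : ∀ {x p W W′} (o : Main.Outcome W x p) (o′ : Main.Outcome W′ x p) →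
                     reduce-with {x} {p} {W} o ≡ reduce-with {x} {p} {W′} o′
reduce-with-unique (inj₁ ((n , 𝓕 , m , eq , _) , _)) (inj₁ ((n′ , 𝓕′ , m′ , eq′ , _) , _)) =
  cong (λ (n , 𝓕 , m) → Target 𝓕 m) (encHS-injective {n} {n′} {𝓕} {𝓕′} {m} {m′} (trans (sym eq) eq′))
reduce-with-unique (inj₁ (inst , _)) (inj₂ (¬inst , _)) = ⊥-elim (¬inst inst)
reduce-with-unique (inj₂ (¬inst , _)) (inj₁ (inst , _)) = ⊥-elim (¬inst inst)
reduce-with-unique (inj₂ _) (inj₂ _) = refl

reduce-correct : ∀ x p →
  (HittingSet-n x p → StableCutset-modLinForest (proj₁ (reduce x p)) (proj₂ (reduce x p))) ×
  (StableCutset-modLinForest (proj₁ (reduce x p)) (proj₂ (reduce x p)) → HittingSet-n x p)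
reduce-correct x p = go′ (outcome x p)
  where
  go′ : ∀ {W} (o : Main.Outcome W x p) → let (y , q) = reduce-with {x} {p} {W} o in
    (HittingSet-n x p → StableCutset-modLinForest y q) × (StableCutset-modLinForest y q → HittingSet-n x p)
  go′ (inj₁ ((n , 𝓕 , m , eq , p≡) , _)) =
    (λ (n′ , 𝓕′ , m′ , eq′ , _ , h) → proj₁ (target-correct 𝓕 m)
      (move (encHS-injective {n′} {n} {𝓕′} {𝓕} {m′} {m} (trans (sym eq′) eq)) h)) ,
    (λ sc → n , 𝓕 , m , eq , p≡ , proj₂ (target-correct 𝓕 m) sc)
    where
    move : ∀ {n′ 𝓕′ m′} → _≡_ {A = Σ ℕ λ n → List (List (Fin n)) × ℕ} (n′ , 𝓕′ , m′) (n , 𝓕 , m) → HasHittingSet n′ 𝓕′ m′ → HasHittingSet n 𝓕 m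
    move refl h = h
  go′ (inj₂ (¬inst , _)) = (λ (n , 𝓕 , m , eq , p≡ , _) → ⊥-elim (¬inst (n , 𝓕 , m , eq , p≡))) , (λ (G , X , eq , _) → ⊥-elim (nonempty (Graph.n G) eq))
    where
    nonempty : ∀ k {x} → [] ≢ encℕ k ++ x
    nonempty zero    ()
    nonempty (suc k) ()

reduce-parameter : ∀ x p → proj₂ (reduce x p) ≤ base p p
reduce-parameter x p = go′ (outcome x p)
  where
  go′ : ∀ {W} (o : Main.Outcome W x p) → proj₂ (reduce-with {x} {p} {W} o) ≤ base p p
  go′ (inj₁ ((n , 𝓕 , m , _ , refl) , _)) = ≤-refl
  go′ (inj₂ _) = z≤n

length≤encPair : ∀ x p → length x ≤ length (encPair x p)
length≤encPair []      p = z≤n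
length≤encPair (b ∷ x) p = s≤s (m≤n⇒m≤1+n (length≤encPair x p))

program-result : ∀ b x p → length (encPair x p) ≤ b →
  Result main assemble (loopBound b) (encPair x p) (encPair (proj₁ (reduce x p)) (proj₂ (reduce x p)))
program-result b x p le = subst (λ r → Result main assemble (loopBound b) (encPair x p) (encPair (proj₁ r) (proj₂ r)))
  (reduce-with-unique {x} {p} {loopBound b} o (outcome x p)) (go′ o)
  where
  o : Main.Outcome (loopBound b) x p
  o = Main.main-exec (loopBound b) b x p (≤-trans (length≤encPair x p) le) refl
  go′ : (o : Main.Outcome (loopBound b) x p) → let (y , q) = reduce-with {x} {p} {loopBound b} o in
        Result main assemble (loopBound b) (encPair x p) (encPair y q)
  go′ (inj₁ ((n , 𝓕 , m , _) , d , run)) = accepts run (λ small → assemble-exec _ n (finalTrail n 𝓕 m) d small)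
  go′ (inj₂ (_ , run)) = refuses run

pb-base : ∀ {f g} → PolyBounded f → PolyBounded g → PolyBounded (λ b → base (f b) (g b))
pb-base {f} {g} pf pg = pb-≤ (λ b → ≤-reflexive (base-closed (f b) (g b))) (pb-+ (pb-* pg (pb-* pf (pb-const 2))) (pb-const 5))

pb-loopBound : PolyBounded loopBound
pb-loopBound = pb-+ (pb-const 2) (pb-+ (pb-base pb-id (pb-+ (pb-const 1) pb-id)) (pb-* pb-id (pb-+ (pb-* pb-id (pb-const 2)) (pb-const 3))))

theorem7 : (Q : ParamProblem) → InMK2 Q → PPT Q StableCutset-modLinForest
theorem7 Q (F , computable , correct , c , bounded) =
  (λ x k → reduce (proj₁ (F x k)) (proj₂ (F x k))) ,
  -- The machine of the given transformation is extended in place, so the stack programs only ever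
  -- meet codes of pairs.
  postcompose {F} main assemble loopBound reduce pb-loopBound program-result computable ,
  (λ x k → let (to , from) = correct x k ; (to′ , from′) = reduce-correct (proj₁ (F x k)) (proj₂ (F x k)) in to′ ∘ to , from ∘ from′) ,
  (let (c′ , le) = ≤-poly (pb-base (pb-poly c) (pb-poly c)) in
   c′ , λ x k → ≤-trans (reduce-parameter (proj₁ (F x k)) (proj₂ (F x k))) (≤-trans (base-mono² (bounded x k) (bounded x k)) (le k)))
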